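{- Let $p$ be an odd prime and $k\in\mathbb{N}$ with $2\le k\le\frac{p-1}{2}$ such that $p\equiv 1\pmod{2k}$. Let $\alpha_1,\ldots,\alpha_{(p-1)/k}$ be the distinct $k$-th power residues modulo $p$ and let $T\left(\frac{p-1}{k}\right)=\prod_{1\le i<j\le\frac{p-1}{k}}(\alpha_i-\alpha_j)$. (a) If $p\equiv 1\pmod{4k}$, then $$\left(\frac{\sqrt{S_{3+\frac{p-1}{k},k}(-1,p)}}{p}\right)=\left(\frac{k(3k-1)(4k-1)\left(6k^3+(3k-1)(2k-1)(k-1)\right)}{p}\right)\left(\frac{\left(\frac{p-1}{k}-1\right)!!}{p}\right)\left(\frac{T\left(\frac{p-1}{k}\right)}{p}\right).$$ (b) If $k$ is even and $p\equiv 2k+1\pmod{4k}$, then $\left(\frac{\sqrt{S_{3+\frac{p-1}{k},k}(-1,p)}}{p}\right)$ equals $\left(\frac{T\left(\frac{p-1}{k}\right)}{p}\right)$ if $p=2k+1$, and otherwise equals $$\left(\frac{(k-1)(2k-1)(4k-1)\left(6k^3+(3k-1)(2k-1)(k-1)\right)}{p}\right)\left(\frac{\left(\frac{p-1}{k}\right)!!}{p}\right)\left(\frac{T\left(\frac{p-1}{k}\right)}{p}\right).$$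
   Context: For an odd prime $p$ and an integer $k\ge 2$ with $k\mid p-1$, the $\alpha_i$ $(1\le i\le\frac{p-1}{k})$ are integers representing the distinct (nonzero) $k$-th power residues modulo $p$, and for $n\in\mathbb{N}$, $d\in\mathbb{Z}$, $$S_{n,k}(d,p)=\det\left[(\alpha_i+d\,\alpha_j)^n\right]_{1\le i,j\le \frac{p-1}{k}}.$$ When $p\equiv 1\pmod{2k}$ and $n$ is odd, $S_{n,k}(-1,p)$ is the determinant of a skew-symmetric integer matrix of even order, hence the square of an integer, and $\sqrt{S_{n,k}(-1,p)}$ denotes its integer square root (the sign is immaterial inside the Legendre symbol when $p\equiv 1\pmod 4$, which is so in all the cases considered). $\left(\frac{\cdot}{p}\right)$ is the Legendre symbol. For $a\in\mathbb{N}$, $a!!$ is the double factorial: $a!!=a\cdot(a-2)!!$ if $a>2$ and $a!!=a$ if $a\in\{1,2\}$. -}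

module Defs where

open import Data.Bool.Base using (if_then_else_)
open import Data.Fin.Base as Fin using (Fin; zero; suc; toℕ; punchIn)
import Data.Fin.Properties as Fin
open import Data.Integer.Base as ℤ using (ℤ; +_; -[1+_]; _+_; _-_; _*_; _^_; -1ℤ; 0ℤ; 1ℤ)
open import Data.Integer.Divisibility.Signed using (_∣_; _∣?_)
import Data.Integer.Properties as ℤ
open import Data.Nat.Base as ℕ using (ℕ; zero; suc)
import Data.Nat.Properties as ℕ
open import Data.Product.Base using (∃; _×_)
open import Data.Vec.Functional using (Vector)
open import Relation.Binary.PropositionalEquality.Core using (_≡_)
open import Relation.Nullary using (¬_; Dec; does)

open import Algebra.Properties.CommutativeMonoid.Sum ℤ.+-0-commutativeMonoid public
  using (sum)
open import Algebra.Properties.CommutativeMonoid.Sum ℤ.*-1-commutativeMonoid public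
  using () renaming (sum to product)

infix 4 _≡_[mod_]

_≡_[mod_] : ℤ → ℤ → ℕ → Set
a ≡ b [mod n ] = + n ∣ a - b

-- Laplace expansion along the first row.
det : ∀ {n} → (Fin n → Fin n → ℤ) → ℤ
det {zero}  M = 1ℤ
det {suc n} M =
  sum λ j → -1ℤ ^ toℕ j * M zero j * det (λ r c → M (suc r) (punchIn j c))

IsPowerResidue : ℕ → ℕ → ℤ → Set
IsPowerResidue k p a = ¬ (+ p ∣ a) × ∃ λ (x : ℤ) → x ^ k ≡ a [mod p ]

-- Integer representatives, in some order and without repetition modulo p,
-- of all the nonzero k-th power residues modulo p.
record EnumeratesPowerResidues (k p : ℕ) {m : ℕ} (α : Vector ℤ m) : Set where
  field
    residue  : ∀ i → IsPowerResidue k p (α i)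
    distinct : ∀ i j → α i ≡ α j [mod p ] → i ≡ j
    complete : ∀ a → IsPowerResidue k p a → ∃ λ i → α i ≡ a [mod p ]

S : ∀ {m} → ℕ → ℤ → Vector ℤ m → ℤ
S n d α = det λ i j → (α i + d * α j) ^ n

T : ∀ {m} → Vector ℤ m → ℤ
T α = product λ i → product λ j → if does (i Fin.<? j) then α i - α j else 1ℤ

⌊√_⌋ : ℕ → ℕ
⌊√ zero  ⌋ = 0
⌊√ suc n ⌋ = next ⌊√ n ⌋
  where
  next : ℕ → ℕ
  next r = if does (suc r ℕ.* suc r ℕ.≤? suc n) then suc r else r

-- The nonnegative square root of a perfect square; on other integers the
-- value is a convention (floor of the root, or 0 for negative numbers).
√ : ℤ → ℤ
√ (+ n)    = + ⌊√ n ⌋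
√ -[1+ _ ] = 0ℤ

isSquareMod? : (a : ℤ) (p : ℕ) →
               Dec (∃ λ (x : Fin p) → (+ toℕ x) ^ 2 ≡ a [mod p ])
isSquareMod? a p = Fin.any? λ x → + p ∣? ((+ toℕ x) ^ 2 - a)

-- Meaningful for odd primes p.
legendre : ℤ → ℕ → ℤ
legendre a p =
  if does (+ p ∣? a) then 0ℤ
  else if does (isSquareMod? a p) then 1ℤ
  else -1ℤ

infix 8 _!!

_!! : ℕ → ℕ
0           !! = 1
1           !! = 1
suc (suc a) !! = suc (suc a) ℕ.* a !!

{-# OPTIONS --safe #-}

-- Write m = (p - 1)/k and N = m + 3. Since α_i^m ≡ 1 (mod p), the binomial theorem gives
-- [(α_i - α_j)^N] ≡ W B Wᵀ with W = [α_i^(t+2)] and B a skew antidiagonal matrix, so that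
-- S ≡ (∏ α_i² · T · Q)², where Q is the product of the first m/2 entries of B: two special
-- ones, (N + C(N,2)) and (1 + C(N,3)) up to sign, and ± C(N,r) for 4 ≤ r ≤ m/2 + 1. Over ℤ
-- a skew-symmetric determinant of even order is a square, so √S is a genuine root of S.
-- As (p - 1)/2 is even, Euler's criterion then shows that √S and T Q have the same Legendre
-- symbol. Modulo squares the factorials in ∏ C(N,r) collapse to a double factorial, and the
-- remaining factors are evaluated with km ≡ -1.

module Submission where

open import Algebra.Bundles using (CommutativeMonoid; CommutativeRing)
import Algebra.Properties.CommutativeMonoid.Sum
open import Data.Bool.Base using (true; false; if_then_else_)
open import Data.Fin.Base as Fin using (Fin; zero; suc; toℕ; punchIn)
import Data.Fin.Properties as Fin
open import Data.Integer.Base using (ℤ; +_; -[1+_]; _+_; _-_; _*_; _^_; -_; -1ℤ; 0ℤ; 1ℤ; ∣_∣)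
import Data.Integer.Base as ℤ
import Data.Integer.DivMod as ℤ
import Data.Integer.Divisibility.Signed as ℤ
import Data.Integer.Properties as ℤ
open import Data.Integer.Tactic.RingSolver using (solve-∀)
open import Data.Nat.Base as ℕ using (ℕ; zero; suc; NonZero; _≤_; z≤n; s≤s; _∸_; _!)
open import Data.Nat.Combinatorics
  using (_C_; nC1≡n; nCn≡1; nCk≡nC[n∸k]; nCk≡n!/k![n-k]!; k![n∸k]!∣n!)
open import Data.Nat.Coprimality using (Coprime; coprime-divisor; coprime-/gcd)
open import Data.Nat.DivMod using (_/_; m*n/n≡m; m/n*n≡m; m/n*n≤m)
import Data.Nat.Divisibility as ℕ
import Data.Nat.GCD as ℕ
open import Data.Nat.Primality using (Prime; euclidsLemma; prime⇒nonZero; prime⇒nonTrivial; ¬prime[1])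
import Data.Nat.Properties as ℕ
open import Data.Nat.Tactic.RingSolver using () renaming (solve-∀ to ℕ-solve-∀)
open import Data.Product.Base using (∃; _×_; _,_; proj₁; proj₂)
open import Data.Sum.Base as Sum using (_⊎_; inj₁; inj₂; [_,_]′)
open import Data.Vec.Functional using (Vector; _∷_; tail; insertAt)
open import Function.Base using (_∘_; id)
open import Level using (0ℓ)
open import Relation.Binary.Bundles using (Setoid)
open import Relation.Binary.Definitions using (Tri; tri<; tri≈; tri>)
open import Relation.Binary.PropositionalEquality
  using (_≡_; _≢_; _≗_; refl; sym; trans; cong; cong₂; subst; subst₂; module ≡-Reasoning)
open import Relation.Nullary using (¬_; Dec; yes; no; ofʸ; ofⁿ; does; ¬?; contradiction)
open import Relation.Nullary.Decidable using (decidable-stable)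
open import Defs

import Algebra.Properties.CommutativeSemiring.Binomial
  (CommutativeRing.commutativeSemiring ℤ.+-*-commutativeRing) as Binomial
import Algebra.Properties.Semiring.Exp ℤ.+-*-semiring as Exp
import Algebra.Properties.Semiring.Mult ℤ.+-*-semiring as Mult
open import Algebra.Properties.Semiring.Sum ℤ.+-*-semiring
  using (sum-cong-≗; ∑-distrib-+; ∑-comm; *-distribˡ-sum; *-distribʳ-sum; sum-replicate-zero)

-- The exponents of y in the binomial expansion run through 0, ..., m + 3, four more than a system
-- of residues modulo m; setting aside two at each end keeps the coefficient matrix skew. The four
-- terms set aside land on the exponents m, m + 1, 2, 3. For m = 2 these collide, and N can fail to
-- be below p, so p = 2k + 1 needs its own computation. From m = 4 on, N < p, and all factorials up
-- to N! are units modulo p.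
--
-- Modulo p, S determines its root only up to sign. In both parts (p - 1)/2 is even, so -1 is a
-- residue; this absorbs that sign together with the signs in B and the sign between T and the
-- Vandermonde determinant.
--
-- The parity of m/2 separates the two formulas: the m/2 - 2 ordinary binomial coefficients
-- contribute N! to the power m/2 - 2, a square in (a), whereas in (b) one N! survives and trades (m
-- - 1)!! for m!!.
--
-- Two numbers are compared through their powers with exponent (p - 1)/2, and only units are
-- cancelled. The argument therefore also covers the case that the special factors vanish modulo p,
-- when both sides are 0.

private variable
  n : ℕ


-- Determinants

module _ where
  open ≡-Reasoning

  private variable
    m : ℕ

  Matrix : ℕ → ℕ → Set
  Matrix n m = Fin n → Fin m → ℤ

  infix 9 _ᵀ
  _ᵀ : Matrix n m → Matrix m n
  (A ᵀ) i j = A j i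

  infixl 7 _·_
  _·_ : ∀ {l} → Matrix n m → Matrix m l → Matrix n l
  (A · B) i j = sum λ k → A i k * B k j

  infixl 6 _[_]≔_
  _[_]≔_ : {X : Set} → Vector X n → Fin n → X → Vector X n
  A [ zero ]≔  v = v ∷ tail A
  A [ suc i ]≔ v = A zero ∷ (tail A [ i ]≔ v)

  δ : Matrix n n
  δ zero    zero    = 1ℤ
  δ zero    (suc j) = 0ℤ
  δ (suc i) zero    = 0ℤ
  δ (suc i) (suc j) = δ i j

  sgn : Fin n → ℤ
  sgn j = -1ℤ ^ toℕ j

  sum-zero : {f : Fin n → ℤ} → (∀ i → f i ≡ 0ℤ) → sum f ≡ 0ℤ
  sum-zero {n} f≗0 = trans (sum-cong-≗ f≗0) (sum-replicate-zero n)

  sum-linear : (x y : ℤ) (f g : Fin n → ℤ) →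
               sum (λ i → x * f i + y * g i) ≡ x * sum f + y * sum g
  sum-linear x y f g = trans (∑-distrib-+ (λ i → x * f i) (λ i → y * g i))
    (cong₂ _+_ (sym (*-distribˡ-sum x f)) (sym (*-distribˡ-sum y g)))

  -- Abstract in the congruence: used with `_≡_` here and with congruence modulo p later.
  module Respects (_≈_ : ℤ → ℤ → Set) (≈-refl : ∀ {a} → a ≈ a)
    (+-cong : ∀ {a b c d} → a ≈ b → c ≈ d → (a + c) ≈ (b + d))
    (*-cong : ∀ {a b c d} → a ≈ b → c ≈ d → (a * c) ≈ (b * d)) where

    sum-resp : {f g : Fin n → ℤ} → (∀ i → f i ≈ g i) → sum f ≈ sum g
    sum-resp {zero}  f≈g = ≈-refl
    sum-resp {suc n} f≈g = +-cong (f≈g zero) (sum-resp (f≈g ∘ suc))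

    product-resp : {f g : Fin n → ℤ} → (∀ i → f i ≈ g i) → product f ≈ product g
    product-resp {zero}  f≈g = ≈-refl
    product-resp {suc n} f≈g = *-cong (f≈g zero) (product-resp (f≈g ∘ suc))

    det-resp : {A B : Matrix n n} → (∀ i j → A i j ≈ B i j) → det A ≈ det B
    det-resp {zero}  A≈B = ≈-refl
    det-resp {suc n} A≈B = sum-resp λ j →
      *-cong (*-cong (≈-refl {sgn j}) (A≈B zero j)) (det-resp λ r c → A≈B (suc r) (punchIn j c))

  open Respects _≡_ refl (cong₂ _+_) (cong₂ _*_) public
    using () renaming (det-resp to det-cong; product-resp to product-cong)

  -- Induction with two predecessors: `ih₁` transposes the minors, so that they can be expanded
  -- along their first column, and `ih₀` transposes the minors of minors back.
  det-transpose-step : (∀ (A : Matrix n n) → det A ≡ det (A ᵀ)) →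
                       (∀ (A : Matrix (suc n) (suc n)) → det A ≡ det (A ᵀ)) →
                       ∀ (A : Matrix (suc (suc n)) (suc (suc n))) → det A ≡ det (A ᵀ)
  det-transpose-step {n} ih₀ ih₁ A = begin
    det A
      ≡⟨ expansion A ⟩
    corner A + sum (λ j → sum λ i → term A i j)
      ≡⟨ cong (_+_ (corner A)) (∑-comm λ j i → term A i j) ⟩
    corner A + sum (λ i → sum λ j → term A i j)
      ≡⟨ cong₂ _+_ (cong (_*_ (1ℤ * A zero zero)) (ih₁ (λ r c → A (suc r) (suc c))))
         (sum-cong-≗ λ i → sum-cong-≗ λ j → trans
           (cong (λ x → -1ℤ * sgn j * A zero (suc j) * (sgn i * A (suc i) zero * x))
             (ih₀ (λ r c → A (suc (punchIn i r)) (suc (punchIn j c)))))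
           (swap-factors (sgn j) (A zero (suc j)) (sgn i) (A (suc i) zero) _)) ⟩
    corner (A ᵀ) + sum (λ j → sum λ i → term (A ᵀ) i j)
      ≡⟨ expansion (A ᵀ) ⟨
    det (A ᵀ) ∎
    where
    corner : Matrix (suc (suc n)) (suc (suc n)) → ℤ
    corner A = 1ℤ * A zero zero * det (λ r c → A (suc r) (suc c))

    term : Matrix (suc (suc n)) (suc (suc n)) → Fin (suc n) → Fin (suc n) → ℤ
    term A i j = -1ℤ * sgn j * A zero (suc j) *
      (sgn i * A (suc i) zero * det (λ r c → A (suc (punchIn i r)) (suc (punchIn j c))))

    swap-factors : ∀ s a t b x → -1ℤ * s * a * (t * b * x) ≡ -1ℤ * t * b * (s * a * x)
    swap-factors = solve-∀

    -- Expanding along the first row and then along the first column gives a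
    -- formula that is visibly symmetric under transposition.
    expansion : ∀ A → det A ≡ corner A + sum (λ j → sum λ i → term A i j)
    expansion A = cong (_+_ (corner A)) (sum-cong-≗ λ j → begin
      -1ℤ * sgn j * A zero (suc j) * det (λ r c → A (suc r) (punchIn (suc j) c))
        ≡⟨ cong (_*_ (-1ℤ * sgn j * A zero (suc j))) (trans
             (ih₁ (λ r c → A (suc r) (punchIn (suc j) c)))
             (sum-cong-≗ λ i → cong (_*_ (sgn i * A (suc i) zero))
               (sym (ih₀ (λ r c → A (suc (punchIn i r)) (suc (punchIn j c))))))) ⟩
      -1ℤ * sgn j * A zero (suc j) *
        sum (λ i → sgn i * A (suc i) zero * det (λ r c → A (suc (punchIn i r)) (suc (punchIn j c))))
        ≡⟨ *-distribˡ-sum (-1ℤ * sgn j * A zero (suc j))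
             (λ i → sgn i * A (suc i) zero * det (λ r c → A (suc (punchIn i r)) (suc (punchIn j c)))) ⟩
      sum (λ i → term A i j) ∎)

  det-transpose : ∀ n (A : Matrix n n) → det A ≡ det (A ᵀ)
  det-transpose zero          A = refl
  det-transpose (suc zero)    A = refl
  det-transpose (suc (suc n)) A =
    det-transpose-step (det-transpose n) (det-transpose (suc n)) A

  ≔-map : {X Y : Set} (f : X → Y) (A : Vector X n) (i : Fin n) (v : X) (k : Fin n) →
          f ((A [ i ]≔ v) k) ≡ ((f ∘ A) [ i ]≔ f v) k
  ≔-map f A zero    v zero    = refl
  ≔-map f A zero    v (suc k) = refl
  ≔-map f A (suc i) v zero    = refl
  ≔-map f A (suc i) v (suc k) = ≔-map f (tail A) i v k

  ≔-cong : (A : Matrix n m) (i : Fin n) {u v : Fin m → ℤ} → u ≗ v →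
           ∀ k c → (A [ i ]≔ u) k c ≡ (A [ i ]≔ v) k c
  ≔-cong A zero    u≗v zero    c = u≗v c
  ≔-cong A zero    u≗v (suc k) c = refl
  ≔-cong A (suc i) u≗v zero    c = refl
  ≔-cong A (suc i) u≗v (suc k) c = ≔-cong (tail A) i u≗v k c

  -- The number of rows and their length are independent, since fixing a row lowers the first and
  -- keeps the second.
  record Alternating (D : Matrix n m → ℤ) : Set where
    field
      resp   : ∀ {A B} → (∀ i j → A i j ≡ B i j) → D A ≡ D B
      linear : ∀ A i x y u v →
               D (A [ i ]≔ λ c → x * u c + y * v c) ≡ x * D (A [ i ]≔ u) + y * D (A [ i ]≔ v)
      alt    : ∀ A i j → i ≢ j → A i ≗ A j → D A ≡ 0ℤ

  open Alternating

  det-linear : ∀ (A : Matrix n n) i x y u v →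
               det (A [ i ]≔ λ c → x * u c + y * v c) ≡ x * det (A [ i ]≔ u) + y * det (A [ i ]≔ v)
  det-linear A zero x y u v = trans
    (sum-cong-≗ λ j → distr (sgn j) x y (u j) (v j) (det λ r c → A (suc r) (punchIn j c)))
    (sum-linear x y
      (λ j → sgn j * u j * det λ r c → A (suc r) (punchIn j c))
      (λ j → sgn j * v j * det λ r c → A (suc r) (punchIn j c)))
    where
    distr : ∀ s x y a b d → s * (x * a + y * b) * d ≡ x * (s * a * d) + y * (s * b * d)
    distr = solve-∀
  det-linear A (suc i) x y u v = trans
    (sum-cong-≗ λ j → trans
      (cong (_*_ (sgn j * A zero j)) (begin
        det (λ r c → (tail A [ i ]≔ (λ c → x * u c + y * v c)) r (punchIn j c))
          ≡⟨ update j (λ c → x * u c + y * v c) ⟩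
        det (minor j [ i ]≔ (λ c → x * u (punchIn j c) + y * v (punchIn j c)))
          ≡⟨ det-linear (minor j) i x y (u ∘ punchIn j) (v ∘ punchIn j) ⟩
        x * det (minor j [ i ]≔ u ∘ punchIn j) + y * det (minor j [ i ]≔ v ∘ punchIn j)
          ≡⟨ cong₂ (λ a b → x * a + y * b) (update j u) (update j v) ⟨
        x * det (λ r c → (tail A [ i ]≔ u) r (punchIn j c)) +
        y * det (λ r c → (tail A [ i ]≔ v) r (punchIn j c)) ∎))
      (distr (sgn j * A zero j) x y (minor-det u j) (minor-det v j)))
    (sum-linear x y (λ j → sgn j * A zero j * minor-det u j) (λ j → sgn j * A zero j * minor-det v j))
    where
    minor : Fin _ → Matrix _ _
    minor j r c = A (suc r) (punchIn j c)
    minor-det : (Fin _ → ℤ) → Fin _ → ℤ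
    minor-det w j = det λ r c → (tail A [ i ]≔ w) r (punchIn j c)
    update : ∀ j w → det (λ r c → (tail A [ i ]≔ w) r (punchIn j c)) ≡ det (minor j [ i ]≔ w ∘ punchIn j)
    update j w = det-cong λ r c → cong (λ f → f c) (≔-map (_∘ punchIn j) (tail A) i w r)
    distr : ∀ s x y a b → s * (x * a + y * b) ≡ x * (s * a) + y * (s * b)
    distr = solve-∀

  mutual
    -- Expanding along the first column, only the terms of the two equal rows survive.
    det-alt₀₁ : ∀ (A : Matrix (suc (suc n)) (suc (suc n))) → A zero ≗ A (suc zero) → det A ≡ 0ℤ
    det-alt₀₁ {n} A A₀≗A₁ = begin
      det A        ≡⟨ det-transpose _ A ⟩
      det (A ᵀ)    ≡⟨ cong₂ _+_ (cong₂ (λ x d → 1ℤ * x * d) (A₀≗A₁ zero) (det-cong A₀₁))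
                        (cong (_+_ (-1ℤ * 1ℤ * A (suc zero) zero * minor₁)) (sum-zero λ i → trans
                          (cong (_*_ (sgn (suc (suc i)) * A (suc (suc i)) zero)) (det-minor-alt₀₁ A A₀≗A₁ i))
                          (ℤ.*-zeroʳ (sgn (suc (suc i)) * A (suc (suc i)) zero)))) ⟩
      1ℤ * A (suc zero) zero * minor₁ + (-1ℤ * 1ℤ * A (suc zero) zero * minor₁ + 0ℤ)
                   ≡⟨ cancel (A (suc zero) zero) minor₁ ⟩
      0ℤ           ∎
      where
      minor₁ = det (λ r c → A (punchIn (suc zero) c) (suc r))
      A₀₁ : ∀ r c → A (suc c) (suc r) ≡ A (punchIn (suc zero) c) (suc r)
      A₀₁ r zero    = sym (A₀≗A₁ (suc r))
      A₀₁ r (suc c) = refl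
      cancel : ∀ a d → 1ℤ * a * d + (-1ℤ * 1ℤ * a * d + 0ℤ) ≡ 0ℤ
      cancel = solve-∀

    -- Deleting a row below the two equal ones keeps both on top. The index `i` guarantees that such
    -- a row exists, so the minor still has size at least two.
    det-minor-alt₀₁ : ∀ (A : Matrix (suc (suc n)) (suc (suc n))) → A zero ≗ A (suc zero) → (i : Fin n) →
                      det (λ r c → A (punchIn (suc (suc i)) c) (suc r)) ≡ 0ℤ
    det-minor-alt₀₁ {suc n} A A₀≗A₁ i = trans (sym (det-transpose _ minor)) (det-alt₀₁ minor (A₀≗A₁ ∘ suc))
      where
      minor : Matrix (suc (suc n)) (suc (suc n))
      minor c r = A (punchIn (suc (suc i)) c) (suc r)

  module _ {D : Matrix (suc (suc n)) m → ℤ}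
    (D-resp : ∀ {A B} → (∀ i j → A i j ≡ B i j) → D A ≡ D B)
    (D-linear : ∀ A i x y u v →
       D (A [ i ]≔ λ c → x * u c + y * v c) ≡ x * D (A [ i ]≔ u) + y * D (A [ i ]≔ v))
    (D-alt₀₁ : ∀ A → A zero ≗ A (suc zero) → D A ≡ 0ℤ) where

    -- Polarisation: the form vanishes with `u+v` in both rows, and so do its two pure terms, which
    -- leaves the two mixed ones.
    swap₀₁ : ∀ u v A → D (u ∷ v ∷ A) ≡ - D (v ∷ u ∷ A)
    swap₀₁ u v A = begin
      D (u ∷ v ∷ A)
        ≡⟨ isolate (D (u ∷ u ∷ A)) (D (u ∷ v ∷ A)) (D (v ∷ u ∷ A)) (D (v ∷ v ∷ A)) ⟩
      1ℤ * (1ℤ * D (u ∷ u ∷ A) + 1ℤ * D (u ∷ v ∷ A)) + 1ℤ * (1ℤ * D (v ∷ u ∷ A) + 1ℤ * D (v ∷ v ∷ A))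
        - D (u ∷ u ∷ A) - D (v ∷ v ∷ A) - D (v ∷ u ∷ A)
        ≡⟨ cong (λ x → x - D (u ∷ u ∷ A) - D (v ∷ v ∷ A) - D (v ∷ u ∷ A)) (cong₂ (λ x y → 1ℤ * x + 1ℤ * y)
             (D-linear (u ∷ u ∷ A) (suc zero) 1ℤ 1ℤ u v)
             (D-linear (v ∷ u ∷ A) (suc zero) 1ℤ 1ℤ u v)) ⟨
      1ℤ * D (u ∷ u+v ∷ A) + 1ℤ * D (v ∷ u+v ∷ A) - D (u ∷ u ∷ A) - D (v ∷ v ∷ A) - D (v ∷ u ∷ A)
        ≡⟨ cong (λ x → x - D (u ∷ u ∷ A) - D (v ∷ v ∷ A) - D (v ∷ u ∷ A))
             (D-linear (u ∷ u+v ∷ A) zero 1ℤ 1ℤ u v) ⟨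
      D (u+v ∷ u+v ∷ A) - D (u ∷ u ∷ A) - D (v ∷ v ∷ A) - D (v ∷ u ∷ A)
        ≡⟨ cong₂ (λ x y → x - y - D (v ∷ v ∷ A) - D (v ∷ u ∷ A))
             (D-alt₀₁ (u+v ∷ u+v ∷ A) λ _ → refl) (D-alt₀₁ (u ∷ u ∷ A) λ _ → refl) ⟩
      0ℤ - 0ℤ - D (v ∷ v ∷ A) - D (v ∷ u ∷ A)
        ≡⟨ cong (λ x → 0ℤ - 0ℤ - x - D (v ∷ u ∷ A)) (D-alt₀₁ (v ∷ v ∷ A) λ _ → refl) ⟩
      0ℤ - 0ℤ - 0ℤ - D (v ∷ u ∷ A)
        ≡⟨ ℤ.+-identityˡ _ ⟩
      - D (v ∷ u ∷ A) ∎
      where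
      u+v = λ c → 1ℤ * u c + 1ℤ * v c
      isolate : ∀ a b c d → b ≡ 1ℤ * (1ℤ * a + 1ℤ * b) + 1ℤ * (1ℤ * c + 1ℤ * d) - a - d - c
      isolate = solve-∀

  -- Laplace expansion deletes the first row. Swapping it with the second brings both equal rows
  -- into every minor, where `ih` applies.
  det-alt₀ : ∀ (A : Matrix (suc (suc n)) (suc (suc n))) (j : Fin n) → A zero ≗ A (suc (suc j)) →
             (∀ (B : Matrix (suc n) (suc n)) → B zero ≗ B (suc j) → det B ≡ 0ℤ) → det A ≡ 0ℤ
  det-alt₀ {n} A j eq ih = begin
    det A                                          ≡⟨ det-cong split ⟩
    det (A zero ∷ A (suc zero) ∷ tail (tail A))    ≡⟨ swap₀₁ {D = det} det-cong det-linear det-alt₀₁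
                                                        (A zero) (A (suc zero)) (tail (tail A)) ⟩
    - det (A (suc zero) ∷ A zero ∷ tail (tail A))  ≡⟨ cong -_ (sum-zero λ k → trans
        (cong (_*_ (sgn k * A (suc zero) k)) (ih (minor k) (eq ∘ punchIn k)))
        (ℤ.*-zeroʳ (sgn k * A (suc zero) k))) ⟩
    0ℤ ∎
    where
    minor : Fin (suc (suc n)) → Matrix (suc n) (suc n)
    minor k r c = (A zero ∷ tail (tail A)) r (punchIn k c)
    split : ∀ i c → A i c ≡ (A zero ∷ A (suc zero) ∷ tail (tail A)) i c
    split zero          c = refl
    split (suc zero)    c = refl
    split (suc (suc i)) c = refl

  det-alt : ∀ (A : Matrix n n) i j → i ≢ j → A i ≗ A j → det A ≡ 0ℤ
  det-alt A zero zero i≢j eq = contradiction refl i≢j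
  det-alt {suc n} A (suc i) (suc j) i≢j eq = sum-zero λ k → trans
    (cong (_*_ (sgn k * A zero k))
      (det-alt (λ r c → A (suc r) (punchIn k c)) i j (i≢j ∘ cong suc) (eq ∘ punchIn k)))
    (ℤ.*-zeroʳ (sgn k * A zero k))
  det-alt A zero (suc zero) i≢j eq = det-alt₀₁ A eq
  det-alt A (suc zero) zero i≢j eq = det-alt₀₁ A (sym ∘ eq)
  det-alt {suc (suc n)} A zero (suc (suc j)) i≢j eq =
    det-alt₀ A j eq λ B → det-alt B zero (suc j) λ ()
  det-alt {suc (suc n)} A (suc (suc j)) zero i≢j eq =
    det-alt₀ A j (sym ∘ eq) λ B → det-alt B zero (suc j) λ ()

-- Uniqueness of alternating forms and multiplicativity of the determinant

module _ where
  open ≡-Reasoning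

  private variable
    m : ℕ

  open Alternating


  fix-first-row : {D : Matrix (suc n) m → ℤ} → Alternating D → ∀ w → Alternating (λ A → D (w ∷ A))
  fix-first-row D-alt w .resp A≗B = D-alt .resp λ where
    zero    c → refl
    (suc i) c → A≗B i c
  fix-first-row D-alt w .linear A i = D-alt .linear (w ∷ A) (suc i)
  fix-first-row D-alt w .alt A i j i≢j = D-alt .alt (w ∷ A) (suc i) (suc j) (λ where refl → i≢j refl)

  ≗-first-row : (A : Matrix (suc n) m) → ∀ i c → A i c ≡ (A zero ∷ tail A) i c
  ≗-first-row A zero    c = refl
  ≗-first-row A (suc i) c = refl

  move-row-to-front : {D : Matrix (suc n) m → ℤ} → Alternating D → ∀ A j →
                      D (A j ∷ (A ∘ punchIn j)) ≡ sgn j * D A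
  move-row-to-front {D = D} D-alt A zero =
    trans (D-alt .resp λ i c → sym (≗-first-row A i c)) (sym (ℤ.*-identityˡ (D A)))
  move-row-to-front {suc n} {D = D} D-alt A (suc j) = begin
    D (A (suc j) ∷ (A ∘ punchIn (suc j)))
      ≡⟨ D-alt .resp (λ { zero c → refl ; (suc zero) c → refl ; (suc (suc i)) c → refl }) ⟩
    D (A (suc j) ∷ A zero ∷ (tail A ∘ punchIn j))
      ≡⟨ swap₀₁ {D = D} (D-alt .resp) (D-alt .linear) (λ B → D-alt .alt B zero (suc zero) λ ())
           (A (suc j)) (A zero) (tail A ∘ punchIn j) ⟩
    - D (A zero ∷ A (suc j) ∷ (tail A ∘ punchIn j))
      ≡⟨ cong -_ (move-row-to-front (fix-first-row D-alt (A zero)) (tail A) j) ⟩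
    - (sgn j * D (A zero ∷ tail A))
      ≡⟨ cong (λ x → - (sgn j * x)) (D-alt .resp (≗-first-row A)) ⟨
    - (sgn j * D A)
      ≡⟨ neg (sgn j) (D A) ⟩
    -1ℤ * sgn j * D A ∎
    where
    neg : ∀ s d → - (s * d) ≡ -1ℤ * s * d
    neg = solve-∀

  linear-expansion : (ℓ : (Fin m → ℤ) → ℤ) → (∀ {u v} → u ≗ v → ℓ u ≡ ℓ v) →
                     (∀ x y u v → ℓ (λ c → x * u c + y * v c) ≡ x * ℓ u + y * ℓ v) →
                     ∀ u → ℓ u ≡ sum λ j → u j * ℓ (δ j)
  linear-expansion {zero} ℓ ℓ-cong ℓ-linear u = begin
    ℓ u                                 ≡⟨ ℓ-cong (λ ()) ⟩
    ℓ (λ c → 0ℤ * u c + 0ℤ * u c)       ≡⟨ ℓ-linear 0ℤ 0ℤ u u ⟩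
    0ℤ                                  ∎
  linear-expansion {suc m} ℓ ℓ-cong ℓ-linear u = begin
    ℓ u
      ≡⟨ ℓ-cong (λ { zero → expand₀ (u zero) ; (suc c) → expandₛ (u zero) (u (suc c)) }) ⟩
    ℓ (λ c → u zero * δ zero c + 1ℤ * (0ℤ ∷ tail u) c)
      ≡⟨ ℓ-linear (u zero) 1ℤ (δ zero) (0ℤ ∷ tail u) ⟩
    u zero * ℓ (δ zero) + 1ℤ * ℓ (0ℤ ∷ tail u)
      ≡⟨ cong (_+_ (u zero * ℓ (δ zero))) (trans (ℤ.*-identityˡ _) (trans
           (linear-expansion (λ v → ℓ (0ℤ ∷ v)) (λ u≗v → ℓ-cong λ { zero → refl ; (suc c) → u≗v c })
             (λ x y v w → trans
               (ℓ-cong λ { zero → sym (0-linear x y) ; (suc c) → refl })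
               (ℓ-linear x y (0ℤ ∷ v) (0ℤ ∷ w)))
             (tail u))
           (sum-cong-≗ λ j → cong (_*_ (u (suc j))) (ℓ-cong λ { zero → refl ; (suc c) → refl })))) ⟩
    u zero * ℓ (δ zero) + sum (λ j → u (suc j) * ℓ (δ (suc j))) ∎
    where
    expand₀ : ∀ a → a ≡ a * 1ℤ + 1ℤ * 0ℤ
    expand₀ = solve-∀
    expandₛ : ∀ a b → b ≡ a * 0ℤ + 1ℤ * b
    expandₛ = solve-∀
    0-linear : ∀ x y → x * 0ℤ + y * 0ℤ ≡ 0ℤ
    0-linear = solve-∀

  -- Row operations valid one at a time may be carried out in all rows together, because `_∼_`
  -- compares a row with its replacement without regard to the other rows.
  replace-rows : (D : Matrix n m → ℤ) (_∼_ : (Fin m → ℤ) → (Fin m → ℤ) → Set) →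
                 (∀ {A B} → (∀ i j → A i j ≡ B i j) → D A ≡ D B) →
                 (∀ A i v → A i ∼ v → D A ≡ D (A [ i ]≔ v)) →
                 ∀ A B → (∀ i → A i ∼ B i) → D A ≡ D B
  replace-rows {zero}  D _∼_ D-resp step A B A∼B = D-resp λ ()
  replace-rows {suc n} D _∼_ D-resp step A B A∼B = begin
    D A                  ≡⟨ step A zero (B zero) (A∼B zero) ⟩
    D (B zero ∷ tail A)  ≡⟨ replace-rows (λ X → D (B zero ∷ X)) _∼_
                              (λ eq → D-resp λ { zero c → refl ; (suc i) c → eq i c })
                              (λ X i v → step (B zero ∷ X) (suc i) v) (tail A) (tail B) (A∼B ∘ suc) ⟩
    D (B zero ∷ tail B)  ≡⟨ D-resp (≗-first-row B) ⟨
    D B                  ∎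

  ≔-self : (A : Matrix n m) (i : Fin n) → ∀ k c → A k c ≡ (A [ i ]≔ A i) k c
  ≔-self A zero    zero    c = refl
  ≔-self A zero    (suc k) c = refl
  ≔-self A (suc i) zero    c = refl
  ≔-self A (suc i) (suc k) c = ≔-self (tail A) i k c

  ≔-lookup : (A : Matrix n m) (i : Fin n) (v : Fin m → ℤ) → (A [ i ]≔ v) i ≗ v
  ≔-lookup A zero    v c = refl
  ≔-lookup A (suc i) v c = ≔-lookup (tail A) i v c

  insertAt-cong : {u v : Fin n → ℤ} → u ≗ v → ∀ j → insertAt u j 0ℤ ≗ insertAt v j 0ℤ
  insertAt-cong         u≗v zero    zero    = refl
  insertAt-cong         u≗v zero    (suc c) = u≗v c
  insertAt-cong {suc n} u≗v (suc j) zero    = u≗v zero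
  insertAt-cong {suc n} u≗v (suc j) (suc c) = insertAt-cong (u≗v ∘ suc) j c

  insertAt-linear : ∀ x y (u v : Fin n → ℤ) j c →
    insertAt (λ c → x * u c + y * v c) j 0ℤ c ≡ x * insertAt u j 0ℤ c + y * insertAt v j 0ℤ c
  insertAt-linear x y u v zero zero = sym (0-linear x y)
    where
    0-linear : ∀ x y → x * 0ℤ + y * 0ℤ ≡ 0ℤ
    0-linear = solve-∀
  insertAt-linear         x y u v zero    (suc c) = refl
  insertAt-linear {suc n} x y u v (suc j) zero    = refl
  insertAt-linear {suc n} x y u v (suc j) (suc c) = insertAt-linear x y (tail u) (tail v) j c

  insertAt-δ : ∀ (j : Fin (suc n)) r c → insertAt (δ r) j 0ℤ c ≡ δ (punchIn j r) c
  insertAt-δ         zero    r       zero    = refl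
  insertAt-δ         zero    r       (suc c) = refl
  insertAt-δ {suc n} (suc j) zero    zero    = refl
  insertAt-δ {suc n} (suc j) zero    (suc c) = insertAt-zero j c
    where
    insertAt-zero : ∀ {n} (j : Fin (suc n)) → insertAt (λ _ → 0ℤ) j 0ℤ ≗ λ _ → 0ℤ
    insertAt-zero         zero    zero    = refl
    insertAt-zero         zero    (suc c) = refl
    insertAt-zero {suc n} (suc j) zero    = refl
    insertAt-zero {suc n} (suc j) (suc c) = insertAt-zero j c
  insertAt-δ {suc n} (suc j) (suc r) zero    = refl
  insertAt-δ {suc n} (suc j) (suc r) (suc c) = insertAt-δ j r c

  insertAt-punchIn : ∀ (u : Fin (suc n) → ℤ) j c → insertAt (u ∘ punchIn j) j 0ℤ c ≡ 1ℤ * u c + - u j * δ j c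
  insertAt-punchIn u zero zero = cancel (u zero)
    where
    cancel : ∀ a → 0ℤ ≡ 1ℤ * a + - a * 1ℤ
    cancel = solve-∀
  insertAt-punchIn u zero (suc c) = keep (u zero) (u (suc c))
    where
    keep : ∀ a b → b ≡ 1ℤ * b + - a * 0ℤ
    keep = solve-∀
  insertAt-punchIn {suc n} u (suc j) zero = keep (u (suc j)) (u zero)
    where
    keep : ∀ a b → b ≡ 1ℤ * b + - a * 0ℤ
    keep = solve-∀
  insertAt-punchIn {suc n} u (suc j) (suc c) = insertAt-punchIn (tail u) j c

  -- Subtracting multiples of the first row δ j clears column j of the other rows.
  clear-column : {D : Matrix (suc n) (suc m) → ℤ} → Alternating D → ∀ j A →
                 D (δ j ∷ A) ≡ D (δ j ∷ λ r → insertAt (A r ∘ punchIn j) j 0ℤ)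
  clear-column {D = D} D-alt j A =
    replace-rows (λ B → D (δ j ∷ B)) (λ u v → v ≗ λ c → 1ℤ * u c + - u j * δ j c)
      (Dⱼ .resp) step A (λ r → insertAt (A r ∘ punchIn j) j 0ℤ) (λ r → insertAt-punchIn (A r) j)
    where
    Dⱼ = fix-first-row D-alt (δ j)
    keep : ∀ a b → 1ℤ * a + b * 0ℤ ≡ a
    keep = solve-∀
    step : ∀ B i v → v ≗ (λ c → 1ℤ * B i c + - B i j * δ j c) → D (δ j ∷ B) ≡ D (δ j ∷ (B [ i ]≔ v))
    step B i v eq = begin
      D (δ j ∷ B)                      ≡⟨ Dⱼ .resp (≔-self B i) ⟩
      D (δ j ∷ (B [ i ]≔ B i))         ≡⟨ keep _ (- B i j) ⟨
      1ℤ * D (δ j ∷ (B [ i ]≔ B i)) + - B i j * 0ℤ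
        ≡⟨ cong (λ x → 1ℤ * D (δ j ∷ (B [ i ]≔ B i)) + - B i j * x)
             (D-alt .alt (δ j ∷ (B [ i ]≔ δ j)) zero (suc i) (λ ()) λ c → sym (≔-lookup B i (δ j) c)) ⟨
      1ℤ * D (δ j ∷ (B [ i ]≔ B i)) + - B i j * D (δ j ∷ (B [ i ]≔ δ j))
        ≡⟨ Dⱼ .linear B i 1ℤ (- B i j) (B i) (δ j) ⟨
      D (δ j ∷ (B [ i ]≔ λ c → 1ℤ * B i c + - B i j * δ j c))
        ≡⟨ Dⱼ .resp (≔-cong B i eq) ⟨
      D (δ j ∷ (B [ i ]≔ v)) ∎

  -- A cofactor of an alternating form is again alternating, in one dimension less; this drives the
  -- induction in `alternating-unique`.
  minor-alternating : {D : Matrix (suc n) (suc m) → ℤ} → Alternating D → ∀ j →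
                      Alternating (λ A → D (δ j ∷ λ r → insertAt (A r) j 0ℤ))
  minor-alternating {D = D} D-alt j = record
    { resp   = λ A≗B → Dⱼ .resp λ i → insertAt-cong (A≗B i) j
    ; linear = λ A i x y u v → begin
        D (δ j ∷ (insert ∘ (A [ i ]≔ λ c → x * u c + y * v c)))
          ≡⟨ Dⱼ .resp (λ k c → trans
               (cong (λ f → f c) (≔-map insert A i (λ c → x * u c + y * v c) k))
               (≔-cong (insert ∘ A) i (insertAt-linear x y u v j) k c)) ⟩
        D (δ j ∷ ((insert ∘ A) [ i ]≔ λ c → x * insert u c + y * insert v c))
          ≡⟨ Dⱼ .linear (insert ∘ A) i x y (insert u) (insert v) ⟩
        x * D (δ j ∷ ((insert ∘ A) [ i ]≔ insert u)) + y * D (δ j ∷ ((insert ∘ A) [ i ]≔ insert v))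
          ≡⟨ cong₂ (λ a b → x * a + y * b)
               (Dⱼ .resp λ k c → cong (λ f → f c) (≔-map insert A i u k))
               (Dⱼ .resp λ k c → cong (λ f → f c) (≔-map insert A i v k)) ⟨
        x * D (δ j ∷ (insert ∘ (A [ i ]≔ u))) + y * D (δ j ∷ (insert ∘ (A [ i ]≔ v))) ∎
    ; alt    = λ A i k i≢k eq → Dⱼ .alt (insert ∘ A) i k i≢k (insertAt-cong eq j)
    }
    where
    Dⱼ = fix-first-row D-alt (δ j)
    insert : (Fin _ → ℤ) → Fin _ → ℤ
    insert u = insertAt u j 0ℤ

  -- Expand the first row in basis vectors. Against `δ j`, column j of the other rows can be
  -- cleared, and the rest is an alternating function of the minor, known by induction. This
  -- reproduces the Laplace expansion.
  alternating-unique : (D : Matrix n n → ℤ) → Alternating D → ∀ A → D A ≡ det A * D δ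
  alternating-unique {zero}  D D-alt A = trans (D-alt .resp λ ()) (sym (ℤ.*-identityˡ (D δ)))
  alternating-unique {suc n} D D-alt A = begin
    D A
      ≡⟨ D-alt .resp (≗-first-row A) ⟩
    D (A zero ∷ tail A)
      ≡⟨ linear-expansion (λ u → D (u ∷ tail A))
           (λ u≗v → D-alt .resp λ { zero c → u≗v c ; (suc i) c → refl })
           (λ x y u v → D-alt .linear A zero x y u v) (A zero) ⟩
    sum (λ j → A zero j * D (δ j ∷ tail A))
      ≡⟨ sum-cong-≗ (λ j → trans (cong (_*_ (A zero j)) (minor-term j))
           (reorder (A zero j) (det (minor j)) (sgn j) (D δ))) ⟩
    sum (λ j → sgn j * A zero j * det (minor j) * D δ)
      ≡⟨ *-distribʳ-sum (D δ) (λ j → sgn j * A zero j * det (minor j)) ⟨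
    det A * D δ ∎
    where
    minor : Fin (suc n) → Matrix n n
    minor j r c = A (suc r) (punchIn j c)
    reorder : ∀ a d s x → a * (d * (s * x)) ≡ s * a * d * x
    reorder = solve-∀
    minor-term : ∀ j → D (δ j ∷ tail A) ≡ det (minor j) * (sgn j * D δ)
    minor-term j = begin
      D (δ j ∷ tail A)
        ≡⟨ clear-column D-alt j (tail A) ⟩
      D (δ j ∷ λ r → insertAt (minor j r) j 0ℤ)
        ≡⟨ alternating-unique _ (minor-alternating D-alt j) (minor j) ⟩
      det (minor j) * D (δ j ∷ λ r → insertAt (δ r) j 0ℤ)
        ≡⟨ cong (_*_ (det (minor j))) (trans
             (fix-first-row D-alt (δ j) .resp (insertAt-δ j)) (move-row-to-front D-alt δ j)) ⟩
      det (minor j) * (sgn j * D δ) ∎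

  sum-δˡ : ∀ (i : Fin n) (f : Fin n → ℤ) → sum (λ k → δ i k * f k) ≡ f i
  sum-δˡ zero f = trans
    (cong₂ _+_ (ℤ.*-identityˡ (f zero)) (sum-zero λ i → ℤ.*-zeroˡ (f (suc i)))) (ℤ.+-identityʳ (f zero))
  sum-δˡ (suc i) f = trans
    (cong₂ _+_ (ℤ.*-zeroˡ (f zero)) (sum-δˡ i (f ∘ suc))) (ℤ.+-identityˡ (f (suc i)))

  -- For fixed `B`, `det (X · B)` is alternating in `X` and takes the value `det B` at the identity.
  det-· : ∀ (A B : Matrix n n) → det (A · B) ≡ det A * det B
  det-· A B = trans
    (alternating-unique (λ X → det (X · B)) ·B-alternating A)
    (cong (_*_ (det A)) (det-cong λ i j → sum-δˡ i (λ k → B k j)))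
    where
    row : (Fin _ → ℤ) → Fin _ → ℤ
    row u j = sum λ k → u k * B k j
    distr : ∀ x y a b c → (x * a + y * b) * c ≡ x * (a * c) + y * (b * c)
    distr = solve-∀
    update : ∀ X i u → det ((X [ i ]≔ u) · B) ≡ det ((X · B) [ i ]≔ row u)
    update X i u = det-cong λ k c → cong (λ f → f c) (≔-map row X i u k)
    ·B-alternating : Alternating (λ X → det (X · B))
    ·B-alternating .resp   A≗B = det-cong λ i j → sum-cong-≗ λ k → cong (λ x → x * B k j) (A≗B i k)
    ·B-alternating .linear X i x y u v = begin
      det ((X [ i ]≔ (λ c → x * u c + y * v c)) · B)
        ≡⟨ update X i (λ c → x * u c + y * v c) ⟩
      det ((X · B) [ i ]≔ row (λ c → x * u c + y * v c))
        ≡⟨ det-cong (≔-cong (X · B) i λ j → trans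
             (sum-cong-≗ λ k → distr x y (u k) (v k) (B k j))
             (sum-linear x y (λ k → u k * B k j) (λ k → v k * B k j))) ⟩
      det ((X · B) [ i ]≔ (λ j → x * row u j + y * row v j))
        ≡⟨ det-linear (X · B) i x y (row u) (row v) ⟩
      x * det ((X · B) [ i ]≔ row u) + y * det ((X · B) [ i ]≔ row v)
        ≡⟨ cong₂ (λ a b → x * a + y * b) (update X i u) (update X i v) ⟨
      x * det ((X [ i ]≔ u) · B) + y * det ((X [ i ]≔ v) · B) ∎
    ·B-alternating .alt X i k i≢k eq =
      det-alt (X · B) i k i≢k λ j → sum-cong-≗ λ l → cong (λ x → x * B l j) (eq l)

module _ where
  open ≡-Reasoning

  private variable
    m : ℕ

  -- Integer squares

  -- After division by the gcd, the cofactor of m divides the square of a number coprime to it,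
  -- hence is 1.
  m²∣n²⇒m∣n : ∀ m n → m ℕ.* m ℕ.∣ n ℕ.* n → m ℕ.∣ n
  m²∣n²⇒m∣n zero n 0∣n² with ℕ.m*n≡0⇒m≡0∨n≡0 n (ℕ.0∣⇒≡0 0∣n²)
  ... | inj₁ refl = ℕ.∣-refl
  ... | inj₂ refl = ℕ.∣-refl
  m²∣n²⇒m∣n m@(suc _) n m²∣n² = subst (ℕ._∣ n) g≡m (ℕ.gcd[m,n]∣n m n)
    where
    g = ℕ.gcd m n
    instance
      g≢0 : ℕ.NonZero g
      g≢0 = ℕ.≢-nonZero (ℕ.gcd[m,n]≢0 m n (inj₁ λ ()))
      g²≢0 : ℕ.NonZero (g ℕ.* g)
      g²≢0 = ℕ.m*n≢0 g g
    m′ = m ℕ./ g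
    n′ = n ℕ./ g
    m≡ = m/n*n≡m (ℕ.gcd[m,n]∣m m n)
    n≡ = m/n*n≡m (ℕ.gcd[m,n]∣n m n)
    regroup : ∀ a b → a ℕ.* b ℕ.* (a ℕ.* b) ≡ a ℕ.* a ℕ.* (b ℕ.* b)
    regroup = ℕ-solve-∀
    m′²∣n′² : m′ ℕ.* m′ ℕ.∣ n′ ℕ.* n′
    m′²∣n′² = ℕ.*-cancelʳ-∣ (g ℕ.* g) (subst₂ ℕ._∣_
      (trans (cong (λ x → x ℕ.* x) (sym m≡)) (regroup m′ g))
      (trans (cong (λ x → x ℕ.* x) (sym n≡)) (regroup n′ g)) m²∣n²)
    coprime : Coprime m′ n′
    coprime = coprime-/gcd m n
    m′≡1 : m′ ≡ 1
    m′≡1 = coprime (ℕ.∣-refl , coprime-divisor coprime (ℕ.∣-trans (ℕ.m∣m*n m′) m′²∣n′²))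
    g≡m : g ≡ m
    g≡m = trans (trans (sym (ℕ.*-identityˡ g)) (cong (ℕ._* g) (sym m′≡1))) m≡

  -- An integer that is the square of a rational is the square of an integer. This undoes the
  -- scaling in the fraction-free elimination below.
  square-cancel : ∀ d x y → d ≢ 0ℤ → d * d * x ≡ y * y → ∃ λ z → x ≡ z * z
  square-cancel d x y d≢0 eq with ℤ.∣ᵤ⇒∣ {d} {y} (m²∣n²⇒m∣n ∣ d ∣ ∣ y ∣
    (subst₂ ℕ._∣_ (ℤ.abs-* d d) (ℤ.abs-* y y) (ℤ.∣⇒∣ᵤ (ℤ.divides x (trans (sym eq) (ℤ.*-comm (d * d) x))))))
  ... | ℤ.divides q refl = q , ℤ.*-cancelˡ-≡ (d * d) x (q * q) (trans eq (regroup q d))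
    where
    instance
      d²≢0 : ℤ.NonZero (d * d)
      d²≢0 = ℤ.≢-nonZero λ d²≡0 → [ d≢0 , d≢0 ]′ (ℤ.i*j≡0⇒i≡0∨j≡0 d d²≡0)
    regroup : ∀ q d → q * d * (q * d) ≡ d * d * (q * q)
    regroup = solve-∀

  ⌊√⌋-bounds : ∀ n → (⌊√ n ⌋ ℕ.* ⌊√ n ⌋ ℕ.≤ n) × (n ℕ.< suc ⌊√ n ⌋ ℕ.* suc ⌊√ n ⌋)
  ⌊√⌋-bounds zero = z≤n , s≤s z≤n
  ⌊√⌋-bounds (suc n) with ⌊√ n ⌋ | ⌊√⌋-bounds n
  -- The test `suc r * suc r ≤? suc n` in the definition of the root computes to this `<ᵇ`.
  ... | r | r²≤n , n<[r+1]² with (r ℕ.+ r ℕ.* suc r) ℕ.<ᵇ suc n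
                                    | ℕ.<ᵇ-reflects-< (r ℕ.+ r ℕ.* suc r) (suc n)
  ... | true  | ofʸ [r+1]²≤n+1 = [r+1]²≤n+1 ,
        ℕ.<-≤-trans (s≤s n<[r+1]²) (ℕ.*-mono-< (ℕ.n<1+n (suc r)) (ℕ.n<1+n (suc r)))
  ... | false | ofⁿ [r+1]²≰n+1 = ℕ.m≤n⇒m≤1+n r²≤n , ℕ.≰⇒> [r+1]²≰n+1

  ⌊√n²⌋≡n : ∀ n → ⌊√ n ℕ.* n ⌋ ≡ n
  ⌊√n²⌋≡n n with ⌊√⌋-bounds (n ℕ.* n)
  ... | r²≤n² , n²<[r+1]² = ℕ.≤-antisym
    (ℕ.≮⇒≥ λ n<r → ℕ.<⇒≱ (ℕ.*-mono-< n<r n<r) r²≤n²)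
    (ℕ.≮⇒≥ λ r<n → ℕ.<⇒≱ n²<[r+1]² (ℕ.*-mono-≤ r<n r<n))

  √-square : ∀ z → √ (z * z) * √ (z * z) ≡ z * z
  √-square z = subst (λ x → √ x * √ x ≡ x) (sym (z²≡ z)) (begin
    + ⌊√ ∣ z ∣ ℕ.* ∣ z ∣ ⌋ * + ⌊√ ∣ z ∣ ℕ.* ∣ z ∣ ⌋  ≡⟨ cong (λ r → + r * + r) (⌊√n²⌋≡n ∣ z ∣) ⟩
    + ∣ z ∣ * + ∣ z ∣                                  ≡⟨ ℤ.pos-* ∣ z ∣ ∣ z ∣ ⟨
    + (∣ z ∣ ℕ.* ∣ z ∣) ∎)
    where
    z²≡ : ∀ z → z * z ≡ + (∣ z ∣ ℕ.* ∣ z ∣)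
    z²≡ (+ n)    = sym (ℤ.pos-* n n)
    z²≡ -[1+ n ] = refl

  -- Skew-symmetric determinants

  SkewSymmetric : Matrix n n → Set
  SkewSymmetric A = ∀ i j → A i j ≡ - A j i

  skew-diagonal : {A : Matrix n n} → SkewSymmetric A → ∀ i → A i i ≡ 0ℤ
  skew-diagonal {A = A} skew i = i≡-i⇒i≡0 (A i i) (skew i i)
    where
    i≡-i⇒i≡0 : ∀ a → a ≡ - a → a ≡ 0ℤ
    i≡-i⇒i≡0 (+ zero) eq = refl

  sum-neg : (f : Fin n → ℤ) → sum (λ i → - f i) ≡ - sum f
  sum-neg f = trans (sum-cong-≗ λ i → sym (ℤ.-1*i≡-i (f i)))
    (trans (sym (*-distribˡ-sum -1ℤ f)) (ℤ.-1*i≡-i (sum f)))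

  sum-δʳ : ∀ (i : Fin n) (f : Fin n → ℤ) → sum (λ k → f k * δ i k) ≡ f i
  sum-δʳ i f = trans (sum-cong-≗ λ k → ℤ.*-comm (f k) (δ i k)) (sum-δˡ i f)

  congruence-skew : {A : Matrix n n} → SkewSymmetric A → (X : Matrix m n) → SkewSymmetric (X · A · X ᵀ)
  congruence-skew {A = A} skew X i j = begin
    sum (λ l → sum (λ k → X i k * A k l) * X j l)
      ≡⟨ sum-cong-≗ (λ l → *-distribʳ-sum (X j l) (λ k → X i k * A k l)) ⟩
    sum (λ l → sum (λ k → X i k * A k l * X j l))
      ≡⟨ ∑-comm (λ l k → X i k * A k l * X j l) ⟩
    sum (λ k → sum (λ l → X i k * A k l * X j l))
      ≡⟨ sum-cong-≗ (λ k → trans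
           (sum-cong-≗ λ l → trans (cong (λ a → X i k * a * X j l) (skew k l)) (flip (X i k) (A l k) (X j l)))
           (trans (sum-neg λ l → X j l * A l k * X i k)
             (cong -_ (sym (*-distribʳ-sum (X i k) (λ l → X j l * A l k)))))) ⟩
    sum (λ k → - (sum (λ l → X j l * A l k) * X i k))
      ≡⟨ sum-neg (λ k → sum (λ l → X j l * A l k) * X i k) ⟩
    - sum (λ k → sum (λ l → X j l * A l k) * X i k) ∎
    where
    flip : ∀ a b c → a * - b * c ≡ - (c * b * a)
    flip = solve-∀

  det-scale-rows : (d : Fin n → ℤ) (A : Matrix n n) → det (λ i j → d i * A i j) ≡ product d * det A
  det-scale-rows {zero}  d A = refl
  det-scale-rows {suc n} d A = begin
    sum (λ j → sgn j * (d zero * A zero j) * det (λ r c → d (suc r) * A (suc r) (punchIn j c)))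
      ≡⟨ sum-cong-≗ (λ j → trans
           (cong (_*_ (sgn j * (d zero * A zero j)))
             (det-scale-rows (d ∘ suc) (λ r c → A (suc r) (punchIn j c))))
           (regroup (sgn j) (d zero) (A zero j) (product (d ∘ suc)) (det λ r c → A (suc r) (punchIn j c)))) ⟩
    sum (λ j → product d * (sgn j * A zero j * det (λ r c → A (suc r) (punchIn j c))))
      ≡⟨ *-distribˡ-sum (product d) (λ j → sgn j * A zero j * det (λ r c → A (suc r) (punchIn j c))) ⟨
    product d * det A ∎
    where
    regroup : ∀ s d a p m → s * (d * a) * (p * m) ≡ d * p * (s * a * m)
    regroup = solve-∀

  det-first-row : (A : Matrix (suc n) (suc n)) → (∀ j → A zero (suc j) ≡ 0ℤ) →
                  det A ≡ A zero zero * det (λ r c → A (suc r) (suc c))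
  det-first-row A A₀≡0 = trans
    (cong (_+_ (1ℤ * A zero zero * det (λ r c → A (suc r) (suc c))))
      (sum-zero λ j → trans
        (cong (λ a → sgn (suc j) * a * det (λ r c → A (suc r) (punchIn (suc j) c))) (A₀≡0 j))
        (vanish (sgn (suc j)) (det (λ r c → A (suc r) (punchIn (suc j) c))))))
    (simplify (A zero zero) (det (λ r c → A (suc r) (suc c))))
    where
    vanish : ∀ s d → s * 0ℤ * d ≡ 0ℤ
    vanish = solve-∀
    simplify : ∀ a d → 1ℤ * a * d + 0ℤ ≡ a * d
    simplify = solve-∀

  det-δ : ∀ n → det (δ {n}) ≡ 1ℤ
  det-δ zero    = refl
  det-δ (suc n) = trans (det-first-row (δ {suc n}) (λ j → refl)) (trans (ℤ.*-identityˡ (det (δ {n}))) (det-δ n))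

  δ-punchIn : ∀ (j : Fin (suc n)) r c → δ (punchIn j r) (punchIn j c) ≡ δ r c
  δ-punchIn         zero    r       c       = refl
  δ-punchIn {suc n} (suc j) zero    zero    = refl
  δ-punchIn {suc n} (suc j) zero    (suc c) = refl
  δ-punchIn {suc n} (suc j) (suc r) zero    = refl
  δ-punchIn {suc n} (suc j) (suc r) (suc c) = δ-punchIn j r c

  δ-punchInᵢ : ∀ (j : Fin (suc n)) c → δ j (punchIn j c) ≡ 0ℤ
  δ-punchInᵢ         zero    c       = refl
  δ-punchInᵢ {suc n} (suc j) zero    = refl
  δ-punchInᵢ {suc n} (suc j) (suc c) = δ-punchInᵢ j c

  product≢0 : (d : Fin n → ℤ) → (∀ i → d i ≢ 0ℤ) → product d ≢ 0ℤ
  product≢0 {zero}  d d≢0 ()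
  product≢0 {suc n} d d≢0 eq =
    [ d≢0 zero , product≢0 (d ∘ suc) (d≢0 ∘ suc) ]′ (ℤ.i*j≡0⇒i≡0∨j≡0 (d zero) eq)

  -- With skewness, the matrix is block diagonal, and its leading block with rows (0, a) and (-a, 0)
  -- has determinant a².
  det-hyperbolic : ∀ (E : Matrix (suc (suc n)) (suc (suc n))) a → SkewSymmetric E → E zero (suc zero) ≡ a →
                   (∀ k → E zero (suc (suc k)) ≡ 0ℤ) → (∀ k → E (suc zero) (suc (suc k)) ≡ 0ℤ) →
                   det E ≡ a * a * det (λ r c → E (suc (suc r)) (suc (suc c)))
  det-hyperbolic {n} E a E-skew E₀₁ E₀ₖ E₁ₖ = begin
    det E
      ≡⟨ cong₂ _+_ (cong (λ x → 1ℤ * x * M₀) (skew-diagonal {A = E} E-skew zero))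
           (cong₂ _+_ (cong₂ (λ x y → -1ℤ * 1ℤ * x * y) E₀₁ det-M₁)
             (sum-zero λ r → trans (cong (λ x → sgn (suc (suc r)) * x * M r) (E₀ₖ r))
               (vanish (sgn (suc (suc r))) (M r)))) ⟩
    1ℤ * 0ℤ * M₀ + (-1ℤ * 1ℤ * a * (- a * det complement) + 0ℤ)
      ≡⟨ simplify M₀ a (det complement) ⟩
    a * a * det complement ∎
    where
    complement : Matrix n n
    complement r c = E (suc (suc r)) (suc (suc c))
    M₀ = det λ r c → E (suc r) (suc c)
    M : Fin n → ℤ
    M k = det λ r c → E (suc r) (punchIn (suc (suc k)) c)
    det-M₁ : det (λ r c → E (suc r) (punchIn (suc zero) c)) ≡ - a * det complement
    det-M₁ = trans (det-first-row (λ r c → E (suc r) (punchIn (suc zero) c)) E₁ₖ)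
      (cong (_* det complement) (trans (E-skew (suc zero) zero) (cong -_ E₀₁)))
    vanish : ∀ s d → s * 0ℤ * d ≡ 0ℤ
    vanish = solve-∀
    simplify : ∀ m a d → 1ℤ * 0ℤ * m + (-1ℤ * 1ℤ * a * (- a * d) + 0ℤ) ≡ a * a * d
    simplify = solve-∀

  congruence-row : ∀ (A : Matrix n n) (X : Matrix m n) i k → X i ≡ δ k →
                   ∀ i′ → (X · A · X ᵀ) i i′ ≡ sum λ l → A k l * X i′ l
  congruence-row A X i k eq i′ = trans
    (cong (λ u → sum λ l → sum (λ k → u k * A k l) * X i′ l) eq)
    (sum-cong-≗ λ l → cong (_* X i′ l) (sum-δˡ k (λ k → A k l)))

  sum-*-δ₃ : ∀ (f : Fin n → ℤ) a x y i j k → sum (λ l → f l * (a * δ i l + x * δ j l + y * δ k l)) ≡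
             a * f i + x * f j + y * f k
  sum-*-δ₃ f a x y i j k = begin
    sum (λ l → f l * (a * δ i l + x * δ j l + y * δ k l))
      ≡⟨ sum-cong-≗ (λ l → distr (f l) a x y (δ i l) (δ j l) (δ k l)) ⟩
    sum (λ l → 1ℤ * (a * (f l * δ i l) + x * (f l * δ j l)) + y * (f l * δ k l))
      ≡⟨ sum-linear 1ℤ y (λ l → a * (f l * δ i l) + x * (f l * δ j l)) (λ l → f l * δ k l) ⟩
    1ℤ * sum (λ l → a * (f l * δ i l) + x * (f l * δ j l)) + y * sum (λ l → f l * δ k l)
      ≡⟨ cong₂ (λ p q → 1ℤ * p + y * q)
           (trans (sum-linear a x (λ l → f l * δ i l) (λ l → f l * δ j l))
             (cong₂ (λ p q → a * p + x * q) (sum-δʳ i f) (sum-δʳ j f)))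
           (sum-δʳ k f) ⟩
    1ℤ * (a * f i + x * f j) + y * f k
      ≡⟨ cong (_+ y * f k) (ℤ.*-identityˡ (a * f i + x * f j)) ⟩
    a * f i + x * f j + y * f k ∎
    where
    distr : ∀ f a x y p q r → f * (a * p + x * q + y * r) ≡ 1ℤ * (a * (f * p) + x * (f * q)) + y * (f * r)
    distr = solve-∀

  -- One step of symplectic Gram–Schmidt: with a = A₀ⱼ ≠ 0, the basis e₀, eⱼ,
  -- a eₖ - A₀ₖ eⱼ + Aⱼₖ e₀ (k ≠ 0, j) splits off a hyperbolic plane.
  module _ (A : Matrix (suc (suc n)) (suc (suc n))) (skew : SkewSymmetric A) (j : Fin (suc n)) where
    private
      a = A zero (suc j)

      ρ : Fin n → Fin (suc (suc n))
      ρ r = suc (punchIn j r)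

      basis : Matrix (suc (suc n)) (suc (suc n))
      basis zero          = δ zero
      basis (suc zero)    = δ (suc j)
      basis (suc (suc r)) = λ c → a * δ (ρ r) c + - A zero (ρ r) * δ (suc j) c + A (suc j) (ρ r) * δ zero c

      E₀₁ : (basis · A · basis ᵀ) zero (suc zero) ≡ a
      E₀₁ = trans (congruence-row A basis zero zero refl (suc zero)) (sum-δʳ (suc j) (A zero))

      E₀ₖ : ∀ r → (basis · A · basis ᵀ) zero (suc (suc r)) ≡ 0ℤ
      E₀ₖ r = trans (congruence-row A basis zero zero refl (suc (suc r))) (trans
        (sum-*-δ₃ (A zero) a (- A zero (ρ r)) (A (suc j) (ρ r)) (ρ r) (suc j) zero) (trans
        (cong (λ x → a * A zero (ρ r) + - A zero (ρ r) * a + A (suc j) (ρ r) * x) (skew-diagonal {A = A} skew zero))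
        (cancel a (A zero (ρ r)) (A (suc j) (ρ r)))))
        where
        cancel : ∀ a b c → a * b + - b * a + c * 0ℤ ≡ 0ℤ
        cancel = solve-∀

      E₁ₖ : ∀ r → (basis · A · basis ᵀ) (suc zero) (suc (suc r)) ≡ 0ℤ
      E₁ₖ r = trans (congruence-row A basis (suc zero) (suc j) refl (suc (suc r))) (trans
        (sum-*-δ₃ (A (suc j)) a (- A zero (ρ r)) (A (suc j) (ρ r)) (ρ r) (suc j) zero) (trans
        (cong₂ (λ x y → a * A (suc j) (ρ r) + - A zero (ρ r) * x + A (suc j) (ρ r) * y)
          (skew-diagonal {A = A} skew (suc j)) (skew (suc j) zero))
        (cancel a (A zero (ρ r)) (A (suc j) (ρ r)))))
        where
        cancel : ∀ a b c → a * c + - b * 0ℤ + c * - a ≡ 0ℤ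
        cancel = solve-∀

      -- The first two rows remove columns 0 and `suc j`, where the correction terms of the other
      -- rows are supported; what remains is `a` times the identity.
      det-basis : det basis ≡ sgn j * product {n} (λ _ → a)
      det-basis = begin
        det basis
          ≡⟨ det-first-row basis (λ _ → refl) ⟩
        1ℤ * sum (λ k → sgn k * δ j k * M k)
          ≡⟨ trans (ℤ.*-identityˡ (sum λ k → sgn k * δ j k * M k))
               (sum-cong-≗ λ k → swap (sgn k) (δ j k) (M k)) ⟩
        sum (λ k → δ j k * (sgn k * M k))
          ≡⟨ sum-δˡ j (λ k → sgn k * M k) ⟩
        sgn j * M j
          ≡⟨ cong (_*_ (sgn j)) det-M ⟩
        sgn j * product {n} (λ _ → a) ∎
        where
        M : Fin (suc n) → ℤ
        M k = det λ r c → basis (suc (suc r)) (suc (punchIn k c))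
        swap : ∀ s d m → s * d * m ≡ d * (s * m)
        swap = solve-∀
        drop : ∀ a x y p → a * p + x * 0ℤ + y * 0ℤ ≡ a * p
        drop = solve-∀
        det-M : M j ≡ product {n} (λ _ → a)
        det-M = begin
          M j
            ≡⟨ det-cong (λ r c → trans
                 (cong₂ (λ p q → a * p + - A zero (ρ r) * q + A (suc j) (ρ r) * 0ℤ)
                   (δ-punchIn j r c) (δ-punchInᵢ j c))
                 (drop a (- A zero (ρ r)) (A (suc j) (ρ r)) (δ r c))) ⟩
          det {n} (λ r c → a * δ r c)
            ≡⟨ det-scale-rows {n} (λ _ → a) (δ {n}) ⟩
          product {n} (λ _ → a) * det (δ {n})
            ≡⟨ cong (_*_ (product {n} (λ _ → a))) (det-δ n) ⟩
          product {n} (λ _ → a) * 1ℤ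
            ≡⟨ ℤ.*-identityʳ (product {n} (λ _ → a)) ⟩
          product {n} (λ _ → a) ∎

    -- The basis is not unimodular: its determinant d is a power of `a` up to sign. Keeping d² on
    -- the left avoids fractions.
    split-hyperbolic-plane : a ≢ 0ℤ → ∃ λ d → d ≢ 0ℤ × ∃ λ (N : Matrix n n) →
      SkewSymmetric N × d * d * det A ≡ a * a * det N
    split-hyperbolic-plane a≢0 = det basis , basis≢0 , (λ r c → (basis · A · basis ᵀ) (suc (suc r)) (suc (suc c))) ,
      (λ r c → E-skew (suc (suc r)) (suc (suc c))) , (begin
        det basis * det basis * det A           ≡⟨ regroup (det basis) (det A) ⟩
        det basis * det A * det basis           ≡⟨ cong (_*_ (det basis * det A)) (det-transpose _ basis) ⟩
        det basis * det A * det (basis ᵀ)       ≡⟨ cong (_* det (basis ᵀ)) (det-· basis A) ⟨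
        det (basis · A) * det (basis ᵀ)         ≡⟨ det-· (basis · A) (basis ᵀ) ⟨
        det (basis · A · basis ᵀ)
          ≡⟨ det-hyperbolic (basis · A · basis ᵀ) a E-skew E₀₁ E₀ₖ E₁ₖ ⟩
        a * a * det (λ r c → (basis · A · basis ᵀ) (suc (suc r)) (suc (suc c))) ∎)
      where
      E-skew : SkewSymmetric (basis · A · basis ᵀ)
      E-skew = congruence-skew skew basis
      regroup : ∀ b d → b * b * d ≡ b * d * b
      regroup = solve-∀
      basis≢0 : det basis ≢ 0ℤ
      basis≢0 eq = [ (λ sgn≡0 → -1≢0 (ℤ.i^n≡0⇒i≡0 -1ℤ (toℕ j) sgn≡0)) , product≢0 {n} (λ _ → a) (λ _ → a≢0) ]′
        (ℤ.i*j≡0⇒i≡0∨j≡0 (sgn j) (trans (sym det-basis) eq))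
        where
        -1≢0 : -1ℤ ≢ 0ℤ
        -1≢0 ()

  IsSquare : ℤ → Set
  IsSquare a = ∃ λ z → a ≡ z * z

  -- A zero first row gives the square of 0. Otherwise a nonzero entry `a` serves as pivot, d² times
  -- the determinant is the square of `a * z`, and d is cancelled.
  skew-det-square-step : (∀ (N : Matrix n n) → SkewSymmetric N → IsSquare (det N)) →
    ∀ (A : Matrix (suc (suc n)) (suc (suc n))) → SkewSymmetric A → IsSquare (det A)
  skew-det-square-step {n} ih A skew = by-pivot (Fin.any? λ j → ¬? (A zero (suc j) ℤ.≟ 0ℤ))
    where
    regroup : ∀ a z → a * a * (z * z) ≡ a * z * (a * z)
    regroup = solve-∀
    by-pivot : Dec (∃ λ j → A zero (suc j) ≢ 0ℤ) → IsSquare (det A)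
    by-pivot (no ¬∃) = 0ℤ , trans
      (det-first-row A λ j → decidable-stable (A zero (suc j) ℤ.≟ 0ℤ) λ ≢0 → ¬∃ (j , ≢0))
      (trans (cong (_* det (λ r c → A (suc r) (suc c))) (skew-diagonal {A = A} skew zero))
        (ℤ.*-zeroˡ (det (λ r c → A (suc r) (suc c)))))
    by-pivot (yes (j , a≢0)) =
      let d , d≢0 , N , N-skew , eq = split-hyperbolic-plane A skew j a≢0
          z , N≡z² = ih N N-skew
      in square-cancel d (det A) (A zero (suc j) * z) d≢0
        (trans eq (trans (cong (_*_ (A zero (suc j) * A zero (suc j))) N≡z²) (regroup (A zero (suc j)) z)))

  -- Even sizes are written `h * 2` throughout because `suc h * 2` reduces to two successors of
  -- `h * 2`.
  skew-det-square : ∀ h (A : Matrix (h ℕ.* 2) (h ℕ.* 2)) → SkewSymmetric A → IsSquare (det A)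
  skew-det-square zero    A skew = 1ℤ , refl
  skew-det-square (suc h) A skew = skew-det-square-step (skew-det-square h) A skew

-- Sums and products over ranges

module _ where
  open ≡-Reasoning

  -- Summands indexed by ℕ instead of `Fin n` make shifts, splittings and reversals plain
  -- arithmetic; the monoid is abstract to serve sums and products alike.
  module RangeFold (M : CommutativeMonoid 0ℓ 0ℓ) where
    open CommutativeMonoid M renaming (refl to ≈-refl; sym to ≈-sym; trans to ≈-trans)
    open Algebra.Properties.CommutativeMonoid.Sum M using () renaming (sum to fold)

    range : ℕ → (ℕ → Carrier) → Carrier
    range n f = fold {n} λ i → f (toℕ i)

    range-cong : ∀ n {f g : ℕ → Carrier} → (∀ i → i ℕ.< n → f i ≈ g i) → range n f ≈ range n g
    range-cong zero    f≈g = ≈-refl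
    range-cong (suc n) f≈g = ∙-cong (f≈g 0 (s≤s z≤n)) (range-cong n λ i i<n → f≈g (suc i) (s≤s i<n))

    range-split : ∀ m n f → range (m ℕ.+ n) f ≈ range m f ∙ range n (λ i → f (m ℕ.+ i))
    range-split zero    n f = ≈-sym (identityˡ _)
    range-split (suc m) n f = ≈-trans (∙-congˡ (range-split m n (f ∘ suc))) (≈-sym (assoc _ _ _))

    range-last : ∀ n f → range (suc n) f ≈ range n f ∙ f n
    range-last zero    f = comm _ _
    range-last (suc n) f = ≈-trans (∙-congˡ (range-last n (f ∘ suc))) (≈-sym (assoc _ _ _))

    range-reverse : ∀ n f → range n f ≈ range n (λ i → f (n ∸ suc i))
    range-reverse zero    f = ≈-refl
    range-reverse (suc n) f =
      ≈-trans (range-last n f) (≈-trans (∙-congʳ (range-reverse n f)) (comm _ _))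

  open RangeFold ℤ.+-0-commutativeMonoid public renaming
    (range to Σ<; range-cong to Σ<-cong; range-split to Σ<-split; range-last to Σ<-last; range-reverse to Σ<-reverse)
  open RangeFold ℤ.*-1-commutativeMonoid public renaming
    (range to Π<; range-cong to Π<-cong; range-split to Π<-split; range-last to Π<-last; range-reverse to Π<-reverse)


  ^-distrib-* : ∀ a b n → (a * b) ^ n ≡ a ^ n * b ^ n
  ^-distrib-* a b zero    = refl
  ^-distrib-* a b (suc n) = trans (cong (_*_ (a * b)) (^-distrib-* a b n)) (regroup a b (a ^ n) (b ^ n))
    where
    regroup : ∀ a b c d → a * b * (c * d) ≡ a * c * (b * d)
    regroup = solve-∀

  binomial-theorem : ∀ x y n → (x + y) ^ n ≡ Σ< (suc n) λ k → + (n C k) * (x ^ k * y ^ (n ∸ k))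
  binomial-theorem x y n = begin
    (x + y) ^ n              ≡⟨ ^≡ (x + y) n ⟩
    (x + y) Exp.^ n          ≡⟨ Binomial.theorem n x y ⟩
    Binomial.binomialExpansion x y n
      ≡⟨ Σ<-cong (suc n) {λ k → (n C k) Mult.× (x Exp.^ k * y Exp.^ (n ∸ k))} (λ k _ → trans (×≡* (n C k) (x Exp.^ k * y Exp.^ (n ∸ k)))
           (cong (_*_ (+ (n C k))) (cong₂ _*_ (sym (^≡ x k)) (sym (^≡ y (n ∸ k)))))) ⟩
    Σ< (suc n) (λ k → + (n C k) * (x ^ k * y ^ (n ∸ k))) ∎
    where
    ^≡ : ∀ x n → x ^ n ≡ x Exp.^ n
    ^≡ x zero    = refl
    ^≡ x (suc n) = cong (_*_ x) (^≡ x n)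
    ×≡* : ∀ n x → n Mult.× x ≡ + n * x
    ×≡* zero    x = sym (ℤ.*-zeroˡ x)
    ×≡* (suc n) x = trans (cong (_+_ x) (×≡* n x)) (sym (ℤ.suc-* (+ n) x))

  nCk*k![n∸k]!≡n! : ∀ {n k} → k ℕ.≤ n → (n C k) ℕ.* (k ! ℕ.* (n ∸ k) !) ≡ n !
  nCk*k![n∸k]!≡n! {n} {k} k≤n = trans
    (cong (ℕ._* (k ! ℕ.* (n ∸ k) !)) (nCk≡n!/k![n-k]! k≤n))
    (m/n*n≡m (k![n∸k]!∣n! k≤n))
    where instance
      k![n∸k]!≢0 = k ℕ.!* (n ∸ k) !≢0

-- Vandermonde determinants

-- The Vandermonde product of all xⱼ - xᵢ with i < j. The factors of `T` have the opposite sign.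
Δ : Vector ℤ n → ℤ
Δ {zero}  x = 1ℤ
Δ {suc n} x = product (λ i → x (suc i) - x zero) * Δ (tail x)

δℕ : ℕ → ℕ → ℤ
δℕ zero    zero    = 1ℤ
δℕ zero    (suc j) = 0ℤ
δℕ (suc i) zero    = 0ℤ
δℕ (suc i) (suc j) = δℕ i j

Σ<-δℕ : ∀ n {k} → k ℕ.< n → (f : ℕ → ℤ) → Σ< n (λ i → δℕ i k * f i) ≡ f k
Σ<-δℕ (suc n) {zero} k<n f = trans
  (cong₂ _+_ (ℤ.*-identityˡ (f 0)) (sum-zero {n} λ i → ℤ.*-zeroˡ (f (suc (toℕ i))))) (ℤ.+-identityʳ (f 0))
Σ<-δℕ (suc n) {suc k} (s≤s k<n) f = trans
  (cong₂ _+_ (ℤ.*-zeroˡ (f 0)) (Σ<-δℕ n k<n (f ∘ suc))) (ℤ.+-identityˡ (f (suc k)))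

module _ where
  open ≡-Reasoning

  private
    -- Left multiplication by this matrix subtracts x times each row from the next one.
    bidiagonal : ℤ → ∀ n → Matrix n n
    bidiagonal x n r c = δℕ (toℕ c) (toℕ r) + - x * δℕ (suc (toℕ c)) (toℕ r)

    det-bidiagonal : ∀ x n → det (bidiagonal x n) ≡ 1ℤ
    det-bidiagonal x zero    = refl
    det-bidiagonal x (suc n) = trans
      (det-first-row (bidiagonal x (suc n)) λ j → simplify₀ x)
      (trans (cong (_* det (bidiagonal x n)) (simplify₁ x))
        (trans (ℤ.*-identityˡ (det (bidiagonal x n))) (det-bidiagonal x n)))
      where
      simplify₀ : ∀ x → 0ℤ + - x * 0ℤ ≡ 0ℤ
      simplify₀ = solve-∀
      simplify₁ : ∀ x → 1ℤ + - x * 0ℤ ≡ 1ℤ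
      simplify₁ = solve-∀

    Σ-bidiagonal : ∀ x {n} (r : Fin n) (f : ℕ → ℤ) → sum (λ c → bidiagonal x n r c * f (toℕ c)) ≡
                   f (toℕ r) + - x * sum {n} (λ c → δℕ (suc (toℕ c)) (toℕ r) * f (toℕ c))
    Σ-bidiagonal x {n} r f = begin
      sum {n} (λ c → (δℕ (toℕ c) (toℕ r) + - x * δℕ (suc (toℕ c)) (toℕ r)) * f (toℕ c))
        ≡⟨ sum-cong-≗ {n} (λ c → distr (δℕ (toℕ c) (toℕ r)) (- x) (δℕ (suc (toℕ c)) (toℕ r)) (f (toℕ c))) ⟩
      sum {n} (λ c → 1ℤ * (δℕ (toℕ c) (toℕ r) * f (toℕ c)) + - x * (δℕ (suc (toℕ c)) (toℕ r) * f (toℕ c)))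
        ≡⟨ sum-linear {n} 1ℤ (- x) (λ c → δℕ (toℕ c) (toℕ r) * f (toℕ c)) (λ c → δℕ (suc (toℕ c)) (toℕ r) * f (toℕ c)) ⟩
      1ℤ * Σ< n (λ c → δℕ c (toℕ r) * f c) + - x * Σ< n (λ c → δℕ (suc c) (toℕ r) * f c)
        ≡⟨ cong (_+ - x * Σ< n (λ c → δℕ (suc c) (toℕ r) * f c)) (trans
             (ℤ.*-identityˡ (Σ< n (λ c → δℕ c (toℕ r) * f c))) (Σ<-δℕ n {toℕ r} (Fin.toℕ<n r) f)) ⟩
      f (toℕ r) + - x * Σ< n (λ c → δℕ (suc c) (toℕ r) * f c) ∎
      where
      distr : ∀ a x b f → (a + x * b) * f ≡ 1ℤ * (a * f) + x * (b * f)
      distr = solve-∀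

  -- Subtracting x₀ times each row from the next leaves ones in the first row and (xᵢ - x₀) xᵢ^r
  -- below. The first column is then cleared, and the factors xᵢ - x₀ come out of a smaller
  -- Vandermonde matrix.
  vandermonde : (x : Vector ℤ n) → det (λ t i → x i ^ toℕ t) ≡ Δ x
  vandermonde {zero}  x = refl
  vandermonde {suc n} x = begin
    det V                                    ≡⟨ ℤ.*-identityˡ (det V) ⟨
    1ℤ * det V                               ≡⟨ cong (_* det V) (det-bidiagonal x₀ (suc n)) ⟨
    det (bidiagonal x₀ (suc n)) * det V      ≡⟨ det-· (bidiagonal x₀ (suc n)) V ⟨
    det (bidiagonal x₀ (suc n) · V)          ≡⟨ det-cong {A = bidiagonal x₀ (suc n) · V} {B = W} (λ { zero i → row₀ i ; (suc r) i → rowₛ r i }) ⟩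
    det W                                    ≡⟨ det-transpose _ W ⟩
    det (W ᵀ)                                ≡⟨ det-first-row (W ᵀ) (λ r → first-column (x zero ^ toℕ r) x₀) ⟩
    1ℤ * det (λ i r → (x (suc i) - x₀) * x (suc i) ^ toℕ r)
      ≡⟨ trans (ℤ.*-identityˡ (det λ i r → (x (suc i) - x₀) * x (suc i) ^ toℕ r)) (det-scale-rows (λ i → x (suc i) - x₀) λ i r → x (suc i) ^ toℕ r) ⟩
    product (λ i → x (suc i) - x₀) * det (λ i r → x (suc i) ^ toℕ r)
      ≡⟨ cong (_*_ (product λ i → x (suc i) - x₀)) (trans
           (det-transpose _ λ i r → x (suc i) ^ toℕ r) (vandermonde (tail x))) ⟩
    Δ x ∎
    where
    x₀ = x zero
    V : Matrix (suc n) (suc n)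
    V t i = x i ^ toℕ t
    W : Matrix (suc n) (suc n)
    W zero    i = 1ℤ
    W (suc r) i = (x i - x₀) * x i ^ toℕ r
    first-column : ∀ a x → (x - x) * a ≡ 0ℤ
    first-column = solve-∀
    row₀ : ∀ i → (bidiagonal x₀ (suc n) · V) zero i ≡ 1ℤ
    row₀ i = trans (Σ-bidiagonal x₀ {suc n} zero (x i ^_)) (trans
      (cong (λ s → 1ℤ + - x₀ * s) (sum-zero {suc n} λ c → ℤ.*-zeroˡ (x i ^ toℕ c))) (simplify x₀))
      where
      simplify : ∀ x → 1ℤ + - x * 0ℤ ≡ 1ℤ
      simplify = solve-∀
    rowₛ : ∀ r i → (bidiagonal x₀ (suc n) · V) (suc r) i ≡ (x i - x₀) * x i ^ toℕ r
    rowₛ r i = trans (Σ-bidiagonal x₀ {suc n} (suc r) (x i ^_)) (trans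
      (cong (λ s → x i * x i ^ toℕ r + - x₀ * s)
        (Σ<-δℕ (suc n) {toℕ r} (ℕ.m<n⇒m<1+n (Fin.toℕ<n r)) (x i ^_)))
      (factor (x i) x₀ (x i ^ toℕ r)))
      where
      factor : ∀ a x p → a * p + - x * p ≡ (a - x) * p
      factor = solve-∀

-- Arithmetic modulo p

module Modular (p : ℕ) where

  infix 4 _≈_
  -- A record around the divisibility statement, so that `a` and `b` can be inferred from a proof.
  record _≈_ (a b : ℤ) : Set where
    constructor mod
    field ∣- : a ≡ b [mod p ]

  open _≈_ public

  ≈-refl : ∀ {a} → a ≈ a
  ≈-refl {a} = mod (ℤ.divides 0ℤ (ℤ.+-inverseʳ a))

  ≈-reflexive : ∀ {a b} → a ≡ b → a ≈ b
  ≈-reflexive refl = ≈-refl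

  ≈-sym : ∀ {a b} → a ≈ b → b ≈ a
  ≈-sym {a} {b} (mod d) = mod (subst (+ p ℤ.∣_) (flip a b) (ℤ.∣m⇒∣-m d))
    where
    flip : ∀ a b → - (a - b) ≡ b - a
    flip = solve-∀

  ≈-trans : ∀ {a b c} → a ≈ b → b ≈ c → a ≈ c
  ≈-trans {a} {b} {c} (mod d) (mod e) = mod (subst (+ p ℤ.∣_) (telescope a b c) (ℤ.∣m∣n⇒∣m+n d e))
    where
    telescope : ∀ a b c → (a - b) + (b - c) ≡ a - c
    telescope = solve-∀

  +-cong : ∀ {a b c d} → a ≈ b → c ≈ d → a + c ≈ b + d
  +-cong {a} {b} {c} {d} (mod e) (mod f) = mod (subst (+ p ℤ.∣_) (regroup a b c d) (ℤ.∣m∣n⇒∣m+n e f))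
    where
    regroup : ∀ a b c d → (a - b) + (c - d) ≡ (a + c) - (b + d)
    regroup = solve-∀

  *-cong : ∀ {a b c d} → a ≈ b → c ≈ d → a * c ≈ b * d
  *-cong {a} {b} {c} {d} (mod e) (mod f) =
    mod (subst (+ p ℤ.∣_) (regroup a b c d) (ℤ.∣m∣n⇒∣m+n (ℤ.∣m⇒∣m*n c e) (ℤ.∣n⇒∣m*n b f)))
    where
    regroup : ∀ a b c d → (a - b) * c + b * (c - d) ≡ a * c - b * d
    regroup = solve-∀

  *-congˡ : ∀ a {b c} → b ≈ c → a * b ≈ a * c
  *-congˡ a = *-cong (≈-refl {a})

  *-congʳ : ∀ a {b c} → b ≈ c → b * a ≈ c * a
  *-congʳ a b≈c = *-cong b≈c (≈-refl {a})

  ^-cong : ∀ {a b} n → a ≈ b → a ^ n ≈ b ^ n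
  ^-cong zero    a≈b = ≈-refl
  ^-cong (suc n) a≈b = *-cong a≈b (^-cong n a≈b)

  open Respects _≈_ ≈-refl +-cong *-cong public

  ≈-setoid : Setoid 0ℓ 0ℓ
  ≈-setoid = record
    { Carrier = ℤ ; _≈_ = _≈_
    ; isEquivalence = record { refl = ≈-refl ; sym = ≈-sym ; trans = ≈-trans } }

  ∣⇒≈0 : ∀ {a} → + p ℤ.∣ a → a ≈ 0ℤ
  ∣⇒≈0 {a} p∣a = mod (subst (+ p ℤ.∣_) (sym (ℤ.+-identityʳ a)) p∣a)

  ≈0⇒∣ : ∀ {a} → a ≈ 0ℤ → + p ℤ.∣ a
  ≈0⇒∣ {a} (mod d) = subst (+ p ℤ.∣_) (ℤ.+-identityʳ a) d

  +∣⇒≈0 : ∀ {n} → p ℕ.∣ n → + n ≈ 0ℤ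
  +∣⇒≈0 p∣n = ∣⇒≈0 (ℤ.∣ᵤ⇒∣ p∣n)

  -≈0⇒≈ : ∀ {a b} → a - b ≈ 0ℤ → a ≈ b
  -≈0⇒≈ a-b≈0 = mod (≈0⇒∣ a-b≈0)

  ≈⇒-≈0 : ∀ {a b} → a ≈ b → a - b ≈ 0ℤ
  ≈⇒-≈0 (mod d) = ∣⇒≈0 d

-- Prime moduli and Fermat's little theorem

module PrimeModulus (p : ℕ) (p-prime : Prime p) where
  open Modular p public
  open import Relation.Binary.Reasoning.Setoid ≈-setoid

  private instance
    p≢0 : ℕ.NonZero p
    p≢0 = prime⇒nonZero p-prime

  1≉0 : ¬ 1ℤ ≈ 0ℤ
  1≉0 1≈0 = contradiction (ℕ.∣1⇒≡1 (ℤ.∣⇒∣ᵤ (≈0⇒∣ 1≈0)))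
    (ℕ.nonTrivial⇒≢1 {p} {{prime⇒nonTrivial p-prime}})

  i*j≈0⇒i≈0∨j≈0 : ∀ a b → a * b ≈ 0ℤ → a ≈ 0ℤ ⊎ b ≈ 0ℤ
  i*j≈0⇒i≈0∨j≈0 a b ab≈0 = Sum.map (∣⇒≈0 ∘ ℤ.∣ᵤ⇒∣) (∣⇒≈0 ∘ ℤ.∣ᵤ⇒∣)
    (euclidsLemma ∣ a ∣ ∣ b ∣ p-prime (subst (p ℕ.∣_) (ℤ.abs-* a b) (ℤ.∣⇒∣ᵤ (≈0⇒∣ ab≈0))))

  *-≉0 : ∀ {a b} → ¬ a ≈ 0ℤ → ¬ b ≈ 0ℤ → ¬ a * b ≈ 0ℤ
  *-≉0 {a} {b} a≉0 b≉0 ab≈0 = [ a≉0 , b≉0 ]′ (i*j≈0⇒i≈0∨j≈0 a b ab≈0)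

  ^-≉0 : ∀ {a} n → ¬ a ≈ 0ℤ → ¬ a ^ n ≈ 0ℤ
  ^-≉0 zero    a≉0 = 1≉0
  ^-≉0 (suc n) a≉0 = *-≉0 a≉0 (^-≉0 n a≉0)

  product-≉0 : ∀ {n} (f : Fin n → ℤ) → (∀ i → ¬ f i ≈ 0ℤ) → ¬ product f ≈ 0ℤ
  product-≉0 {zero}  f f≉0 = 1≉0
  product-≉0 {suc n} f f≉0 = *-≉0 (f≉0 zero) (product-≉0 (f ∘ suc) (f≉0 ∘ suc))

  *-cancelʳ-≈ : ∀ {a b} u → ¬ u ≈ 0ℤ → a * u ≈ b * u → a ≈ b
  *-cancelʳ-≈ {a} {b} u u≉0 au≈bu = [ -≈0⇒≈ , (λ u≈0 → contradiction u≈0 u≉0) ]′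
    (i*j≈0⇒i≈0∨j≈0 (a - b) u (≈-trans (≈-reflexive (distr a b u)) (≈⇒-≈0 au≈bu)))
    where
    distr : ∀ a b u → (a - b) * u ≡ a * u - b * u
    distr = solve-∀

  a²≈b²⇒a≈b∨a≈-b : ∀ a b → a * a ≈ b * b → a ≈ b ⊎ a ≈ - b
  a²≈b²⇒a≈b∨a≈-b a b a²≈b² = Sum.map -≈0⇒≈ (λ e → -≈0⇒≈ (subst (_≈ 0ℤ) (minus a b) e))
    (i*j≈0⇒i≈0∨j≈0 (a - b) (a + b) (≈-trans (≈-reflexive (factor a b)) (≈⇒-≈0 a²≈b²)))
    where
    factor : ∀ a b → (a - b) * (a + b) ≡ a * a - b * b
    factor = solve-∀
    minus : ∀ a b → a + b ≡ a - (- b)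
    minus = solve-∀

  a^2≈b^2⇒a≈b∨a≈-b : ∀ a b → a ^ 2 ≈ b ^ 2 → a ≈ b ⊎ a ≈ - b
  a^2≈b^2⇒a≈b∨a≈-b a b a²≈b² = a²≈b²⇒a≈b∨a≈-b a b
    (subst₂ _≈_ (cong (a *_) (ℤ.*-identityʳ a)) (cong (b *_) (ℤ.*-identityʳ b)) a²≈b²)

  +-≉0 : ∀ {n} → 0 ℕ.< n → n ℕ.< p → ¬ + n ≈ 0ℤ
  +-≉0 {suc n} _ n<p n≈0 = ℕ.<⇒≱ n<p (ℕ.∣⇒≤ (ℤ.∣⇒∣ᵤ (≈0⇒∣ n≈0)))

  !-≉0 : ∀ n → n ℕ.< p → ¬ + (n !) ≈ 0ℤ
  !-≉0 zero    n<p = 1≉0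
  !-≉0 (suc n) n<p = subst (λ x → ¬ x ≈ 0ℤ) (sym (ℤ.pos-* (suc n) (n !)))
    (*-≉0 (+-≉0 (s≤s z≤n) n<p) (!-≉0 n (ℕ.<-trans (ℕ.n<1+n n) n<p)))

  residue≈ : ∀ a → a ≈ + (a ℤ.%ℕ p)
  residue≈ a = mod (ℤ.divides (a ℤ./ℕ p)
    (trans (cong (_- + (a ℤ.%ℕ p)) (ℤ.a≡a%ℕn+[a/ℕn]*n a p)) (cancel (+ (a ℤ.%ℕ p)) ((a ℤ./ℕ p) * + p))))
    where
    cancel : ∀ r q → r + q - r ≡ q
    cancel = solve-∀

  -- p divides p! = C(p,k) k! (p - k)!, but neither of the two factorials on the right.
  pCk≈0 : ∀ {k} → 0 ℕ.< k → k ℕ.< p → + (p C k) ≈ 0ℤ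
  pCk≈0 {k} 0<k k<p with i*j≈0⇒i≈0∨j≈0 (+ (p C k)) (+ (k ! ℕ.* (p ∸ k) !)) (begin
      + (p C k) * + (k ! ℕ.* (p ∸ k) !)    ≡⟨ ℤ.pos-* (p C k) (k ! ℕ.* (p ∸ k) !) ⟨
      + ((p C k) ℕ.* (k ! ℕ.* (p ∸ k) !))  ≡⟨ cong +_ (nCk*k![n∸k]!≡n! (ℕ.<⇒≤ k<p)) ⟩
      + (p !)                              ≈⟨ +∣⇒≈0 (m∣m! p) ⟩
      0ℤ                                   ∎)
    where
    m∣m! : ∀ m .{{_ : ℕ.NonZero m}} → m ℕ.∣ m !
    m∣m! (suc m) = ℕ.m∣m*n (m !)
  ... | inj₁ C≈0 = C≈0
  ... | inj₂ !≈0 = contradiction (subst (_≈ 0ℤ) (ℤ.pos-* (k !) ((p ∸ k) !)) !≈0)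
    (*-≉0 (!-≉0 k k<p) (!-≉0 (p ∸ k) (ℕ.∸-monoʳ-< 0<k (ℕ.<⇒≤ k<p))))

  fermat-step : ∀ a → (a + 1ℤ) ^ p ≈ a ^ p + 1ℤ
  -- Splitting off both outer binomial terms takes an exponent of the form `suc q`. So p is replaced
  -- by `suc (pred p)` together with the vanishing of its inner binomial coefficients.
  fermat-step a = subst (λ n → (∀ {k} → 0 ℕ.< k → k ℕ.< n → + (n C k) ≈ 0ℤ) → (a + 1ℤ) ^ n ≈ a ^ n + 1ℤ)
    (ℕ.suc-pred p) (λ C≈0 → frobenius (ℕ.pred p) C≈0) pCk≈0
    where
    frobenius : ∀ q → (∀ {k} → 0 ℕ.< k → k ℕ.< suc q → + (suc q C k) ≈ 0ℤ) →
                (a + 1ℤ) ^ suc q ≈ a ^ suc q + 1ℤ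
    frobenius q C≈0 = begin
      (a + 1ℤ) ^ suc q
        ≡⟨ binomial-theorem a 1ℤ (suc q) ⟩
      term 0 + Σ< (suc q) (term ∘ suc)
        ≡⟨ cong (_+_ (term 0)) (Σ<-last q (term ∘ suc)) ⟩
      term 0 + (Σ< q (term ∘ suc) + term (suc q))
        ≈⟨ +-cong (≈-reflexive term₀) (+-cong
             (≈-trans (sum-resp {q} λ i → middle (toℕ i) (Fin.toℕ<n i))
               (≈-reflexive (sum-replicate-zero q)))
             (≈-reflexive termₚ)) ⟩
      1ℤ + (0ℤ + a ^ suc q)
        ≡⟨ comm (a ^ suc q) ⟩
      a ^ suc q + 1ℤ ∎
      where
      term : ℕ → ℤ
      term k = + (suc q C k) * (a ^ k * 1ℤ ^ (suc q ∸ k))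
      comm : ∀ x → 1ℤ + (0ℤ + x) ≡ x + 1ℤ
      comm = solve-∀
      middle : ∀ i → i ℕ.< q → term (suc i) ≈ 0ℤ
      middle i i<q = ≈-trans
        (*-congʳ (a ^ suc i * 1ℤ ^ (q ∸ i)) (C≈0 (s≤s z≤n) (s≤s i<q)))
        (≈-reflexive (ℤ.*-zeroˡ (a ^ suc i * 1ℤ ^ (q ∸ i))))
      term₀ : term 0 ≡ 1ℤ
      term₀ = trans (cong₂ (λ c e → + c * (1ℤ * e)) (trans (nCk≡nC[n∸k] {0} {suc q} z≤n) (nCn≡1 (suc q))) (ℤ.^-zeroˡ (suc q))) refl
      termₚ : term (suc q) ≡ a ^ suc q
      termₚ = trans (cong₂ (λ c e → + c * (a ^ suc q * 1ℤ ^ e)) (nCn≡1 (suc q)) (ℕ.n∸n≡0 q))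
        (trans (ℤ.*-identityˡ (a ^ suc q * 1ℤ)) (ℤ.*-identityʳ (a ^ suc q)))

  fermat : ∀ a → a ^ p ≈ a
  fermat a = ≈-trans (^-cong p (residue≈ a)) (≈-trans (fermat-ℕ (a ℤ.%ℕ p)) (≈-sym (residue≈ a)))
    where
    fermat-ℕ : ∀ a → (+ a) ^ p ≈ + a
    fermat-ℕ zero    = ≈-reflexive (subst (λ n → 0ℤ ^ n ≡ 0ℤ) (ℕ.suc-pred p) (ℤ.*-zeroˡ (0ℤ ^ ℕ.pred p)))
    fermat-ℕ (suc a) = begin
      (+ suc a) ^ p     ≡⟨ cong (λ n → (+ n) ^ p) (ℕ.+-comm a 1) ⟨
      (+ a + 1ℤ) ^ p    ≈⟨ fermat-step (+ a) ⟩
      (+ a) ^ p + 1ℤ    ≈⟨ +-cong (fermat-ℕ a) ≈-refl ⟩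
      + a + 1ℤ          ≡⟨ cong +_ (ℕ.+-comm a 1) ⟩
      + suc a           ∎

  fermat′ : ∀ {q a} → p ≡ suc q → ¬ a ≈ 0ℤ → a ^ q ≈ 1ℤ
  fermat′ {q} {a} p≡1+q a≉0 = *-cancelʳ-≈ a a≉0 (begin
    a ^ q * a   ≡⟨ ℤ.*-comm (a ^ q) a ⟩
    a ^ suc q   ≡⟨ cong (a ^_) p≡1+q ⟨
    a ^ p       ≈⟨ fermat a ⟩
    a           ≡⟨ ℤ.*-identityˡ a ⟨
    1ℤ * a      ∎)

  Δ≉0 : ∀ {n} (x : Vector ℤ n) → (∀ i j → x i ≈ x j → i ≡ j) → ¬ Δ x ≈ 0ℤ
  Δ≉0 {zero}  x x-distinct = 1≉0
  Δ≉0 {suc n} x x-distinct = *-≉0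
    (product-≉0 (λ i → x (suc i) - x zero) λ i e → contradiction (x-distinct (suc i) zero (-≈0⇒≈ e)) λ ())
    (Δ≉0 (tail x) λ i j e → Fin.suc-injective (x-distinct (suc i) (suc j) e))

  -- With n + 1 distinct roots, the first and last rows of their Vandermonde
  -- matrix would agree modulo p.
  too-many-roots : ∀ n (x : Vector ℤ (suc (suc n))) → (∀ i j → x i ≈ x j → i ≡ j) →
                   ¬ (∀ i → x i ^ suc n ≈ 1ℤ)
  too-many-roots n x x-distinct x^n≈1 = Δ≉0 x x-distinct (begin
    Δ x       ≡⟨ vandermonde x ⟨
    det V     ≈⟨ det-resp V≈V′ ⟩
    det V′    ≡⟨ det-alt V′ zero (Fin.fromℕ (suc n)) (λ ()) V′-rows ⟩
    0ℤ        ∎)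
    where
    V V′ : Matrix (suc (suc n)) (suc (suc n))
    V t i = x i ^ toℕ t
    V′ = V [ Fin.fromℕ (suc n) ]≔ λ _ → 1ℤ
    V′-rows : ∀ i → V′ zero i ≡ V′ (Fin.fromℕ (suc n)) i
    V′-rows i = sym (≔-lookup V (Fin.fromℕ (suc n)) (λ _ → 1ℤ) i)
    V≈V′ : ∀ t i → V t i ≈ V′ t i
    V≈V′ t i = ≈-trans (≈-reflexive (≔-self V (Fin.fromℕ (suc n)) t i))
      (update V (Fin.fromℕ (suc n)) (λ i → ≈-trans (≈-reflexive (cong (x i ^_) (Fin.toℕ-fromℕ (suc n)))) (x^n≈1 i)) t i)
      where
      update : ∀ {m l} (A : Matrix m l) k {u v : Fin l → ℤ} → (∀ i → u i ≈ v i) →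
               ∀ t i → (A [ k ]≔ u) t i ≈ (A [ k ]≔ v) t i
      update A zero    u≈v zero    i = u≈v i
      update A zero    u≈v (suc t) i = ≈-refl
      update A (suc k) u≈v zero    i = ≈-refl
      update A (suc k) u≈v (suc t) i = update (tail A) k u≈v t i

  -- Euler's criterion, with (p - 1)/2 in the form `suc h`

  module Euler (h : ℕ) (p≡1+h*2 : p ≡ suc (suc h ℕ.* 2)) where

    H : ℕ
    H = suc h

    x²^H≈1 : ∀ {x} → ¬ x ≈ 0ℤ → (x ^ 2) ^ H ≈ 1ℤ
    x²^H≈1 {x} x≉0 = ≈-trans
      (≈-reflexive (trans (ℤ.^-*-assoc x 2 H) (cong (x ^_) (ℕ.*-comm 2 H)))) (fermat′ p≡1+h*2 x≉0)

    x^H²≈1 : ∀ {x} → ¬ x ≈ 0ℤ → x ^ H * x ^ H ≈ 1ℤ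
    x^H²≈1 {x} x≉0 = ≈-trans
      (≈-reflexive (trans (sym (^-distrib-* x x H)) (cong (λ y → (x * y) ^ H) (sym (ℤ.*-identityʳ x))))) (x²^H≈1 x≉0)

    H<p : H ℕ.< p
    H<p = subst (H ℕ.<_) (sym p≡1+h*2) (s≤s (ℕ.m≤m*n H 2))

    distinct : ∀ {i j} → i ℕ.< j → j ℕ.< H → ¬ + suc i ≈ + suc j
    distinct {i} {j} i<j j<H i≈j = +-≉0 (ℕ.m<n⇒0<n∸m i<j)
      (ℕ.≤-<-trans (ℕ.m∸n≤m j i) (ℕ.<-trans j<H H<p)) (begin
        + (j ∸ i)            ≡⟨⟩
        + (suc j ∸ suc i)    ≡⟨ ℤ.⊖-≥ (s≤s (ℕ.<⇒≤ i<j)) ⟨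
        suc j ℤ.⊖ suc i      ≡⟨ ℤ.m-n≡m⊖n (suc j) (suc i) ⟨
        + suc j - + suc i    ≈⟨ ≈⇒-≈0 (≈-sym i≈j) ⟩
        0ℤ                   ∎)

    -- Equal squares mean equal or opposite numbers modulo p, and two numbers between 1 and `H` have
    -- a sum between 2 and p - 1.
    small-squares : ∀ {i j} → i ℕ.< H → j ℕ.< H → (+ suc i) ^ 2 ≈ (+ suc j) ^ 2 → i ≡ j
    small-squares {i} {j} i<H j<H eq =
      [ same-sign (ℕ.<-cmp i j) , opposite-sign ]′ (a^2≈b^2⇒a≈b∨a≈-b (+ suc i) (+ suc j) eq)
      where
      p≡ : p ≡ suc (H ℕ.+ H)
      p≡ = trans p≡1+h*2 (cong suc (trans (ℕ.*-comm H 2) (cong (H ℕ.+_) (ℕ.+-identityʳ H))))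
      same-sign : Tri (i ℕ.< j) (i ≡ j) (i ℕ.> j) → + suc i ≈ + suc j → i ≡ j
      same-sign (tri≈ _ i≡j _) i≈j = i≡j
      same-sign (tri< i<j _ _) i≈j = contradiction i≈j (distinct i<j j<H)
      same-sign (tri> _ _ j<i) i≈j = contradiction (≈-sym i≈j) (distinct j<i i<H)
      opposite-sign : + suc i ≈ - + suc j → i ≡ j
      opposite-sign i≈-j = contradiction
        (≈-trans (+-cong i≈-j (≈-refl {+ suc j})) (≈-reflexive (ℤ.+-inverseˡ (+ suc j))))
        (+-≉0 (s≤s z≤n) (subst (suc i ℕ.+ suc j ℕ.<_) (sym p≡) (s≤s (ℕ.+-mono-≤ i<H j<H))))

    -- The squares of 1, ..., `H` are already `H` roots of x^H ≈ 1. A nonresidue with a^H ≈ 1 would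
    -- be one root too many, so of the two square roots of 1 only -1 is left.
    nonresidue : ∀ a → ¬ a ≈ 0ℤ → (∀ x → ¬ x ^ 2 ≈ a) → a ^ H ≈ -1ℤ
    nonresidue a a≉0 ¬square = [ (λ a^H≈1 → contradiction (roots-roots a^H≈1)
        (too-many-roots h roots roots-distinct)) , id ]′ (a²≈b²⇒a≈b∨a≈-b (a ^ H) 1ℤ (x^H²≈1 a≉0))
      where
      roots : Vector ℤ (suc (suc h))
      roots zero    = a
      roots (suc i) = (+ suc (toℕ i)) ^ 2
      roots-distinct : ∀ i j → roots i ≈ roots j → i ≡ j
      roots-distinct zero    zero    eq = refl
      roots-distinct zero    (suc j) eq = contradiction (≈-sym eq) (¬square (+ suc (toℕ j)))
      roots-distinct (suc i) zero    eq = contradiction eq (¬square (+ suc (toℕ i)))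
      roots-distinct (suc i) (suc j) eq =
        cong suc (Fin.toℕ-injective (small-squares (Fin.toℕ<n i) (Fin.toℕ<n j) eq))
      roots-roots : a ^ H ≈ 1ℤ → ∀ i → roots i ^ H ≈ 1ℤ
      roots-roots a^H≈1 zero    = a^H≈1
      roots-roots a^H≈1 (suc i) = x²^H≈1 (+-≉0 (s≤s z≤n) (ℕ.≤-<-trans (Fin.toℕ<n i) H<p))

    0^H≈0 : ∀ {a} → a ≈ 0ℤ → a ^ H ≈ 0ℤ
    0^H≈0 {a} a≈0 = ≈-trans (*-congʳ (a ^ h) a≈0) (≈-reflexive (ℤ.*-zeroˡ (a ^ h)))

    euler-criterion : ∀ a → legendre a p ≈ a ^ H
    euler-criterion a = by-cases (+ p ℤ.∣? a) (isSquareMod? a p)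
      where
      by-cases : (p∣a : Dec (+ p ℤ.∣ a)) (square : Dec (∃ λ (x : Fin p) → (+ toℕ x) ^ 2 ≡ a [mod p ])) →
                 (if does p∣a then 0ℤ else if does square then 1ℤ else -1ℤ) ≈ a ^ H
      by-cases (yes p∣a) square = ≈-sym (0^H≈0 (∣⇒≈0 p∣a))
      by-cases (no p∤a) (yes (x , x²≈a)) = ≈-trans
        (≈-sym (x²^H≈1 {+ toℕ x} λ x≈0 → p∤a (≈0⇒∣ (≈-trans (≈-sym (mod {(+ toℕ x) ^ 2} {a} x²≈a)) (^-cong 2 x≈0)))))
        (^-cong H (mod {(+ toℕ x) ^ 2} {a} x²≈a))
      -- The symbol searches for roots among 0, ..., p - 1 only; an arbitrary integer root is
      -- replaced by its remainder.
      by-cases (no p∤a) (no ¬square) = ≈-sym (nonresidue a (p∤a ∘ ≈0⇒∣) λ x x²≈a → ¬square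
        (Fin.fromℕ< (ℤ.n%ℕd<d x p) , ∣- (begin
          (+ toℕ (Fin.fromℕ< (ℤ.n%ℕd<d x p))) ^ 2
            ≡⟨ cong (λ r → (+ r) ^ 2) (Fin.toℕ-fromℕ< (ℤ.n%ℕd<d x p)) ⟩
          (+ (x ℤ.%ℕ p)) ^ 2
            ≈⟨ ^-cong 2 (residue≈ x) ⟨
          x ^ 2
            ≈⟨ x²≈a ⟩
          a ∎)))

    2≉0 : ¬ + 2 ≈ 0ℤ
    2≉0 = +-≉0 (s≤s z≤n) (subst (2 ℕ.<_) (sym p≡1+h*2) (s≤s (s≤s (s≤s z≤n))))

    data IsSign : ℤ → Set where
      zero  : IsSign 0ℤ
      plus  : IsSign 1ℤ
      minus : IsSign -1ℤ

    sign-* : ∀ {a b} → IsSign a → IsSign b → IsSign (a * b)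
    sign-* zero  zero  = zero
    sign-* zero  plus  = zero
    sign-* zero  minus = zero
    sign-* plus  zero  = zero
    sign-* plus  plus  = plus
    sign-* plus  minus = minus
    sign-* minus zero  = zero
    sign-* minus plus  = minus
    sign-* minus minus = plus

    -- 0, 1 and -1 are pairwise incongruent since p > 2, so a congruence of Legendre symbols is an
    -- equality.
    sign-≈ : ∀ {a b} → IsSign a → IsSign b → a ≈ b → a ≡ b
    sign-≈ zero  zero  eq = refl
    sign-≈ plus  plus  eq = refl
    sign-≈ minus minus eq = refl
    sign-≈ zero  plus  eq = contradiction (≈-sym eq) 1≉0
    sign-≈ plus  zero  eq = contradiction eq 1≉0
    sign-≈ zero  minus eq = contradiction (+-cong eq (≈-refl {1ℤ})) 1≉0
    sign-≈ minus zero  eq = contradiction (+-cong (≈-sym eq) (≈-refl {1ℤ})) 1≉0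
    sign-≈ plus  minus eq = contradiction (+-cong eq (≈-refl {1ℤ})) 2≉0
    sign-≈ minus plus  eq = contradiction (+-cong (≈-sym eq) (≈-refl {1ℤ})) 2≉0

    legendre-sign : ∀ a → IsSign (legendre a p)
    legendre-sign a with does (+ p ℤ.∣? a) | does (isSquareMod? a p)
    ... | true  | _     = zero
    ... | false | true  = plus
    ... | false | false = minus

-- Skew antidiagonal matrices and T

module _ where
  open ≡-Reasoning

  sgn² : ∀ n → -1ℤ ^ n * -1ℤ ^ n ≡ 1ℤ
  sgn² n = trans (sym (^-distrib-* -1ℤ -1ℤ n)) (ℤ.^-zeroˡ n)

  sgn-even : ∀ h → -1ℤ ^ (h ℕ.* 2) ≡ 1ℤ
  sgn-even h = trans (cong (-1ℤ ^_) (ℕ.*-comm h 2)) (trans (sym (ℤ.^-*-assoc -1ℤ 2 h)) (ℤ.^-zeroˡ h))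

  sgn-odd-sum : ∀ t u h → t ℕ.+ suc u ≡ h ℕ.* 2 → -1ℤ ^ u ≡ - (-1ℤ ^ t)
  sgn-odd-sum t u h t+1+u≡2h = begin
    b                       ≡⟨ ℤ.*-identityˡ b ⟨
    1ℤ * b                  ≡⟨ cong (_* b) (sgn² t) ⟨
    a * a * b               ≡⟨ regroup a b ⟩
    - (a * (a * (-1ℤ * b))) ≡⟨ cong (λ x → - (a * x)) (trans (sym (ℤ.^-distribˡ-+-* -1ℤ t (suc u)))
                                 (trans (cong (-1ℤ ^_) t+1+u≡2h) (sgn-even h))) ⟩
    - (a * 1ℤ)              ≡⟨ cong -_ (ℤ.*-identityʳ a) ⟩
    - a                     ∎
    where
    a = -1ℤ ^ t
    b = -1ℤ ^ u
    regroup : ∀ a b → a * a * b ≡ - (a * (a * (-1ℤ * b)))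
    regroup = solve-∀

  -- `β` takes natural numbers, so the minors in a Laplace expansion are again of this form with `β`
  -- shifted.
  antidiagonal : (ℕ → ℕ → ℤ) → ∀ n → Matrix n n
  antidiagonal β n r c = β (toℕ r) (toℕ c) * δℕ (suc (toℕ r ℕ.+ toℕ c)) n

  -- The sign of the permutation reversing n points, (-1)^(n(n-1)/2).
  reversal-sign : ℕ → ℤ
  reversal-sign zero    = 1ℤ
  reversal-sign (suc n) = -1ℤ ^ n * reversal-sign n

  δℕ-fromℕ : ∀ n (j : Fin (suc n)) → δℕ (toℕ j) n ≡ δ (Fin.fromℕ n) j
  δℕ-fromℕ zero    zero    = refl
  δℕ-fromℕ (suc n) zero    = refl
  δℕ-fromℕ (suc n) (suc j) = δℕ-fromℕ n j

  toℕ-punchIn-fromℕ : ∀ n (c : Fin n) → toℕ (punchIn (Fin.fromℕ n) c) ≡ toℕ c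
  toℕ-punchIn-fromℕ (suc n) zero    = refl
  toℕ-punchIn-fromℕ (suc n) (suc c) = cong suc (toℕ-punchIn-fromℕ n c)

  -- In the first row only the last column survives, with cofactor sign (-1)^(size - 1).
  det-antidiagonal : ∀ n β → det (antidiagonal β n) ≡ reversal-sign n * Π< n (λ t → β t (n ∸ suc t))
  det-antidiagonal zero    β = refl
  det-antidiagonal (suc n) β = begin
    sum (λ j → sgn j * (β 0 (toℕ j) * δℕ (toℕ j) n) * M j)
      ≡⟨ sum-cong-≗ {suc n} (λ j → trans
           (cong (λ d → sgn j * (β 0 (toℕ j) * d) * M j) (δℕ-fromℕ n j))
           (regroup (sgn j) (β 0 (toℕ j)) (δ (Fin.fromℕ n) j) (M j))) ⟩
    sum (λ j → δ (Fin.fromℕ n) j * (sgn j * β 0 (toℕ j) * M j))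
      ≡⟨ sum-δˡ (Fin.fromℕ n) (λ j → sgn j * β 0 (toℕ j) * M j) ⟩
    -1ℤ ^ toℕ (Fin.fromℕ n) * β 0 (toℕ (Fin.fromℕ n)) * M (Fin.fromℕ n)
      ≡⟨ cong₂ (λ l m → -1ℤ ^ l * β 0 l * m) (Fin.toℕ-fromℕ n) (trans
           (det-cong {A = λ r c → antidiagonal β (suc n) (suc r) (punchIn (Fin.fromℕ n) c)} {B = antidiagonal (λ t → β (suc t)) n}
             λ r c → cong (λ k → β (suc (toℕ r)) k * δℕ (suc (toℕ r ℕ.+ k)) n) (toℕ-punchIn-fromℕ n c))
           (det-antidiagonal n (λ t → β (suc t)))) ⟩
    -1ℤ ^ n * β 0 n * (reversal-sign n * Π< n (λ t → β (suc t) (n ∸ suc t)))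
      ≡⟨ regroup′ (-1ℤ ^ n) (β 0 n) (reversal-sign n) (Π< n (λ t → β (suc t) (n ∸ suc t))) ⟩
    -1ℤ ^ n * reversal-sign n * (β 0 n * Π< n (λ t → β (suc t) (n ∸ suc t))) ∎
    where
    M : Fin (suc n) → ℤ
    M j = det λ r c → antidiagonal β (suc n) (suc r) (punchIn j c)
    regroup : ∀ s b d m → s * (b * d) * m ≡ d * (s * b * m)
    regroup = solve-∀
    regroup′ : ∀ s b r p → s * b * (r * p) ≡ s * r * (b * p)
    regroup′ = solve-∀

  -- For n = 2h the exponent n(n-1)/2 = h(2h-1) has the parity of h.
  reversal-sign-even : ∀ h → reversal-sign (h ℕ.* 2) ≡ -1ℤ ^ h
  reversal-sign-even zero    = refl
  reversal-sign-even (suc h) = trans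
    (regroup (-1ℤ ^ (h ℕ.* 2)) (reversal-sign (h ℕ.* 2)))
    (trans (cong (λ x → -1ℤ * (x * reversal-sign (h ℕ.* 2))) (sgn² (h ℕ.* 2)))
      (cong (_*_ -1ℤ) (trans (ℤ.*-identityˡ (reversal-sign (h ℕ.* 2))) (reversal-sign-even h))))
    where
    regroup : ∀ s r → -1ℤ * s * (s * r) ≡ -1ℤ * (s * s * r)
    regroup = solve-∀

  Π<-neg : ∀ n f → Π< n (λ t → - f t) ≡ -1ℤ ^ n * Π< n f
  Π<-neg zero    f = refl
  Π<-neg (suc n) f = trans (cong (_*_ (- f 0)) (Π<-neg n (f ∘ suc))) (regroup (f 0) (-1ℤ ^ n) (Π< n (f ∘ suc)))
    where
    regroup : ∀ a s p → - a * (s * p) ≡ -1ℤ * s * (a * p)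
    regroup = solve-∀

  n∸suc[n∸suc[i]]≡i : ∀ {n i} → i ℕ.< n → n ∸ suc (n ∸ suc i) ≡ i
  n∸suc[n∸suc[i]]≡i {suc n} {i} (s≤s i≤n) = ℕ.m∸[m∸n]≡n i≤n

  h*2≡h+h : ∀ h → h ℕ.* 2 ≡ h ℕ.+ h
  h*2≡h+h h = trans (ℕ.*-comm h 2) (cong (h ℕ.+_) (ℕ.+-identityʳ h))

  -- The index opposite to t < h, that is 2h - 1 - t, is written `h + (h ∸ suc t)` from here on.
  mirror-sum : ∀ h {t} → t ℕ.< h → t ℕ.+ suc (h ℕ.+ (h ∸ suc t)) ≡ h ℕ.* 2
  mirror-sum h {t} t<h = trans (ℕ.+-suc t (h ℕ.+ (h ∸ suc t))) (trans
    (cong (λ x → suc (t ℕ.+ x)) (sym (ℕ.+-∸-assoc h t<h)))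
    (trans (ℕ.m+[n∸m]≡n (ℕ.≤-trans t<h (ℕ.m≤m+n h h))) (sym (h*2≡h+h h))))

  Π<-halves : ∀ h (f : ℕ → ℤ) → Π< (h ℕ.+ h) f ≡ Π< h f * Π< h (λ t → f (h ℕ.+ (h ∸ suc t)))
  Π<-halves h f = trans (Π<-split h h f) (cong (_*_ (Π< h f)) (Π<-reverse h (λ t → f (h ℕ.+ t))))

  -- The entries in the second half of the rows are the negatives of those in the first half. This
  -- contributes (-1)^h, which cancels the sign of the reversal.
  det-skew-antidiagonal : ∀ h β →
    (∀ t → t ℕ.< h → β (h ℕ.+ (h ∸ suc t)) t ≡ - β t (h ℕ.+ (h ∸ suc t))) →
    let Q = Π< h λ t → β t (h ℕ.+ (h ∸ suc t)) in det (antidiagonal β (h ℕ.* 2)) ≡ Q * Q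
  det-skew-antidiagonal h β skew = begin
    det (antidiagonal β (h ℕ.* 2))
      ≡⟨ det-antidiagonal (h ℕ.* 2) β ⟩
    reversal-sign (h ℕ.* 2) * Π< (h ℕ.* 2) (λ t → β t (h ℕ.* 2 ∸ suc t))
      ≡⟨ cong₂ _*_ (reversal-sign-even h) (cong (λ n → Π< n λ t → β t (n ∸ suc t)) (h*2≡h+h h)) ⟩
    -1ℤ ^ h * Π< (h ℕ.+ h) b
      ≡⟨ cong (_*_ (-1ℤ ^ h)) (trans (Π<-halves h b) (cong₂ _*_
           (Π<-cong h λ t t<h → cong (β t) (ℕ.+-∸-assoc h t<h))
           (trans (Π<-cong h λ t t<h → trans (cong (β (h ℕ.+ (h ∸ suc t))) (upper t t<h)) (skew t t<h))
             (Π<-neg h (λ t → β t (h ℕ.+ (h ∸ suc t))))))) ⟩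
    -1ℤ ^ h * (Q * (-1ℤ ^ h * Q))
      ≡⟨ regroup (-1ℤ ^ h) Q ⟩
    -1ℤ ^ h * -1ℤ ^ h * (Q * Q)
      ≡⟨ trans (cong (_* (Q * Q)) (sgn² h)) (ℤ.*-identityˡ (Q * Q)) ⟩
    Q * Q ∎
    where
    b : ℕ → ℤ
    b t = β t (h ℕ.+ h ∸ suc t)
    Q = Π< h λ t → β t (h ℕ.+ (h ∸ suc t))
    upper : ∀ t → t ℕ.< h → h ℕ.+ h ∸ suc (h ℕ.+ (h ∸ suc t)) ≡ t
    upper t t<h = trans (cong (h ℕ.+ h ∸_) (sym (ℕ.+-suc h (h ∸ suc t))))
      (trans (ℕ.[m+n]∸[m+o]≡n∸o h h (suc (h ∸ suc t))) (n∸suc[n∸suc[i]]≡i t<h))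
    regroup : ∀ s q → s * (q * (s * q)) ≡ s * s * (q * q)
    regroup = solve-∀

  δℕ-antidiagonal : ∀ {n} t u → u ℕ.< n → δℕ (suc (t ℕ.+ u)) n ≡ δℕ t (n ∸ suc u)
  δℕ-antidiagonal {suc n} t zero    _         = cong (λ s → δℕ s n) (ℕ.+-identityʳ t)
  δℕ-antidiagonal {suc n} t (suc u) (s≤s u<n) =
    trans (cong (λ s → δℕ s n) (ℕ.+-suc t u)) (δℕ-antidiagonal t u u<n)

  antidiagonal-congruence : ∀ (f : Fin n → ℕ → ℤ) β i j →
    ((λ i t → f i (toℕ t)) · antidiagonal β n · (λ t i → f i (toℕ t))) i j ≡
    Σ< n λ u → β (n ∸ suc u) u * (f i (n ∸ suc u) * f j u)
  antidiagonal-congruence {n} f β i j = Σ<-cong n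
    {λ u → Σ< n (λ t → f i t * (β t u * δℕ (suc (t ℕ.+ u)) n)) * f j u}
    {λ u → β (n ∸ suc u) u * (f i (n ∸ suc u) * f j u)} λ u u<n → trans
      (cong (_* f j u) (trans
        (Σ<-cong n {λ t → f i t * (β t u * δℕ (suc (t ℕ.+ u)) n)} {λ t → δℕ t (n ∸ suc u) * (f i t * β t u)} λ t _ → trans
          (cong (λ d → f i t * (β t u * d)) (δℕ-antidiagonal t u u<n))
          (regroup (f i t) (β t u) (δℕ t (n ∸ suc u))))
        (Σ<-δℕ n {n ∸ suc u} (m∸suc<m u<n) (λ t → f i t * β t u))))
      (regroup′ (f i (n ∸ suc u)) (β (n ∸ suc u) u) (f j u))
    where
    m∸suc<m : ∀ {n u} → u ℕ.< n → n ∸ suc u ℕ.< n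
    m∸suc<m {suc n} {u} _ = s≤s (ℕ.m∸n≤m n u)
    regroup : ∀ a b d → a * (b * d) ≡ d * (a * b)
    regroup = solve-∀
    regroup′ : ∀ a b c → a * b * c ≡ b * (a * c)
    regroup′ = solve-∀

  -- Corresponding factors differ by a sign; comparing squares makes it unnecessary to count the
  -- pairs.
  T²≡Δ² : (α : Vector ℤ n) → T α * T α ≡ Δ α * Δ α
  T²≡Δ² {zero}  α = refl
  T²≡Δ² {suc n} α = begin
    T α * T α
      ≡⟨ cong (λ x → x * x) T-suc ⟩
    (A * T (tail α)) * (A * T (tail α))
      ≡⟨ regroup A (T (tail α)) ⟩
    A * A * (T (tail α) * T (tail α))
      ≡⟨ cong₂ _*_ (product-square-neg (λ j → α zero - α (suc j)) (λ j → α (suc j) - α zero)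
           λ j → flip (α zero) (α (suc j))) (T²≡Δ² (tail α)) ⟩
    B * B * (Δ (tail α) * Δ (tail α))
      ≡⟨ regroup B (Δ (tail α)) ⟨
    Δ α * Δ α ∎
    where
    A = product λ j → α zero - α (suc j)
    B = product λ j → α (suc j) - α zero
    T-suc : T α ≡ A * T (tail α)
    T-suc = cong₂ _*_ (ℤ.*-identityˡ A) (product-cong {n} λ i →
      ℤ.*-identityˡ (product λ j → if does (i Fin.<? j) then α (suc i) - α (suc j) else 1ℤ))
    regroup : ∀ a t → (a * t) * (a * t) ≡ a * a * (t * t)
    regroup = solve-∀
    flip : ∀ a b → a - b ≡ - (b - a)
    flip = solve-∀
    product-square-neg : ∀ {n} (f g : Fin n → ℤ) → (∀ i → f i ≡ - g i) → product f * product f ≡ product g * product g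
    product-square-neg {zero}  f g f≡-g = refl
    product-square-neg {suc n} f g f≡-g = trans (regroup (f zero) (product (f ∘ suc))) (trans
      (cong₂ _*_ (trans (cong (λ x → x * x) (f≡-g zero)) (neg² (g zero))) (product-square-neg (f ∘ suc) (g ∘ suc) (f≡-g ∘ suc)))
      (sym (regroup (g zero) (product (g ∘ suc)))))
      where
      neg² : ∀ a → - a * - a ≡ a * a
      neg² = solve-∀

-- Expansion of the matrix entries

-- For t + u = m - 1, the coefficient of x^(t+2) y^(u+2) in (x - y)^N, N = m + 3, after
-- reducing exponents by x^m = y^m = 1; the δ-terms come from the four outer binomial terms.
coefficient : ℕ → ℕ → ℕ → ℤ
coefficient N t u = -1ℤ ^ u * + (N C (2 ℕ.+ u)) +
  (+ N * δℕ u 0 + - δℕ u 1 + (δℕ t 1 + - (+ N * δℕ t 0)))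

module _ where
  open ≡-Reasoning

  -- Since N = (t + 2) + (u + 2), the binomial coefficient is symmetric in t and u, while t + u is
  -- odd, so the powers of -1 are opposite. The δ-terms are antisymmetric by design.
  coefficient-skew : ∀ h t u → t ℕ.+ suc u ≡ h ℕ.* 2 →
    let N = 3 ℕ.+ h ℕ.* 2 in coefficient N u t ≡ - coefficient N t u
  coefficient-skew h t u t+1+u≡m = trans
    (flip (-1ℤ ^ t) (+ (N C (2 ℕ.+ t))) (+ N) (δℕ u 0) (δℕ u 1) (δℕ t 0) (δℕ t 1))
    (cong₂ (λ s c → - (s * + c + (+ N * δℕ u 0 + - δℕ u 1 + (δℕ t 1 + - (+ N * δℕ t 0)))))
      (sym (sgn-odd-sum t u h t+1+u≡m))
      (trans (nCk≡nC[n∸k] (subst (2 ℕ.+ t ℕ.≤_) (sym N≡) (ℕ.m≤m+n (2 ℕ.+ t) (2 ℕ.+ u))))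
        (cong (N C_) (trans (cong (_∸ (2 ℕ.+ t)) N≡) (ℕ.m+n∸m≡n (2 ℕ.+ t) (2 ℕ.+ u))))))
    where
    N = 3 ℕ.+ h ℕ.* 2
    N≡ : N ≡ (2 ℕ.+ t) ℕ.+ (2 ℕ.+ u)
    N≡ = trans (cong (3 ℕ.+_) (sym t+1+u≡m)) (cong (2 ℕ.+_) (sym (ℕ.+-suc t (suc u))))
    flip : ∀ s c N u₀ u₁ t₀ t₁ → s * c + (N * t₀ + - t₁ + (u₁ + - (N * u₀))) ≡
           - (- s * c + (N * u₀ + - u₁ + (t₁ + - (N * t₀))))
    flip = solve-∀

  Σ<-δℕ-reflect : ∀ n {k} → k ℕ.< n → (f : ℕ → ℤ) → Σ< n (λ i → δℕ (n ∸ suc i) k * f i) ≡ f (n ∸ suc k)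
  Σ<-δℕ-reflect n {k} k<n f = trans (Σ<-reverse n (λ i → δℕ (n ∸ suc i) k * f i)) (trans
    (Σ<-cong n {λ i → δℕ (n ∸ suc (n ∸ suc i)) k * f (n ∸ suc i)} {λ i → δℕ i k * f (n ∸ suc i)}
      λ i i<n → cong (λ j → δℕ j k * f (n ∸ suc i)) (n∸suc[n∸suc[i]]≡i i<n))
    (Σ<-δℕ n {k} k<n (λ i → f (n ∸ suc i))))

  Σ<-linear : ∀ n a b (f g : ℕ → ℤ) → Σ< n (λ i → a * f i + b * g i) ≡ a * Σ< n f + b * Σ< n g
  Σ<-linear n a b f g = sum-linear {n} a b (λ i → f (toℕ i)) (λ i → g (toℕ i))

  -- Evaluates the δ-terms: as m = l + 2, the conditions t = 1 and t = 0 select u = l and u = l + 1.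
  Σ<-coefficient : ∀ l N (w : ℕ → ℤ) → let m = 2 ℕ.+ l in
    Σ< m (λ u → coefficient N (m ∸ suc u) u * w u) ≡
    Σ< m (λ u → -1ℤ ^ u * + (N C (2 ℕ.+ u)) * w u) + (+ N * w 0 + - w 1 + (w l + - (+ N * w (suc l))))
  Σ<-coefficient l N w = begin
    Σ< m (λ u → coefficient N (m ∸ suc u) u * w u)
      ≡⟨ Σ<-cong m {λ u → coefficient N (m ∸ suc u) u * w u}
           {λ u → 1ℤ * (1ℤ * A u + + N * D u 0) + 1ℤ * (-1ℤ * D u 1 + 1ℤ * (1ℤ * R u 1 + - + N * R u 0))}
           (λ u _ → distr (-1ℤ ^ u * + (N C (2 ℕ.+ u))) (+ N) (δℕ u 0) (δℕ u 1) (δℕ (m ∸ suc u) 0) (δℕ (m ∸ suc u) 1) (w u)) ⟩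
    Σ< m (λ u → 1ℤ * (1ℤ * A u + + N * D u 0) + 1ℤ * (-1ℤ * D u 1 + 1ℤ * (1ℤ * R u 1 + - + N * R u 0)))
      ≡⟨ Σ<-linear m 1ℤ 1ℤ (λ u → 1ℤ * A u + + N * D u 0) (λ u → -1ℤ * D u 1 + 1ℤ * (1ℤ * R u 1 + - + N * R u 0)) ⟩
    1ℤ * Σ< m (λ u → 1ℤ * A u + + N * D u 0) + 1ℤ * Σ< m (λ u → -1ℤ * D u 1 + 1ℤ * (1ℤ * R u 1 + - + N * R u 0))
      ≡⟨ cong₂ (λ x y → 1ℤ * x + 1ℤ * y)
           (Σ<-linear m 1ℤ (+ N) A (λ u → D u 0))
           (trans (Σ<-linear m -1ℤ 1ℤ (λ u → D u 1) (λ u → 1ℤ * R u 1 + - + N * R u 0))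
             (cong (λ x → -1ℤ * Σ< m (λ u → D u 1) + 1ℤ * x) (Σ<-linear m 1ℤ (- + N) (λ u → R u 1) (λ u → R u 0)))) ⟩
    1ℤ * (1ℤ * Σ< m A + + N * Σ< m (λ u → D u 0)) +
    1ℤ * (-1ℤ * Σ< m (λ u → D u 1) + 1ℤ * (1ℤ * Σ< m (λ u → R u 1) + - + N * Σ< m (λ u → R u 0)))
      ≡⟨ cong₂ (λ x y → 1ℤ * (1ℤ * Σ< m A + + N * x) + y)
           (Σ<-δℕ m {0} (s≤s z≤n) w)
           (cong₂ (λ x y → 1ℤ * (-1ℤ * x + 1ℤ * y)) (Σ<-δℕ m {1} (s≤s (s≤s z≤n)) w)
             (cong₂ (λ x y → 1ℤ * x + - + N * y) (Σ<-δℕ-reflect m {1} (s≤s (s≤s z≤n)) w) (Σ<-δℕ-reflect m {0} (s≤s z≤n) w))) ⟩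
    1ℤ * (1ℤ * Σ< m A + + N * w 0) + 1ℤ * (-1ℤ * w 1 + 1ℤ * (1ℤ * w l + - + N * w (suc l)))
      ≡⟨ simplify (Σ< m A) (+ N) (w 0) (w 1) (w l) (w (suc l)) ⟩
    Σ< m A + (+ N * w 0 + - w 1 + (w l + - (+ N * w (suc l)))) ∎
    where
    m = 2 ℕ.+ l
    A : ℕ → ℤ
    A u = -1ℤ ^ u * + (N C (2 ℕ.+ u)) * w u
    D R : ℕ → ℕ → ℤ
    D u k = δℕ u k * w u
    R u k = δℕ (m ∸ suc u) k * w u
    distr : ∀ s N u₀ u₁ t₀ t₁ w → (s + (N * u₀ + - u₁ + (t₁ + - (N * t₀)))) * w ≡
      1ℤ * (1ℤ * (s * w) + N * (u₀ * w)) + 1ℤ * (-1ℤ * (u₁ * w) + 1ℤ * (1ℤ * (t₁ * w) + - N * (t₀ * w)))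
    distr = solve-∀
    simplify : ∀ a N w₀ w₁ x y → 1ℤ * (1ℤ * a + N * w₀) + 1ℤ * (-1ℤ * w₁ + 1ℤ * (1ℤ * x + - N * y)) ≡
      a + (N * w₀ + - w₁ + (x + - (N * y)))
    simplify = solve-∀

  -- The terms with y-exponent 0, 1, m + 2 and m + 3 are split off; the others have y-exponents 2,
  -- ..., m + 1, one in each class modulo m.
  odd-power-expansion : ∀ h x y → let m = h ℕ.* 2; N = 3 ℕ.+ m in
    (x + -1ℤ * y) ^ N ≡
    Σ< m (λ u → -1ℤ ^ u * + (N C (2 ℕ.+ u)) * (x ^ (2 ℕ.+ (m ∸ suc u)) * y ^ (2 ℕ.+ u))) +
    (x ^ N + - (+ N * (y * x ^ (2 ℕ.+ m))) + (+ N * (y ^ (2 ℕ.+ m) * x) + - y ^ N))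
  odd-power-expansion h x y = begin
    (x + -1ℤ * y) ^ N
      -- With -y as the first summand, the summation index is the exponent of y.
      ≡⟨ cong (_^ N) (ℤ.+-comm x (-1ℤ * y)) ⟩
    (-1ℤ * y + x) ^ N
      ≡⟨ binomial-theorem (-1ℤ * y) x N ⟩
    g 0 + (g 1 + Σ< (2 ℕ.+ m) g₂)
      ≡⟨ cong (λ s → g 0 + (g 1 + s)) (trans (Σ<-last (suc m) g₂) (cong (_+ g₂ (suc m)) (Σ<-last m g₂))) ⟩
    g 0 + (g 1 + (Σ< m g₂ + g₂ m + g₂ (suc m)))
      ≡⟨ cong₂ (λ a b → a + (b + (Σ< m g₂ + g₂ m + g₂ (suc m)))) first second ⟩
    x ^ N + (- (+ N * (y * x ^ (2 ℕ.+ m))) + (Σ< m g₂ + g₂ m + g₂ (suc m)))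
      ≡⟨ cong₂ (λ a b → x ^ N + (- (+ N * (y * x ^ (2 ℕ.+ m))) + (Σ< m g₂ + a + b))) penultimate last ⟩
    x ^ N + (- (+ N * (y * x ^ (2 ℕ.+ m))) + (Σ< m g₂ + + N * (y ^ (2 ℕ.+ m) * x) + - y ^ N))
      ≡⟨ cong (λ s → x ^ N + (- (+ N * (y * x ^ (2 ℕ.+ m))) + (s + + N * (y ^ (2 ℕ.+ m) * x) + - y ^ N)))
           (Σ<-cong m {g₂} {λ u → -1ℤ ^ u * + (N C (2 ℕ.+ u)) * (x ^ (2 ℕ.+ (m ∸ suc u)) * y ^ (2 ℕ.+ u))} middle) ⟩
    x ^ N + (- (+ N * (y * x ^ (2 ℕ.+ m))) + (Σ′ + + N * (y ^ (2 ℕ.+ m) * x) + - y ^ N))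
      ≡⟨ collect (x ^ N) (- (+ N * (y * x ^ (2 ℕ.+ m)))) Σ′ (+ N * (y ^ (2 ℕ.+ m) * x)) (- y ^ N) ⟩
    Σ′ + (x ^ N + - (+ N * (y * x ^ (2 ℕ.+ m))) + (+ N * (y ^ (2 ℕ.+ m) * x) + - y ^ N)) ∎
    where
    m = h ℕ.* 2
    N = 3 ℕ.+ m
    g g₂ : ℕ → ℤ
    g k = + (N C k) * ((-1ℤ * y) ^ k * x ^ (N ∸ k))
    g₂ u = g (2 ℕ.+ u)
    Σ′ = Σ< m (λ u → -1ℤ ^ u * + (N C (2 ℕ.+ u)) * (x ^ (2 ℕ.+ (m ∸ suc u)) * y ^ (2 ℕ.+ u)))
    collect : ∀ a b s c d → a + (b + (s + c + d)) ≡ s + (a + b + (c + d))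
    collect = solve-∀
    NC0 : N C 0 ≡ 1
    NC0 = trans (nCk≡nC[n∸k] {0} {N} z≤n) (nCn≡1 N)
    NC[2+m] : N C (2 ℕ.+ m) ≡ N
    NC[2+m] = trans (nCk≡nC[n∸k] {2 ℕ.+ m} {N} (ℕ.n≤1+n (2 ℕ.+ m)))
      (trans (cong (N C_) (ℕ.m+n∸n≡m 1 (2 ℕ.+ m))) (nC1≡n N))
    first : g 0 ≡ x ^ N
    first = trans (cong (λ c → + c * (1ℤ * x ^ N)) NC0)
      (trans (ℤ.*-identityˡ (1ℤ * x ^ N)) (ℤ.*-identityˡ (x ^ N)))
    second : g 1 ≡ - (+ N * (y * x ^ (2 ℕ.+ m)))
    second = trans (cong (λ c → + c * (-1ℤ * y * 1ℤ * x ^ (2 ℕ.+ m))) (nC1≡n N)) (simplify (+ N) y (x ^ (2 ℕ.+ m)))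
      where
      simplify : ∀ N y X → N * (-1ℤ * y * 1ℤ * X) ≡ - (N * (y * X))
      simplify = solve-∀
    penultimate : g₂ m ≡ + N * (y ^ (2 ℕ.+ m) * x)
    penultimate = trans (cong₂ (λ c e → + c * ((-1ℤ * y) ^ (2 ℕ.+ m) * x ^ e)) NC[2+m] (ℕ.m+n∸n≡m 1 (2 ℕ.+ m)))
      (cong₂ (λ Y X → + N * (Y * X))
        (trans (^-distrib-* -1ℤ y (2 ℕ.+ m)) (trans (cong (_* y ^ (2 ℕ.+ m)) (sgn-even (suc h))) (ℤ.*-identityˡ (y ^ (2 ℕ.+ m)))))
        (ℤ.*-identityʳ x))
    last : g₂ (suc m) ≡ - y ^ N
    last = trans (cong₂ (λ c e → + c * ((-1ℤ * y) ^ N * x ^ e)) (nCn≡1 N) (ℕ.n∸n≡0 N)) (trans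
      (cong (λ Y → 1ℤ * (Y * 1ℤ)) (^-distrib-* -1ℤ y N)) (trans
      (cong (λ s → 1ℤ * (-1ℤ * s * y ^ N * 1ℤ)) (sgn-even (suc h)))
      (simplify (y ^ N))))
      where
      simplify : ∀ Y → 1ℤ * (-1ℤ * 1ℤ * Y * 1ℤ) ≡ - Y
      simplify = solve-∀
    1+m∸u : ∀ {m u} → u ℕ.< m → suc m ∸ u ≡ 2 ℕ.+ (m ∸ suc u)
    1+m∸u {suc m} {u} (s≤s u≤m) = ℕ.+-∸-assoc 2 u≤m
    middle : ∀ u → u ℕ.< m → g₂ u ≡ -1ℤ ^ u * + (N C (2 ℕ.+ u)) * (x ^ (2 ℕ.+ (m ∸ suc u)) * y ^ (2 ℕ.+ u))
    middle u u<m = trans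
      (cong₂ (λ Y e → + (N C (2 ℕ.+ u)) * (Y * x ^ e)) (^-distrib-* -1ℤ y (2 ℕ.+ u)) (1+m∸u u<m))
      (simplify (+ (N C (2 ℕ.+ u))) (-1ℤ ^ u) (y ^ (2 ℕ.+ u)) (x ^ (2 ℕ.+ (m ∸ suc u))))
      where
      simplify : ∀ c s Y X → c * (-1ℤ * (-1ℤ * s) * Y * X) ≡ s * c * (X * Y)
      simplify = solve-∀

-- Reduction of the entries modulo p, and S as a square modulo p

module ReducedPowers (p : ℕ) where
  open Modular p
  open import Relation.Binary.Reasoning.Setoid ≈-setoid

  -- Since x^m ≈ y^m ≈ 1, each outer term of the expansion merges with a middle term.
  power-of-difference : ∀ h′ x y → let h = suc h′; m = h ℕ.* 2; N = 3 ℕ.+ m in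
    x ^ m ≈ 1ℤ → y ^ m ≈ 1ℤ →
    (x + -1ℤ * y) ^ N ≈ Σ< m λ u → coefficient N (m ∸ suc u) u * (x ^ (2 ℕ.+ (m ∸ suc u)) * y ^ (2 ℕ.+ u))
  power-of-difference h′ x y x^m≈1 y^m≈1 = begin
    (x + -1ℤ * y) ^ N
      ≡⟨ odd-power-expansion (suc h′) x y ⟩
    Σ′ + (x ^ N + - (+ N * (y * x ^ (2 ℕ.+ m))) + (+ N * (y ^ (2 ℕ.+ m) * x) + - y ^ N))
      ≡⟨ cong (_+_ Σ′) (outer x y (x ^ m) (y ^ m) (+ N)) ⟩
    Σ′ + (x * x * x * x ^ m + - (+ N * (x * x * y * x ^ m)) + (+ N * (x * y * y * y ^ m) + - (y * y * y * y ^ m)))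
      -- Exchanging x^m and y^m turns x^(m+3) into x^3 y^m and x^(m+2) y into x^2 y^(m+1), and
      -- likewise with x and y interchanged, so that all exponents lie between 2 and m + 1.
      ≈⟨ +-cong (≈-refl {Σ′}) (+-cong
           (+-cong (*-congˡ (x * x * x) x≈y) (neg-cong (*-congˡ (+ N) (*-congˡ (x * x * y) x≈y))))
           (+-cong (*-congˡ (+ N) (*-congˡ (x * y * y) (≈-sym x≈y))) (neg-cong (*-congˡ (y * y * y) (≈-sym x≈y))))) ⟩
    Σ′ + (x * x * x * y ^ m + - (+ N * (x * x * y * y ^ m)) + (+ N * (x * y * y * x ^ m) + - (y * y * y * x ^ m)))
      ≡⟨ cong (_+_ Σ′) (trans (inner x y (x ^ l) (y ^ l) (+ N))
           (cong₂ (λ a b → + N * w 0 + - w 1 + (x ^ (2 ℕ.+ a) * y ^ (2 ℕ.+ l) + - (+ N * (x ^ (2 ℕ.+ b) * y ^ (3 ℕ.+ l)))))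
             (sym (ℕ.m+n∸n≡m 1 l)) (sym (ℕ.n∸n≡0 l)))) ⟩
    Σ′ + (+ N * w 0 + - w 1 + (w l + - (+ N * w (suc l))))
      ≡⟨ Σ<-coefficient l N w ⟨
    Σ< m (λ u → coefficient N (m ∸ suc u) u * w u) ∎
    where
    l = h′ ℕ.* 2
    m = 2 ℕ.+ l
    N = 3 ℕ.+ m
    w : ℕ → ℤ
    w u = x ^ (2 ℕ.+ (m ∸ suc u)) * y ^ (2 ℕ.+ u)
    Σ′ = Σ< m (λ u → -1ℤ ^ u * + (N C (2 ℕ.+ u)) * w u)
    x≈y : x ^ m ≈ y ^ m
    x≈y = ≈-trans x^m≈1 (≈-sym y^m≈1)
    neg-cong : ∀ {a b} → a ≈ b → - a ≈ - b
    neg-cong {a} {b} a≈b = ≈-trans (≈-reflexive (sym (ℤ.-1*i≡-i a)))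
      (≈-trans (*-congˡ -1ℤ a≈b) (≈-reflexive (ℤ.-1*i≡-i b)))
    outer : ∀ x y X Y N →
      x * (x * (x * X)) + - (N * (y * (x * (x * X)))) + (N * (y * (y * Y) * x) + - (y * (y * (y * Y)))) ≡
      x * x * x * X + - (N * (x * x * y * X)) + (N * (x * y * y * Y) + - (y * y * y * Y))
    outer = solve-∀
    inner : ∀ x y X Y N →
      x * x * x * (y * (y * Y)) + - (N * (x * x * y * (y * (y * Y)))) +
        (N * (x * y * y * (x * (x * X))) + - (y * y * y * (x * (x * X)))) ≡
      N * (x * (x * (x * X)) * (y * (y * 1ℤ))) + - (x * (x * X) * (y * (y * (y * 1ℤ)))) +
        (x * (x * (x * 1ℤ)) * (y * (y * Y)) + - (N * (x * (x * 1ℤ) * (y * (y * (y * Y))))))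
    inner = solve-∀

  S≈square : ∀ h′ → let h = suc h′; m = h ℕ.* 2; N = 3 ℕ.+ m in
    (α : Vector ℤ m) → (∀ i → α i ^ m ≈ 1ℤ) →
    let R = product (λ i → α i * α i) * T α * Π< h λ t → coefficient N t (h ℕ.+ (h ∸ suc t)) in
    S N -1ℤ α ≈ R * R
  S≈square h′ α α^m≈1 = begin
    det (λ i j → (α i + -1ℤ * α j) ^ N)
      ≈⟨ det-resp {m} (λ i j → ≈-trans (power-of-difference h′ (α i) (α j) (α^m≈1 i) (α^m≈1 j))
           (≈-reflexive (sym (antidiagonal-congruence (λ i t → α i ^ (2 ℕ.+ t)) (coefficient N) i j)))) ⟩
    det (W · antidiagonal (coefficient N) m · W ᵀ)
      ≡⟨ det-· (W · antidiagonal (coefficient N) m) (W ᵀ) ⟩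
    det (W · antidiagonal (coefficient N) m) * det (W ᵀ)
      ≡⟨ cong₂ _*_ (det-· W (antidiagonal (coefficient N) m)) (sym (det-transpose m W)) ⟩
    det W * det (antidiagonal (coefficient N) m) * det W
      ≡⟨ cong₂ (λ a b → a * b * a) det-W (det-skew-antidiagonal h (coefficient N) λ t t<h →
           coefficient-skew h t (h ℕ.+ (h ∸ suc t)) (mirror-sum h t<h)) ⟩
    P * Δ α * (Q * Q) * (P * Δ α)
      ≡⟨ regroup P (Δ α) Q ⟩
    P * P * (Q * Q) * (Δ α * Δ α)
      ≡⟨ cong (_*_ (P * P * (Q * Q))) (T²≡Δ² α) ⟨
    P * P * (Q * Q) * (T α * T α)
      ≡⟨ regroup′ P (T α) Q ⟩
    P * T α * Q * (P * T α * Q) ∎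
    where
    h = suc h′
    m = h ℕ.* 2
    N = 3 ℕ.+ m
    W : Matrix m m
    W i t = α i ^ (2 ℕ.+ toℕ t)
    P = product λ i → α i * α i
    Q = Π< h λ t → coefficient N t (h ℕ.+ (h ∸ suc t))
    det-W : det W ≡ P * Δ α
    det-W = trans (det-cong {A = W} {B = λ i t → α i * α i * α i ^ toℕ t} (λ i t → sym (ℤ.*-assoc (α i) (α i) (α i ^ toℕ t))))
      (trans (det-scale-rows (λ i → α i * α i) (λ i t → α i ^ toℕ t))
        (cong (_*_ P) (trans (det-transpose m (λ i t → α i ^ toℕ t)) (vandermonde α))))
    regroup : ∀ P D Q → P * D * (Q * Q) * (P * D) ≡ P * P * (Q * Q) * (D * D)
    regroup = solve-∀
    regroup′ : ∀ P T Q → P * P * (Q * Q) * (T * T) ≡ P * T * Q * (P * T * Q)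
    regroup′ = solve-∀

-- Legendre symbols

module _ where
  open ≡-Reasoning

  1+n!≡1+n!!*n!! : ∀ n → suc n ! ≡ suc n !! ℕ.* n !!
  1+n!≡1+n!!*n!! zero    = refl
  1+n!≡1+n!!*n!! (suc n) = trans (cong (suc (suc n) ℕ.*_) (1+n!≡1+n!!*n!! n)) (regroup (suc (suc n)) (suc n !!) (n !!))
    where
    regroup : ∀ a b c → a ℕ.* (b ℕ.* c) ≡ a ℕ.* c ℕ.* b
    regroup = ℕ-solve-∀

  module _ (m : ℕ) where
    private N = 3 ℕ.+ m

    2*NC2 : 2 ℕ.* (N C 2) ≡ N ℕ.* (2 ℕ.+ m)
    2*NC2 = ℕ.*-cancelʳ-≡ (2 ℕ.* (N C 2)) (N ℕ.* (2 ℕ.+ m)) (suc m !) {{ℕ._!≢0 (suc m)}} (begin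
      2 ℕ.* (N C 2) ℕ.* suc m !         ≡⟨ regroup (N C 2) (suc m !) ⟩
      (N C 2) ℕ.* (2 ! ℕ.* suc m !)     ≡⟨ nCk*k![n∸k]!≡n! {N} {2} (s≤s (s≤s z≤n)) ⟩
      N ℕ.* ((2 ℕ.+ m) ℕ.* suc m !)     ≡⟨ ℕ.*-assoc N (2 ℕ.+ m) (suc m !) ⟨
      N ℕ.* (2 ℕ.+ m) ℕ.* suc m !       ∎)
      where
      regroup : ∀ c f → 2 ℕ.* c ℕ.* f ≡ c ℕ.* (2 ℕ.* f)
      regroup = ℕ-solve-∀

    6*NC3 : 6 ℕ.* (N C 3) ≡ N ℕ.* (2 ℕ.+ m) ℕ.* (1 ℕ.+ m)
    6*NC3 = ℕ.*-cancelʳ-≡ (6 ℕ.* (N C 3)) (N ℕ.* (2 ℕ.+ m) ℕ.* (1 ℕ.+ m)) (m !) {{ℕ._!≢0 m}} (begin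
      6 ℕ.* (N C 3) ℕ.* m !                       ≡⟨ regroup (N C 3) (m !) ⟩
      (N C 3) ℕ.* (3 ! ℕ.* m !)                   ≡⟨ nCk*k![n∸k]!≡n! {N} {3} (s≤s (s≤s (s≤s z≤n))) ⟩
      N ℕ.* ((2 ℕ.+ m) ℕ.* ((1 ℕ.+ m) ℕ.* m !))   ≡⟨ regroup′ N (2 ℕ.+ m) (1 ℕ.+ m) (m !) ⟩
      N ℕ.* (2 ℕ.+ m) ℕ.* (1 ℕ.+ m) ℕ.* m !       ∎)
      where
      regroup : ∀ c f → 6 ℕ.* c ℕ.* f ≡ c ℕ.* (6 ℕ.* f)
      regroup = ℕ-solve-∀
      regroup′ : ∀ a b c f → a ℕ.* (b ℕ.* (c ℕ.* f)) ≡ a ℕ.* b ℕ.* c ℕ.* f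
      regroup′ = ℕ-solve-∀

  S-skew : ∀ h (α : Vector ℤ n) → SkewSymmetric (λ i j → (α i + -1ℤ * α j) ^ (3 ℕ.+ h ℕ.* 2))
  S-skew h α i j = begin
    (α i + -1ℤ * α j) ^ N                       ≡⟨ cong (_^ N) (flip (α i) (α j)) ⟩
    (-1ℤ * (α j + -1ℤ * α i)) ^ N               ≡⟨ ^-distrib-* -1ℤ (α j + -1ℤ * α i) N ⟩
    -1ℤ * -1ℤ ^ (suc h ℕ.* 2) * (α j + -1ℤ * α i) ^ N
      ≡⟨ cong (λ s → -1ℤ * s * (α j + -1ℤ * α i) ^ N) (sgn-even (suc h)) ⟩
    -1ℤ * 1ℤ * (α j + -1ℤ * α i) ^ N            ≡⟨ ℤ.-1*i≡-i ((α j + -1ℤ * α i) ^ N) ⟩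
    - (α j + -1ℤ * α i) ^ N                     ∎
    where
    N = 3 ℕ.+ h ℕ.* 2
    flip : ∀ a b → a + -1ℤ * b ≡ -1ℤ * (b + -1ℤ * a)
    flip = solve-∀

  -- `√` is a rounded-down root; it is a true root of S because a skew-symmetric determinant of even
  -- order is a perfect square.
  √S² : ∀ h (α : Vector ℤ (h ℕ.* 2)) →
        let S′ = S (3 ℕ.+ h ℕ.* 2) -1ℤ α in √ S′ * √ S′ ≡ S′
  √S² h α = let z , S≡z² = skew-det-square h (λ i j → (α i + -1ℤ * α j) ^ (3 ℕ.+ h ℕ.* 2)) (S-skew h α)
            in subst (λ s → √ s * √ s ≡ s) (sym S≡z²) (√-square z)

-- Legendre symbols for p ≡ 1 modulo 4, and the class of Q up to squares

module EvenEuler (p : ℕ) (p-prime : Prime p) (e : ℕ) (p≡1+H*2 : p ≡ suc (suc e ℕ.* 2))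
                 (G : ℕ) (H≡G*2 : suc e ≡ G ℕ.* 2) where
  open PrimeModulus p p-prime public
  open Euler e p≡1+H*2 public

  -- Equality of Legendre symbols, by Euler's criterion.
  infix 4 _~_
  record _~_ (a b : ℤ) : Set where
    constructor same
    field ^H : a ^ H ≈ b ^ H

  open _~_ public

  ~-refl : ∀ {a} → a ~ a
  ~-refl {a} = same (≈-refl {a ^ H})

  ~-sym : ∀ {a b} → a ~ b → b ~ a
  ~-sym (same x) = same (≈-sym x)

  ~-trans : ∀ {a b c} → a ~ b → b ~ c → a ~ c
  ~-trans (same x) (same y) = same (≈-trans x y)

  ~-setoid : Setoid 0ℓ 0ℓ
  ~-setoid = record
    { Carrier = ℤ ; _≈_ = _~_
    ; isEquivalence = record { refl = ~-refl ; sym = ~-sym ; trans = ~-trans } }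

  open import Relation.Binary.Reasoning.Setoid ~-setoid

  ≈⇒~ : ∀ {a b} → a ≈ b → a ~ b
  ≈⇒~ a≈b = same (^-cong H a≈b)

  ~-* : ∀ {a b c d} → a ~ b → c ~ d → a * c ~ b * d
  ~-* {a} {b} {c} {d} (same x) (same y) = same (≈-trans (≈-reflexive (^-distrib-* a c H))
    (≈-trans (*-cong x y) (≈-reflexive (sym (^-distrib-* b d H)))))

  ~-*ˡ : ∀ a {b c} → b ~ c → a * b ~ a * c
  ~-*ˡ a = ~-* (~-refl {a})

  ~-*ʳ : ∀ a {b c} → b ~ c → b * a ~ c * a
  ~-*ʳ a b~c = ~-* b~c (~-refl {a})

  -- As `H` is twice `G`, a^H is a power of a². This disposes of every sign, including the unknown
  -- one of the root of S.
  squares≈⇒~ : ∀ {a b} → a * a ≈ b * b → a ~ b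
  squares≈⇒~ {a} {b} a²≈b² = same (≈-trans (≈-reflexive (^H≡ a)) (≈-trans (^-cong G a²≈b²) (≈-reflexive (sym (^H≡ b)))))
    where
    ^H≡ : ∀ a → a ^ H ≡ (a * a) ^ G
    ^H≡ a = trans (cong (a ^_) (trans H≡G*2 (ℕ.*-comm G 2)))
      (trans (sym (ℤ.^-*-assoc a 2 G)) (cong (λ x → (a * x) ^ G) (ℤ.*-identityʳ a)))

  ~-neg : ∀ a → - a ~ a
  ~-neg a = squares≈⇒~ (≈-reflexive (neg² a))
    where
    neg² : ∀ a → - a * - a ≡ a * a
    neg² = solve-∀

  square~1 : ∀ {u} → ¬ u ≈ 0ℤ → u * u ~ 1ℤ
  square~1 {u} u≉0 = same (≈-trans (≈-reflexive (^-distrib-* u u H))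
    (≈-trans (x^H²≈1 u≉0) (≈-reflexive (sym (ℤ.^-zeroˡ H)))))

  *-square~ : ∀ {u} a → ¬ u ≈ 0ℤ → u * u * a ~ a
  *-square~ {u} a u≉0 = ~-trans (~-*ʳ a (square~1 u≉0)) (≈⇒~ (≈-reflexive (ℤ.*-identityˡ a)))

  ^-even~1 : ∀ {u} v → ¬ u ≈ 0ℤ → u ^ (v ℕ.* 2) ~ 1ℤ
  ^-even~1 {u} v u≉0 = ~-trans (≈⇒~ (≈-reflexive (trans (cong (u ^_) (h*2≡h+h v)) (ℤ.^-distribˡ-+-* u v v))))
    (square~1 (^-≉0 v u≉0))

  Π<-~ : ∀ n (f g : ℕ → ℤ) → (∀ i → i ℕ.< n → f i ~ g i) → Π< n f ~ Π< n g
  Π<-~ zero    f g f~g = ~-refl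
  Π<-~ (suc n) f g f~g = ~-* (f~g 0 (s≤s z≤n)) (Π<-~ n (f ∘ suc) (g ∘ suc) λ i i<n → f~g (suc i) (s≤s i<n))

  product-squares~1 : (f : Vector ℤ n) → (∀ i → ¬ f i ≈ 0ℤ) → product (λ i → f i * f i) ~ 1ℤ
  product-squares~1 {zero}  f f≉0 = ~-refl
  product-squares~1 {suc n} f f≉0 = ~-* (square~1 (f≉0 zero)) (product-squares~1 (f ∘ suc) (f≉0 ∘ suc))

  legendre-≡ : ∀ {a b} → a ~ b → legendre a p ≡ legendre b p
  legendre-≡ {a} {b} (same x) = sign-≈ (legendre-sign a) (legendre-sign b)
    (≈-trans (euler-criterion a) (≈-trans x (≈-sym (euler-criterion b))))

  legendre-* : ∀ a b → legendre (a * b) p ≡ legendre a p * legendre b p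
  legendre-* a b = sign-≈ (legendre-sign (a * b)) (sign-* (legendre-sign a) (legendre-sign b))
    (≈-trans (euler-criterion (a * b)) (≈-trans (≈-reflexive (^-distrib-* a b H))
      (≈-sym (*-cong (euler-criterion a) (euler-criterion b)))))

  fac : ℕ → ℤ
  fac n = + (n !)

  -- Pair consecutive factorials: (2i)! (2i + 1)! = (2i + 1) · (2i)!².
  factorials~!! : ∀ u → 3 ℕ.+ u ℕ.* 2 ℕ.< p → + 3 * Π< (u ℕ.* 2) (λ t → fac (4 ℕ.+ t)) ~ + ((3 ℕ.+ u ℕ.* 2) !!)
  factorials~!! zero    _   = ~-refl
  factorials~!! (suc u) <p = begin
    + 3 * Π< (2 ℕ.+ l) f
      ≡⟨ cong (_*_ (+ 3)) (trans (Π<-last (suc l) f) (cong (_* f (suc l)) (Π<-last l f))) ⟩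
    + 3 * (Π< l f * f l * f (suc l))
      ≡⟨ cong (λ x → + 3 * (Π< l f * f l * x)) (ℤ.pos-* (5 ℕ.+ l) ((4 ℕ.+ l) !)) ⟩
    + 3 * (Π< l f * f l * (+ (5 ℕ.+ l) * f l))
      ≡⟨ regroup (Π< l f) (f l) (+ (5 ℕ.+ l)) ⟩
    f l * f l * (+ (5 ℕ.+ l) * (+ 3 * Π< l f))
      ≈⟨ *-square~ (+ (5 ℕ.+ l) * (+ 3 * Π< l f)) (!-≉0 (4 ℕ.+ l) (ℕ.<-trans (ℕ.n<1+n (4 ℕ.+ l)) <p)) ⟩
    + (5 ℕ.+ l) * (+ 3 * Π< l f)
      ≈⟨ ~-*ˡ (+ (5 ℕ.+ l)) (factorials~!! u (ℕ.<-trans (ℕ.m<n⇒m<1+n (ℕ.n<1+n (3 ℕ.+ l))) <p)) ⟩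
    + (5 ℕ.+ l) * + ((3 ℕ.+ l) !!)
      ≡⟨ ℤ.pos-* (5 ℕ.+ l) ((3 ℕ.+ l) !!) ⟨
    + ((5 ℕ.+ l) !!) ∎
    where
    l = u ℕ.* 2
    f : ℕ → ℤ
    f t = fac (4 ℕ.+ t)
    regroup : ∀ P f a → + 3 * (P * f * (a * f)) ≡ f * f * (a * (+ 3 * P))
    regroup = solve-∀

  module _ (u : ℕ) where
    private
      h = 2 ℕ.+ u
      m = h ℕ.* 2
      N = 3 ℕ.+ m
      P = Π< u λ t → + (N C (4 ℕ.+ t))
      D = + ((m ∸ 1) !!)

    Q : ℤ
    Q = Π< h λ t → coefficient N t (h ℕ.+ (h ∸ suc t))

    -- Six times the special factor C(N,3) + 1, by `6*NC3`.
    E : ℤ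
    E = + (3 ℕ.+ m) * + (2 ℕ.+ m) * + (1 ℕ.+ m) + + 6

    module _ (N<p : N ℕ.< p) where
      small≉0 : ∀ {n} → 0 ℕ.< n → n ℕ.≤ N → ¬ + n ≈ 0ℤ
      small≉0 0<n n≤N = +-≉0 0<n (ℕ.≤-<-trans n≤N N<p)

      fac≉0 : ∀ {n} → n ℕ.≤ N → ¬ fac n ≈ 0ℤ
      fac≉0 {n} n≤N = !-≉0 n (ℕ.≤-<-trans n≤N N<p)

      -- In the product of the binomial coefficients the factorials in the denominators
      -- fill the range 4!, 5!, …, (m - 1)!.
      binomials~ : + 3 * P ~ D * fac N ^ u
      binomials~ = begin
        + 3 * P
          -- `F` collects all the denominators: one copy turns every coefficient into N!, the other
          -- becomes the double factorial.
          ≈⟨ *-square~ (+ 3 * P) F≉0 ⟨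
        F * F * (+ 3 * P)
          ≡⟨ regroup F P ⟩
        + 3 * F * (P * F)
          ≡⟨ cong (_*_ (+ 3 * F)) P*F≡ ⟩
        + 3 * F * fac N ^ u
          ≈⟨ ~-*ʳ (fac N ^ u) (≈⇒~ (≈-reflexive (cong (_*_ (+ 3)) F≡))) ⟩
        + 3 * Π< (u ℕ.* 2) f * fac N ^ u
          ≈⟨ ~-*ʳ (fac N ^ u) (factorials~!! u (ℕ.<-trans (ℕ.m<n+m (3 ℕ.+ u ℕ.* 2) {4} (s≤s z≤n)) N<p)) ⟩
        D * fac N ^ u ∎
        where
        f : ℕ → ℤ
        f t = fac (4 ℕ.+ t)
        F = Π< u λ t → f t * fac (N ∸ (4 ℕ.+ t))
        regroup : ∀ F P → F * F * (+ 3 * P) ≡ + 3 * F * (P * F)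
        regroup = solve-∀
        t≤u*2 : ∀ {t} → t ℕ.< u → t ℕ.≤ u ℕ.* 2
        t≤u*2 t<u = ℕ.≤-trans (ℕ.<⇒≤ t<u) (ℕ.m≤m*n u 2)
        4+t≤N : ∀ {t} → t ℕ.< u → 4 ℕ.+ t ℕ.≤ N
        4+t≤N t<u = ℕ.+-mono-≤ (ℕ.m≤m+n 4 3) (t≤u*2 t<u)
        F≉0 : ¬ F ≈ 0ℤ
        F≉0 = product-≉0 {u} (λ t → f (toℕ t) * fac (N ∸ (4 ℕ.+ toℕ t))) λ t →
          *-≉0 (fac≉0 (4+t≤N (Fin.toℕ<n t))) (fac≉0 (ℕ.m∸n≤m N (4 ℕ.+ toℕ t)))
        Π<-* : ∀ n (f g : ℕ → ℤ) → Π< n (λ t → f t * g t) ≡ Π< n f * Π< n g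
        Π<-* zero    f g = refl
        Π<-* (suc n) f g = trans (cong (_*_ (f 0 * g 0)) (Π<-* n (f ∘ suc) (g ∘ suc)))
          (interchange (f 0) (g 0) (Π< n (f ∘ suc)) (Π< n (g ∘ suc)))
          where
          interchange : ∀ a b c d → a * b * (c * d) ≡ a * c * (b * d)
          interchange = solve-∀
        Π<-const : ∀ n a → Π< n (λ _ → a) ≡ a ^ n
        Π<-const zero    a = refl
        Π<-const (suc n) a = cong (a *_) (Π<-const n a)
        P*F≡ : P * F ≡ fac N ^ u
        P*F≡ = trans (sym (Π<-* u (λ t → + (N C (4 ℕ.+ t))) (λ t → f t * fac (N ∸ (4 ℕ.+ t))))) (trans
          (Π<-cong u {λ t → + (N C (4 ℕ.+ t)) * (f t * fac (N ∸ (4 ℕ.+ t)))} {λ _ → fac N} λ t t<u → trans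
            (cong (_*_ (+ (N C (4 ℕ.+ t)))) (sym (ℤ.pos-* ((4 ℕ.+ t) !) ((N ∸ (4 ℕ.+ t)) !))))
            (trans (sym (ℤ.pos-* (N C (4 ℕ.+ t)) ((4 ℕ.+ t) ! ℕ.* (N ∸ (4 ℕ.+ t)) !)))
              (cong +_ (nCk*k![n∸k]!≡n! (4+t≤N t<u)))))
          (Π<-const u (fac N)))
        -- N - (4 + t) = m - 1 - t: the second factorials of the denominators descend from (m - 1)!
        -- and meet the first ones, which ascend from 4!, without gap or overlap.
        reflect : ∀ {t} → t ℕ.< u → N ∸ (4 ℕ.+ t) ≡ 4 ℕ.+ (u ℕ.+ (u ∸ suc t))
        reflect {t} t<u = trans (cong (λ x → 3 ℕ.+ x ∸ t) (h*2≡h+h u))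
          (trans (ℕ.+-∸-assoc 4 {u ℕ.+ u} {suc t} (ℕ.≤-trans t<u (ℕ.m≤m+n u u)))
            (cong (4 ℕ.+_) (ℕ.+-∸-assoc u t<u)))
        F≡ : F ≡ Π< (u ℕ.* 2) f
        F≡ = trans (Π<-* u f (λ t → fac (N ∸ (4 ℕ.+ t)))) (trans
          (cong (_*_ (Π< u f)) (Π<-cong u {λ t → fac (N ∸ (4 ℕ.+ t))} {λ t → f (u ℕ.+ (u ∸ suc t))}
            λ t t<u → cong fac (reflect t<u)))
          (trans (sym (Π<-halves u f)) (cong (λ n → Π< n f) (sym (h*2≡h+h u)))))

      -- By skewness each entry is traded, up to sign, for its mirror image, whose `u` is the small
      -- index. There u = 0 and u = 1 carry the corrections N and -1, and those in t vanish because
      -- the mirrored row is at least h ≥ 2.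
      Q~ : Q ~ + (3 ℕ.+ m) * + (4 ℕ.+ m) * E * (+ 3 * P)
      Q~ = begin
        Q
          ≈⟨ Π<-~ h (λ t → coefficient N t (h ℕ.+ (h ∸ suc t))) (λ t → coefficient N (h ℕ.+ (h ∸ suc t)) t) (λ t t<h →
               ~-sym (~-trans (≈⇒~ (≈-reflexive (coefficient-skew h t (h ℕ.+ (h ∸ suc t)) (mirror-sum h t<h))))
                 (~-neg (coefficient N t (h ℕ.+ (h ∸ suc t)))))) ⟩
        coefficient N (h ℕ.+ suc u) 0 * (coefficient N (h ℕ.+ u) 1 *
          Π< u (λ t → coefficient N (h ℕ.+ (u ∸ suc t)) (2 ℕ.+ t)))
          ≈⟨ ~-* (≈⇒~ (≈-reflexive (simplify₀ C₂ (+ N)))) (~-*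
               (~-trans (≈⇒~ (≈-reflexive (simplify₁ C₃ (+ N)))) (~-neg (C₃ + 1ℤ)))
               (Π<-~ u (λ t → coefficient N (h ℕ.+ (u ∸ suc t)) (2 ℕ.+ t)) (λ t → + (N C (4 ℕ.+ t))) λ t _ → middle t)) ⟩
        (C₂ + + N) * ((C₃ + 1ℤ) * P)
          -- The square 36 splits as 2 · 6 · 3: the factors 2 and 6 clear the denominators of C(N,2)
          -- and C(N,3), and `binomials~` asks for the 3.
          ≈⟨ *-square~ ((C₂ + + N) * ((C₃ + 1ℤ) * P)) 6≉0 ⟨
        + 6 * + 6 * ((C₂ + + N) * ((C₃ + 1ℤ) * P))
          ≡⟨ regroup C₂ (+ N) C₃ P ⟩
        (+ 2 * C₂ + + 2 * + N) * (+ 6 * C₃ + + 6) * (+ 3 * P)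
          ≡⟨ cong₂ (λ a b → (a + + 2 * + N) * (b + + 6) * (+ 3 * P))
               (trans (sym (ℤ.pos-* 2 (N C 2))) (trans (cong +_ (2*NC2 m)) (ℤ.pos-* N (2 ℕ.+ m))))
               (trans (sym (ℤ.pos-* 6 (N C 3))) (trans (cong +_ (6*NC3 m))
                 (trans (ℤ.pos-* (N ℕ.* (2 ℕ.+ m)) (1 ℕ.+ m)) (cong (_* + (1 ℕ.+ m)) (ℤ.pos-* N (2 ℕ.+ m)))))) ⟩
        (+ N * + (2 ℕ.+ m) + + 2 * + N) * E * (+ 3 * P)
          ≡⟨ cong (λ x → x * E * (+ 3 * P)) (factor (+ N) (+ (2 ℕ.+ m))) ⟩
        + N * (+ 2 + + (2 ℕ.+ m)) * E * (+ 3 * P) ∎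
        where
        C₂ = + (N C 2)
        C₃ = + (N C 3)
        6≉0 : ¬ + 6 ≈ 0ℤ
        6≉0 = small≉0 (s≤s z≤n) (ℕ.≤-trans (ℕ.n≤1+n 6) (ℕ.m≤m+n 7 (u ℕ.* 2)))
        simplify₀ : ∀ C N → 1ℤ * C + (N * 1ℤ + - 0ℤ + (0ℤ + - (N * 0ℤ))) ≡ C + N
        simplify₀ = solve-∀
        simplify₁ : ∀ C N → -1ℤ * 1ℤ * C + (N * 0ℤ + - 1ℤ + (0ℤ + - (N * 0ℤ))) ≡ - (C + 1ℤ)
        simplify₁ = solve-∀
        middle : ∀ t → coefficient N (h ℕ.+ (u ∸ suc t)) (2 ℕ.+ t) ~ + (N C (4 ℕ.+ t))
        middle t = begin
          coefficient N (h ℕ.+ (u ∸ suc t)) (2 ℕ.+ t)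
            ≡⟨ simplify₂ (-1ℤ ^ t) (+ (N C (4 ℕ.+ t))) (+ N) ⟩
          -1ℤ ^ t * + (N C (4 ℕ.+ t))
            ≈⟨ squares≈⇒~ (≈-reflexive (trans (square (-1ℤ ^ t) (+ (N C (4 ℕ.+ t)))) (trans
                 (cong (_* (+ (N C (4 ℕ.+ t)) * + (N C (4 ℕ.+ t)))) (sgn² t))
                 (ℤ.*-identityˡ (+ (N C (4 ℕ.+ t)) * + (N C (4 ℕ.+ t))))))) ⟩
          + (N C (4 ℕ.+ t)) ∎
          where
          simplify₂ : ∀ s C N → -1ℤ * (-1ℤ * s) * C + (N * 0ℤ + - 0ℤ + (0ℤ + - (N * 0ℤ))) ≡ s * C
          simplify₂ = solve-∀
          square : ∀ s c → s * c * (s * c) ≡ s * s * (c * c)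
          square = solve-∀
        regroup : ∀ a n b P → + 6 * + 6 * ((a + n) * ((b + 1ℤ) * P)) ≡ (+ 2 * a + + 2 * n) * (+ 6 * b + + 6) * (+ 3 * P)
        regroup = solve-∀
        factor : ∀ n a → n * a + + 2 * n ≡ n * (+ 2 + a)
        factor = solve-∀

-- Evaluation by k m ≡ -1, and the case m = 2

module Conclusion (p : ℕ) (p-prime : Prime p) (e : ℕ) (p≡1+H*2 : p ≡ suc (suc e ℕ.* 2))
                 (G : ℕ) (H≡G*2 : suc e ≡ G ℕ.* 2) where
  open EvenEuler p p-prime e p≡1+H*2 G H≡G*2
  open import Relation.Binary.Reasoning.Setoid ~-setoid

  module _ (k u : ℕ) (k≥2 : 2 ≤ k) (p≡1+k*m : p ≡ suc (k ℕ.* ((2 ℕ.+ u) ℕ.* 2))) where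
    private
      m = (2 ℕ.+ u) ℕ.* 2
      N = 3 ℕ.+ m
      K = + k
      P = Π< u λ t → + (N C (4 ℕ.+ t))
      D = + ((m ∸ 1) !!)
      c = + 6 * K ^ 3 + (+ 3 * K - + 1) * (+ 2 * K - + 1) * (K - + 1)

    -- As m ≥ 4 and k ≥ 2, m + 4 ≤ 2m ≤ km = p - 1.
    N<p : N ℕ.< p
    N<p = subst (N ℕ.<_) (sym p≡1+k*m) (s≤s (ℕ.≤-trans
      (ℕ.≤-trans (ℕ.n≤1+n N) (ℕ.+-mono-≤ (ℕ.m≤m+n 4 (u ℕ.* 2)) (ℕ.m≤m+n m 0))) (ℕ.*-monoˡ-≤ m k≥2)))

    K≉0 : ¬ K ≈ 0ℤ
    K≉0 = +-≉0 (ℕ.<-trans (s≤s z≤n) k≥2) (subst (k ℕ.<_) (sym p≡1+k*m) (s≤s (ℕ.m≤m*n k m)))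

    K*m≈-1 : K * + m ≈ -1ℤ
    K*m≈-1 = -≈0⇒≈ (≈-trans (≈-reflexive (trans (ℤ.+-comm (K * + m) 1ℤ) (trans
      (cong (_+_ 1ℤ) (sym (ℤ.pos-* k m))) (cong +_ (sym p≡1+k*m))))) (∣⇒≈0 ℤ.∣-refl))

    -- The source of the linear factors of the formulas: 3k - 1 and 4k - 1 come from N and N + 1,
    -- and 2k - 1 from N - 1.
    K*[j+m] : ∀ j → K * + (j ℕ.+ m) ≈ + j * K - + 1
    K*[j+m] j = ≈-trans (≈-reflexive (distr K (+ j) (+ m))) (+-cong (≈-refl {+ j * K}) K*m≈-1)
      where
      distr : ∀ K j m → K * (j + m) ≡ j * K + K * m
      distr = solve-∀

    K*[1+m] : K * + (1 ℕ.+ m) ≈ K - + 1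
    K*[1+m] = ≈-trans (K*[j+m] 1) (≈-reflexive (cong (_- + 1) (ℤ.*-identityˡ K)))

    -- The source of the cubic factor: k³ (N(N-1)(N-2) + 6), with one k for each factor of the
    -- product.
    K³*E : K * K * K * E u ≈ c
    K³*E = ≈-trans (≈-reflexive (distr K (+ (3 ℕ.+ m)) (+ (2 ℕ.+ m)) (+ (1 ℕ.+ m))))
      (+-cong (≈-refl {+ 6 * K ^ 3}) (*-cong (*-cong (K*[j+m] 3) (K*[j+m] 2)) K*[1+m]))
      where
      distr : ∀ K a b c → K * K * K * (a * b * c + + 6) ≡ + 6 * (K * (K * (K * 1ℤ))) + K * a * (K * b) * (K * c)
      distr = solve-∀

    -- k⁶ is a square, so six factors k can be handed out: three to `E` and one to each linear
    -- factor. `Q~-even` has two linear factors, hence the extra k in its formula; `Q~-odd` has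
    -- three.
    K⁶* : ∀ a → K * K * K * (K * K * K) * a ~ a
    K⁶* a = *-square~ a (*-≉0 (*-≉0 K≉0 K≉0) K≉0)

    Q~′ : Q u ~ + (3 ℕ.+ m) * + (4 ℕ.+ m) * E u * (D * fac N ^ u)
    Q~′ = ~-trans (Q~ u N<p) (~-*ˡ (+ (3 ℕ.+ m) * + (4 ℕ.+ m) * E u) (binomials~ u N<p))

    D≉0 : ¬ D ≈ 0ℤ
    D≉0 D≈0 = fac≉0 u N<p {m} (ℕ.m≤n+m m 3) (≈-trans (≈-reflexive (trans (cong +_ (1+n!≡1+n!!*n!! (m ∸ 1))) (ℤ.pos-* (m !!) ((m ∸ 1) !!))))
      (≈-trans (*-congˡ (+ (m !!)) D≈0) (≈-reflexive (ℤ.*-zeroʳ (+ (m !!))))))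

    -- The power of N! has even exponent and drops out as a square.
    Q~-even : ∀ v → u ≡ v ℕ.* 2 → Q u ~ K * (+ 3 * K - + 1) * (+ 4 * K - + 1) * c * D
    Q~-even v u≡v*2 = begin
      Q u                              ≈⟨ Q~′ ⟩
      A * B * E u * (D * fac N ^ u)    ≈⟨ ~-*ˡ (A * B * E u) (~-*ˡ D (subst (λ u′ → fac N ^ u′ ~ 1ℤ) (sym u≡v*2)
                                            (^-even~1 v (fac≉0 u N<p {N} ℕ.≤-refl)))) ⟩
      A * B * E u * (D * 1ℤ)           ≈⟨ K⁶* (A * B * E u * (D * 1ℤ)) ⟨
      K * K * K * (K * K * K) * (A * B * E u * (D * 1ℤ))
                                       ≡⟨ regroup K A B (E u) D ⟩
      K * (K * A) * (K * B) * (K * K * K * E u) * D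
        ≈⟨ ≈⇒~ (*-congʳ D (*-cong (*-cong (*-congˡ K (K*[j+m] 3)) (K*[j+m] 4)) K³*E)) ⟩
      K * (+ 3 * K - + 1) * (+ 4 * K - + 1) * c * D ∎
      where
      A = + (3 ℕ.+ m)
      B = + (4 ℕ.+ m)
      regroup : ∀ K A B E D → K * K * K * (K * K * K) * (A * B * E * (D * 1ℤ)) ≡ K * (K * A) * (K * B) * (K * K * K * E) * D
      regroup = solve-∀

    -- One N! survives. It equals N (m+2) (m+1) m!! (m-1)!!, so N and (m-1)!! meet their copies in
    -- `Q~′` and drop out as squares, leaving (m+2) (m+1) m!!.
    Q~-odd : ∀ v → u ≡ suc (v ℕ.* 2) → Q u ~ (K - + 1) * (+ 2 * K - + 1) * (+ 4 * K - + 1) * c * + (m !!)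
    Q~-odd v u≡1+v*2 = begin
      Q u                              ≈⟨ Q~′ ⟩
      A * B * E u * (D * fac N ^ u)    ≡⟨ cong (λ u′ → A * B * E u * (D * fac N ^ u′)) u≡1+v*2 ⟩
      A * B * E u * (D * (fac N * fac N ^ (v ℕ.* 2)))
        ≈⟨ ~-*ˡ (A * B * E u) (~-*ˡ D (~-*ˡ (fac N) (^-even~1 v (fac≉0 u N<p {N} ℕ.≤-refl)))) ⟩
      A * B * E u * (D * (fac N * 1ℤ)) ≡⟨ cong (λ x → A * B * E u * (D * (x * 1ℤ))) fac-N ⟩
      A * B * E u * (D * (A * (+ (2 ℕ.+ m) * (+ (1 ℕ.+ m) * (+ (m !!) * D))) * 1ℤ))
        ≡⟨ regroup A B (E u) D (+ (2 ℕ.+ m)) (+ (1 ℕ.+ m)) (+ (m !!)) ⟩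
      A * D * (A * D) * (B * E u * + (2 ℕ.+ m) * + (1 ℕ.+ m) * + (m !!))
        ≈⟨ *-square~ (B * E u * + (2 ℕ.+ m) * + (1 ℕ.+ m) * + (m !!)) (*-≉0 (small≉0 u N<p (s≤s z≤n) ℕ.≤-refl) D≉0) ⟩
      B * E u * + (2 ℕ.+ m) * + (1 ℕ.+ m) * + (m !!)
        ≈⟨ K⁶* (B * E u * + (2 ℕ.+ m) * + (1 ℕ.+ m) * + (m !!)) ⟨
      K * K * K * (K * K * K) * (B * E u * + (2 ℕ.+ m) * + (1 ℕ.+ m) * + (m !!))
        ≡⟨ regroup′ K B (E u) (+ (2 ℕ.+ m)) (+ (1 ℕ.+ m)) (+ (m !!)) ⟩
      K * + (1 ℕ.+ m) * (K * + (2 ℕ.+ m)) * (K * B) * (K * K * K * E u) * + (m !!)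
        ≈⟨ ≈⇒~ (*-congʳ (+ (m !!)) (*-cong (*-cong (*-cong K*[1+m] (K*[j+m] 2)) (K*[j+m] 4)) K³*E)) ⟩
      (K - + 1) * (+ 2 * K - + 1) * (+ 4 * K - + 1) * c * + (m !!) ∎
      where
      A = + (3 ℕ.+ m)
      B = + (4 ℕ.+ m)
      fac-N : fac N ≡ A * (+ (2 ℕ.+ m) * (+ (1 ℕ.+ m) * (+ (m !!) * D)))
      fac-N = trans (ℤ.pos-* N ((2 ℕ.+ m) !)) (cong (_*_ A) (trans (ℤ.pos-* (2 ℕ.+ m) ((1 ℕ.+ m) !)) (cong (_*_ (+ (2 ℕ.+ m)))
        (trans (ℤ.pos-* (1 ℕ.+ m) (m !)) (cong (_*_ (+ (1 ℕ.+ m)))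
          (trans (cong +_ (1+n!≡1+n!!*n!! (m ∸ 1))) (ℤ.pos-* (m !!) ((m ∸ 1) !!))))))))
      regroup : ∀ A B E D b a M → A * B * E * (D * (A * (b * (a * (M * D))) * 1ℤ)) ≡ A * D * (A * D) * (B * E * b * a * M)
      regroup = solve-∀
      regroup′ : ∀ K B E b a M → K * K * K * (K * K * K) * (B * E * b * a * M) ≡ K * a * (K * b) * (K * B) * (K * K * K * E) * M
      regroup′ = solve-∀

    module _ (α : Vector ℤ m) (α≉0 : ∀ i → ¬ α i ≈ 0ℤ) (α^m≈1 : ∀ i → α i ^ m ≈ 1ℤ) where

      √S~ : √ (S N -1ℤ α) ~ Q u * T α
      √S~ = begin
        √ (S N -1ℤ α)  ≈⟨ squares≈⇒~ (≈-trans (≈-reflexive (√S² (2 ℕ.+ u) α)) (ReducedPowers.S≈square p (suc u) α α^m≈1)) ⟩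
        product (λ i → α i * α i) * T α * Q u   ≈⟨ ~-*ʳ (Q u) (~-*ʳ (T α) (product-squares~1 α α≉0)) ⟩
        1ℤ * T α * Q u                          ≡⟨ trans (cong (_* Q u) (ℤ.*-identityˡ (T α))) (ℤ.*-comm (T α) (Q u)) ⟩
        Q u * T α ∎

      legendre-√S : ∀ Z D → Q u ~ Z * D → legendre (√ (S N -1ℤ α)) p ≡ legendre Z p * legendre D p * legendre (T α) p
      legendre-√S Z D Q~ZD = trans (legendre-≡ (~-trans √S~ (~-*ʳ (T α) Q~ZD)))
        (trans (legendre-* (Z * D) (T α)) (cong (_* legendre (T α) p) (legendre-* Z D)))

  -- The matrix has rows (0, d^5) and (-d^5, 0), so S = d^10 with d = α₀ - α₁, and d^5 differs from
  -- d by a square.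
  legendre-√S₂ : (α : Vector ℤ 2) → ¬ α zero ≈ α (suc zero) → legendre (√ (S 5 -1ℤ α)) p ≡ legendre (T α) p
  legendre-√S₂ α α₀≉α₁ = legendre-≡ (begin
    √ (S 5 -1ℤ α)        ≈⟨ squares≈⇒~ (≈-reflexive (trans (√S² 1 α) det≡)) ⟩
    d ^ 5                ≡⟨ fifth d ⟩
    d * d * (d * d) * d  ≈⟨ *-square~ d (*-≉0 d≉0 d≉0) ⟩
    d                    ≈⟨ ~-neg d ⟨
    - d                  ≡⟨ Δ₂ (α zero) (α (suc zero)) ⟩
    Δ α                  ≈⟨ squares≈⇒~ (≈-reflexive (T²≡Δ² α)) ⟨
    T α                  ∎)
    where
    d = α zero + -1ℤ * α (suc zero)
    subtract : ∀ a b → a + -1ℤ * b ≡ a - b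
    subtract = solve-∀
    d≉0 : ¬ d ≈ 0ℤ
    d≉0 d≈0 = α₀≉α₁ (-≈0⇒≈ (≈-trans (≈-reflexive (sym (subtract (α zero) (α (suc zero))))) d≈0))
    det≡ : S 5 -1ℤ α ≡ d ^ 5 * d ^ 5
    det≡ = trans (det-hyperbolic (λ i j → (α i + -1ℤ * α j) ^ 5) (d ^ 5) (S-skew 1 α) refl (λ ()) (λ ()))
      (ℤ.*-identityʳ (d ^ 5 * d ^ 5))
    fifth : ∀ d → d * (d * (d * (d * (d * 1ℤ)))) ≡ d * d * (d * d) * d
    fifth = solve-∀
    Δ₂ : ∀ a b → - (a + -1ℤ * b) ≡ (b - a) * 1ℤ * (1ℤ * 1ℤ)
    Δ₂ = solve-∀

-- Power residues and the two congruence classes of p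

module Residues (p : ℕ) (p-prime : Prime p) {k M : ℕ} {α : Vector ℤ M} (k≥2 : 2 ≤ k)
                (residues : EnumeratesPowerResidues k p α) where
  open PrimeModulus p p-prime
  open EnumeratesPowerResidues residues

  residue-≉0 : ∀ i → ¬ α i ≈ 0ℤ
  residue-≉0 i α≈0 = proj₁ (residue i) (≈0⇒∣ α≈0)

  -- With α ≈ x^k this is Fermat's theorem for x, since km = p - 1.
  residue-^m≈1 : ∀ m → p ≡ suc (k ℕ.* m) → ∀ i → α i ^ m ≈ 1ℤ
  residue-^m≈1 m p≡1+k*m i = let x , x^k≡α = proj₂ (residue i); x^k≈α = mod {x ^ k} {α i} x^k≡α in
    ≈-trans (≈-sym (^-cong m x^k≈α)) (≈-trans (≈-reflexive (ℤ.^-*-assoc x k m))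
      (fermat′ p≡1+k*m λ x≈0 → residue-≉0 i (≈-trans (≈-sym x^k≈α) (0^k≈0 k≥2 x≈0))))
    where
    0^k≈0 : ∀ {k x} → 2 ≤ k → x ≈ 0ℤ → x ^ k ≈ 0ℤ
    0^k≈0 {suc k} {x} _ x≈0 = ≈-trans (*-congʳ (x ^ k) x≈0) (≈-reflexive (ℤ.*-zeroˡ (x ^ k)))

private
  cubic : ℕ → ℤ
  cubic k = + 6 * (+ k) ^ 3 + (+ 3 * + k - + 1) * (+ 2 * + k - + 1) * (+ k - + 1)

-- Here m = 4q and (p - 1)/2 = 2qk is even. The length `M` is a variable with an equation, so that
-- matching on `refl` can give the type of `α` the form `(2 + u) * 2`, where u = 2(q - 1) is even.
p≡1[mod4k] : ∀ p k M → Prime p → 2 ≤ k → (α : Vector ℤ M) → EnumeratesPowerResidues k p α →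
  ∀ q → p ≡ suc (q ℕ.* (4 ℕ.* k)) → M ≡ q ℕ.* 4 →
  legendre (√ (S (3 ℕ.+ M) -1ℤ α)) p
    ≡ legendre (+ k * (+ 3 * + k - + 1) * (+ 4 * + k - + 1) * cubic k) p * legendre (+ ((M ∸ 1) !!)) p * legendre (T α) p
p≡1[mod4k] p k M p-prime k≥2 α residues zero p≡1 M≡ = contradiction (subst Prime p≡1 p-prime) ¬prime[1]
p≡1[mod4k] p k@(suc k′) M p-prime k≥2 α residues (suc v) p≡ M≡ =
  from-even (trans M≡ (regroup₁ v)) α residues
  where
  regroup₁ : ∀ v → suc v ℕ.* 4 ≡ (2 ℕ.+ v ℕ.* 2) ℕ.* 2
  regroup₁ = ℕ-solve-∀
  regroup₂ : ∀ v k → suc v ℕ.* (4 ℕ.* k) ≡ (2 ℕ.+ v ℕ.* 2) ℕ.* k ℕ.* 2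
  regroup₂ = ℕ-solve-∀
  regroup₃ : ∀ v k → (2 ℕ.+ v ℕ.* 2) ℕ.* k ≡ suc v ℕ.* k ℕ.* 2
  regroup₃ = ℕ-solve-∀
  regroup₄ : ∀ v k → suc v ℕ.* (4 ℕ.* k) ≡ k ℕ.* ((2 ℕ.+ v ℕ.* 2) ℕ.* 2)
  regroup₄ = ℕ-solve-∀
  open Conclusion p p-prime (k′ ℕ.+ (1 ℕ.+ v ℕ.* 2) ℕ.* k) (trans p≡ (cong suc (regroup₂ v k)))
    (suc v ℕ.* k) (regroup₃ v k)
  p≡1+k*m : p ≡ suc (k ℕ.* ((2 ℕ.+ v ℕ.* 2) ℕ.* 2))
  p≡1+k*m = trans p≡ (cong suc (regroup₄ v k))
  from-even : ∀ {M} → M ≡ (2 ℕ.+ v ℕ.* 2) ℕ.* 2 → (α : Vector ℤ M) → EnumeratesPowerResidues k p α →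
    legendre (√ (S (3 ℕ.+ M) -1ℤ α)) p
      ≡ legendre (+ k * (+ 3 * + k - + 1) * (+ 4 * + k - + 1) * cubic k) p * legendre (+ ((M ∸ 1) !!)) p * legendre (T α) p
  from-even refl α residues = legendre-√S k (v ℕ.* 2) k≥2 p≡1+k*m α
    residue-≉0 (residue-^m≈1 ((2 ℕ.+ v ℕ.* 2) ℕ.* 2) p≡1+k*m)
    (+ k * (+ 3 * + k - + 1) * (+ 4 * + k - + 1) * cubic k) (+ ((3 ℕ.+ v ℕ.* 2 ℕ.* 2) !!))
    (Q~-even k (v ℕ.* 2) k≥2 p≡1+k*m v refl)
    where open Residues p p-prime {α = α} k≥2 residues

-- In this class (p - 1)/2 is an odd multiple of k, so p ≡ 1 modulo 4 comes from k being even.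
module _ (p k : ℕ) (p-prime : Prime p) (k≥2 : 2 ≤ k) (j : ℕ) (k≡j*2 : k ≡ j ℕ.* 2) where

  p≡2k+1 : ∀ {M} → p ≡ suc (2 ℕ.* k) → M ≡ 2 → (α : Vector ℤ M) → EnumeratesPowerResidues k p α →
           legendre (√ (S (3 ℕ.+ M) -1ℤ α)) p ≡ legendre (T α) p
  p≡2k+1 p≡ refl α residues = by-k k k≥2 p≡ k≡j*2
    where
    by-k : ∀ k → 2 ≤ k → p ≡ suc (2 ℕ.* k) → k ≡ j ℕ.* 2 → legendre (√ (S 5 -1ℤ α)) p ≡ legendre (T α) p
    by-k (suc k′) _ p≡ k≡ = legendre-√S₂ α λ { (mod α₀≡α₁) →
        contradiction (EnumeratesPowerResidues.distinct residues zero (suc zero) α₀≡α₁) λ () }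
      where
      open Modular p using (mod)
      open Conclusion p p-prime k′ (trans p≡ (cong suc (ℕ.*-comm 2 (suc k′)))) j k≡

  p≡2k+1[mod4k] : ∀ v {M} → p ≡ suc (2 ℕ.* k ℕ.+ suc v ℕ.* (4 ℕ.* k)) → M ≡ 2 ℕ.+ suc v ℕ.* 4 →
    (α : Vector ℤ M) → EnumeratesPowerResidues k p α →
    legendre (√ (S (3 ℕ.+ M) -1ℤ α)) p
      ≡ legendre ((+ k - + 1) * (+ 2 * + k - + 1) * (+ 4 * + k - + 1) * cubic k) p * legendre (+ (M !!)) p * legendre (T α) p
  p≡2k+1[mod4k] v {M} p≡ M≡ α residues = by-k k k≥2 p≡ k≡j*2 (trans M≡ (regroup₁ v)) α residues
    where
    regroup₁ : ∀ v → 2 ℕ.+ suc v ℕ.* 4 ≡ (3 ℕ.+ v ℕ.* 2) ℕ.* 2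
    regroup₁ = ℕ-solve-∀
    regroup₂ : ∀ v k → 2 ℕ.* k ℕ.+ suc v ℕ.* (4 ℕ.* k) ≡ (3 ℕ.+ v ℕ.* 2) ℕ.* k ℕ.* 2
    regroup₂ = ℕ-solve-∀
    regroup₃ : ∀ v j → (3 ℕ.+ v ℕ.* 2) ℕ.* (j ℕ.* 2) ≡ (3 ℕ.+ v ℕ.* 2) ℕ.* j ℕ.* 2
    regroup₃ = ℕ-solve-∀
    regroup₄ : ∀ v k → 2 ℕ.* k ℕ.+ suc v ℕ.* (4 ℕ.* k) ≡ k ℕ.* ((3 ℕ.+ v ℕ.* 2) ℕ.* 2)
    regroup₄ = ℕ-solve-∀
    by-k : ∀ k {M} → 2 ≤ k → p ≡ suc (2 ℕ.* k ℕ.+ suc v ℕ.* (4 ℕ.* k)) → k ≡ j ℕ.* 2 → M ≡ (3 ℕ.+ v ℕ.* 2) ℕ.* 2 →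
      (α : Vector ℤ M) → EnumeratesPowerResidues k p α →
      legendre (√ (S (3 ℕ.+ M) -1ℤ α)) p
        ≡ legendre ((+ k - + 1) * (+ 2 * + k - + 1) * (+ 4 * + k - + 1) * cubic k) p * legendre (+ (M !!)) p * legendre (T α) p
    by-k k@(suc k′) k≥2 p≡ k≡ refl α residues = legendre-√S k u k≥2 p≡1+k*m α
      residue-≉0 (residue-^m≈1 ((2 ℕ.+ u) ℕ.* 2) p≡1+k*m)
      ((+ k - + 1) * (+ 2 * + k - + 1) * (+ 4 * + k - + 1) * cubic k) (+ (((2 ℕ.+ u) ℕ.* 2) !!))
      (Q~-odd k u k≥2 p≡1+k*m v refl)
      where
      u = suc (v ℕ.* 2)
      open Residues p p-prime {α = α} k≥2 residues
      open Conclusion p p-prime (k′ ℕ.+ (2 ℕ.+ v ℕ.* 2) ℕ.* k) (trans p≡ (cong suc (regroup₂ v k)))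
        ((3 ℕ.+ v ℕ.* 2) ℕ.* j) (trans (cong ((3 ℕ.+ v ℕ.* 2) ℕ.*_) k≡) (regroup₃ v j))
      p≡1+k*m : p ≡ suc (k ℕ.* ((2 ℕ.+ u) ℕ.* 2))
      p≡1+k*m = trans p≡ (cong suc (regroup₄ v k))

∣-⇒∣∸ : ∀ {a m n} → n ≤ m → + a ℤ.∣ + m - + n → a ℕ.∣ m ∸ n
∣-⇒∣∸ {a} {m} {n} n≤m d = subst (λ x → a ℕ.∣ ∣ x ∣) (trans (ℤ.m-n≡m⊖n m n) (ℤ.⊖-≥ n≤m)) (ℤ.∣⇒∣ᵤ d)

theorem1p11 :
  (p k : ℕ) .{{_ : NonZero k}} →
  Prime p → ¬ (2 ℕ.∣ p) →
  2 ≤ k → k ≤ (p ∸ 1) / 2 →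
  + p ≡ 1ℤ [mod 2 ℕ.* k ] →
  (α : Vector ℤ ((p ∸ 1) / k)) → EnumeratesPowerResidues k p α →
  let m = (p ∸ 1) / k
      K = + k
      c = + 6 * K ^ 3 + (+ 3 * K - + 1) * (+ 2 * K - + 1) * (K - + 1)
  in
  ( + p ≡ 1ℤ [mod 4 ℕ.* k ] →
    legendre (√ (S (3 ℕ.+ m) -1ℤ α)) p
      ≡ legendre (K * (+ 3 * K - + 1) * (+ 4 * K - + 1) * c) p
        * legendre (+ ((m ∸ 1) !!)) p
        * legendre (T α) p )
  ×
  ( 2 ℕ.∣ k → + p ≡ + (2 ℕ.* k ℕ.+ 1) [mod 4 ℕ.* k ] →
    ( p ≡ 2 ℕ.* k ℕ.+ 1 →
      legendre (√ (S (3 ℕ.+ m) -1ℤ α)) p ≡ legendre (T α) p )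
    ×
    ( p ≢ 2 ℕ.* k ℕ.+ 1 →
      legendre (√ (S (3 ℕ.+ m) -1ℤ α)) p
        ≡ legendre ((K - + 1) * (+ 2 * K - + 1) * (+ 4 * K - + 1) * c) p
          * legendre (+ (m !!)) p
          * legendre (T α) p ) )
theorem1p11 p k p-prime _ k≥2 k≤[p-1]/2 _ α residues =
    (λ p≡1 → let ℕ.divides q p-1≡ = ∣-⇒∣∸ {4 ℕ.* k} {p} {1} (ℕ.>-nonZero⁻¹ p) p≡1 in
      p≡1[mod4k] p k m p-prime k≥2 α residues q (trans p≡1+[p-1] (cong suc p-1≡))
        (m≡ (trans p-1≡ (sym (ℕ.*-assoc q 4 k)))))
  , λ 2∣k p≡1+2k →
      let ℕ.divides j k≡j*2 = 2∣k
          ℕ.divides q p-1-2k≡ = ∣-⇒∣∸ {4 ℕ.* k} {p} {2 ℕ.* k ℕ.+ 1} 2k+1≤p p≡1+2k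
      in (λ p≡2k+1′ → let p≡ = trans p≡2k+1′ (ℕ.+-comm (2 ℕ.* k) 1) in
           p≡2k+1 p k p-prime k≥2 j k≡j*2 p≡ (m≡ (cong (_∸ 1) p≡)) α residues)
       , λ p≢2k+1 → by-quotient j k≡j*2 q (p-as-sum p-1-2k≡) p≢2k+1
  where
  m = (p ∸ 1) / k
  instance
    p≢0 : NonZero p
    p≢0 = prime⇒nonZero p-prime
  p≡1+[p-1] : p ≡ suc (p ∸ 1)
  p≡1+[p-1] = sym (ℕ.suc-pred p)
  m≡ : ∀ {a} → p ∸ 1 ≡ a ℕ.* k → m ≡ a
  m≡ {a} p-1≡a*k = trans (cong (_/ k) p-1≡a*k) (m*n/n≡m a k)
  -- Makes `p ∸ (2k + 1)` a true difference and thus a natural multiple q of 4k; q = 0 is the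
  -- exceptional prime p = 2k + 1.
  2k+1≤p : 2 ℕ.* k ℕ.+ 1 ≤ p
  2k+1≤p = subst₂ _≤_ (trans (cong suc (ℕ.*-comm k 2)) (ℕ.+-comm 1 (2 ℕ.* k))) (sym p≡1+[p-1])
    (s≤s (ℕ.≤-trans (ℕ.*-monoˡ-≤ 2 k≤[p-1]/2) (m/n*n≤m (p ∸ 1) 2)))
  p-as-sum : ∀ {a} → p ∸ (2 ℕ.* k ℕ.+ 1) ≡ a → p ≡ suc (2 ℕ.* k ℕ.+ a)
  p-as-sum {a} eq = trans (sym (ℕ.m+[n∸m]≡n 2k+1≤p)) (trans (cong (2 ℕ.* k ℕ.+ 1 ℕ.+_) eq)
    (cong (ℕ._+ a) (ℕ.+-comm (2 ℕ.* k) 1)))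
  by-quotient : ∀ j → k ≡ j ℕ.* 2 → ∀ q → p ≡ suc (2 ℕ.* k ℕ.+ q ℕ.* (4 ℕ.* k)) → p ≢ 2 ℕ.* k ℕ.+ 1 →
    legendre (√ (S (3 ℕ.+ m) -1ℤ α)) p
      ≡ legendre ((+ k - + 1) * (+ 2 * + k - + 1) * (+ 4 * + k - + 1) * cubic k) p * legendre (+ (m !!)) p * legendre (T α) p
  by-quotient j k≡j*2 zero    p≡ p≢2k+1 = contradiction
    (trans p≡ (trans (cong suc (ℕ.+-identityʳ (2 ℕ.* k))) (ℕ.+-comm 1 (2 ℕ.* k)))) p≢2k+1
  by-quotient j k≡j*2 (suc v) p≡ _ = p≡2k+1[mod4k] p k p-prime k≥2 j k≡j*2 v p≡
    (m≡ (trans (cong (_∸ 1) p≡) (regroup v k))) α residues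
    where
    regroup : ∀ v k → 2 ℕ.* k ℕ.+ suc v ℕ.* (4 ℕ.* k) ≡ (2 ℕ.+ suc v ℕ.* 4) ℕ.* k
    regroup = ℕ-solve-∀
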